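{- Let $n\in\omega$ be fixed. Let $T$ be a consistent first-order theory formulated in a finite language $\mathcal{L}$ such that $T$ is sequential and $T$ is axiomatized by a set of $\Sigma_n^{*}$-sentences (i.e., there is a set $A$ of $\Sigma_n^{*}$-sentences of $\mathcal{L}$ such that for every $\mathcal{L}$-sentence $\psi$, $\psi\in T$ iff $A\vdash\psi$). Then $T$ is incomplete, i.e., there is an $\mathcal{L}$-sentence $\psi$ such that neither $T\vdash\psi$ nor $T\vdash\neg\psi$.
   Context: A theory $T$ is sequential if there is a formula $N(x)$, together with formulae providing interpretations of equality and of successor, addition and multiplication on the elements satisfying $N(x)$, such that $T$ proves the translations of the axioms of Robinson's arithmetic $\mathsf{Q}$ relativized to $N$; and additionally there is a formula $\beta(x,i,w)$ (intended meaning: $x$ is the $i$-th element of the sequence $w$) such that $T$ proves $\forall w,x,k\ \exists w'\ \forall i,y\ [ (N(k)\wedge i\le k)\rightarrow (\beta(y,i,w')\leftrightarrow [(i<k\wedge\beta(y,i,w))\vee(i=k\wedge y=x)])]$. The classes $\Sigma_n^{*},\Pi_n^{*}$ measure depth of quantifier alternation (not requiring prenex form): $\Sigma_0^{*}=\Pi_0^{*}$ consists of the quantifier-free formulae; $\Sigma_{n+1}^{*}$ is the smallest class containing $\Pi_n^{*}$ (hence $\Sigma_n^*$) and closed under $\wedge$, $\vee$, existential quantification, under forming $\neg\varphi$ for $\varphi\in\Pi_{n+1}^{*}$, and under forming $\varphi\to\psi$ for $\varphi\in\Pi_{n+1}^{*}$, $\psi\in\Sigma_{n+1}^{*}$; $\Pi_{n+1}^{*}$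 is defined dually (containing $\Sigma_n^{*}$, closed under $\wedge$, $\vee$, universal quantification, $\neg\varphi$ for $\varphi\in\Sigma_{n+1}^{*}$, and $\varphi\to\psi$ for $\varphi\in\Sigma_{n+1}^{*}$, $\psi\in\Pi_{n+1}^{*}$). -}

module Defs where

open import Data.Nat using (ℕ; zero; suc; _<ᵇ_)
open import Data.Fin using (Fin)
open import Data.Vec using (Vec; []; _∷_)
open import Data.List using (List; []; _∷_; map)
open import Data.List.Membership.Propositional using (_∈_)
open import Data.List.Relation.Unary.All using (All)
open import Data.Bool using (Bool; true; false; _∧_) renaming (T to True)
open import Data.Product using (Σ; _×_)
open import Function using (_∘_)

-- Finite first-order languages (with equality as a logical symbol).
-- Finitely many function symbols (constants = 0-ary functions) and
-- finitely many relation symbols, each with an arity.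

record Lang : Set where
  field
    nFun     : ℕ
    funArity : Fin nFun → ℕ
    nRel     : ℕ
    relArity : Fin nRel → ℕ
open Lang public

-- Syntax (de Bruijn variables: var 0 is bound by the innermost quantifier)

module _ (L : Lang) where

  data Term : Set where
    var : ℕ → Term
    fun : (f : Fin (nFun L)) → Vec Term (funArity L f) → Term

  infix  7 _≐_
  infixr 6 _∧'_
  infixr 5 _∨'_
  infixr 4 _⇒'_

  data Formula : Set where
    ⊥'    : Formula
    rel   : (r : Fin (nRel L)) → Vec Term (relArity L r) → Formula
    _≐_   : Term → Term → Formula
    ¬'    : Formula → Formula
    _∧'_  : Formula → Formula → Formula
    _∨'_  : Formula → Formula → Formula
    _⇒'_  : Formula → Formula → Formula
    ∀'    : Formula → Formula
    ∃'    : Formula → Formula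

module _ {L : Lang} where

  infixr 3 _⇔'_
  _⇔'_ : Formula L → Formula L → Formula L
  φ ⇔' ψ = (φ ⇒' ψ) ∧' (ψ ⇒' φ)

  mutual
    substT : (ℕ → Term L) → Term L → Term L
    substT σ (var i)    = σ i
    substT σ (fun f ts) = fun f (substTs σ ts)

    substTs : ∀ {k} → (ℕ → Term L) → Vec (Term L) k → Vec (Term L) k
    substTs σ []       = []
    substTs σ (t ∷ ts) = substT σ t ∷ substTs σ ts

  shiftT : Term L → Term L
  shiftT = substT (λ i → var (suc i))

  liftσ : (ℕ → Term L) → ℕ → Term L
  liftσ σ zero    = var zero
  liftσ σ (suc i) = shiftT (σ i)

  subst : (ℕ → Term L) → Formula L → Formula L
  subst σ ⊥'         = ⊥'
  subst σ (rel r ts) = rel r (substTs σ ts)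
  subst σ (s ≐ t)    = substT σ s ≐ substT σ t
  subst σ (¬' φ)     = ¬' (subst σ φ)
  subst σ (φ ∧' ψ)   = subst σ φ ∧' subst σ ψ
  subst σ (φ ∨' ψ)   = subst σ φ ∨' subst σ ψ
  subst σ (φ ⇒' ψ)   = subst σ φ ⇒' subst σ ψ
  subst σ (∀' φ)     = ∀' (subst (liftσ σ) φ)
  subst σ (∃' φ)     = ∃' (subst (liftσ σ) φ)

  shift : Formula L → Formula L
  shift = subst (λ i → var (suc i))

  infixr 5 _∷σ_
  _∷σ_ : Term L → (ℕ → Term L) → ℕ → Term L
  (t ∷σ σ) zero    = t
  (t ∷σ σ) (suc i) = σ i

  infix 8 _[_]
  _[_] : Formula L → Term L → Formula L
  φ [ t ] = subst (t ∷σ var) φ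

  listσ : List (Term L) → ℕ → Term L
  listσ []       i       = var i
  listσ (t ∷ ts) zero    = t
  listσ (t ∷ ts) (suc i) = listσ ts i

  infix 8 _⟨_⟩
  _⟨_⟩ : Formula L → List (Term L) → Formula L
  φ ⟨ ts ⟩ = subst (listσ ts) φ

  mutual
    boundT : ℕ → Term L → Bool
    boundT k (var i)    = i <ᵇ k
    boundT k (fun f ts) = boundTs k ts

    boundTs : ∀ {m} → ℕ → Vec (Term L) m → Bool
    boundTs k []       = true
    boundTs k (t ∷ ts) = boundT k t ∧ boundTs k ts

  bound : ℕ → Formula L → Bool
  bound k ⊥'         = true
  bound k (rel r ts) = boundTs k ts
  bound k (s ≐ t)    = boundT k s ∧ boundT k t
  bound k (¬' φ)     = bound k φ
  bound k (φ ∧' ψ)   = bound k φ ∧ bound k ψ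
  bound k (φ ∨' ψ)   = bound k φ ∧ bound k ψ
  bound k (φ ⇒' ψ)   = bound k φ ∧ bound k ψ
  bound k (∀' φ)     = bound (suc k) φ
  bound k (∃' φ)     = bound (suc k) φ

  FVBelow : ℕ → Formula L → Set
  FVBelow k φ = True (bound k φ)

  Sentence : Formula L → Set
  Sentence = FVBelow 0

  infix 2 _⊢_
  data _⊢_ : List (Formula L) → Formula L → Set where
    hyp    : ∀ {Γ φ} → φ ∈ Γ → Γ ⊢ φ
    raa    : ∀ {Γ φ} → (¬' φ ∷ Γ) ⊢ ⊥' → Γ ⊢ φ
    ∧I     : ∀ {Γ φ ψ} → Γ ⊢ φ → Γ ⊢ ψ → Γ ⊢ φ ∧' ψ
    ∧E₁    : ∀ {Γ φ ψ} → Γ ⊢ φ ∧' ψ → Γ ⊢ φ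
    ∧E₂    : ∀ {Γ φ ψ} → Γ ⊢ φ ∧' ψ → Γ ⊢ ψ
    ∨I₁    : ∀ {Γ φ ψ} → Γ ⊢ φ → Γ ⊢ φ ∨' ψ
    ∨I₂    : ∀ {Γ φ ψ} → Γ ⊢ ψ → Γ ⊢ φ ∨' ψ
    ∨E     : ∀ {Γ φ ψ χ} → Γ ⊢ φ ∨' ψ → (φ ∷ Γ) ⊢ χ → (ψ ∷ Γ) ⊢ χ → Γ ⊢ χ
    ⇒I     : ∀ {Γ φ ψ} → (φ ∷ Γ) ⊢ ψ → Γ ⊢ φ ⇒' ψ
    ⇒E     : ∀ {Γ φ ψ} → Γ ⊢ φ ⇒' ψ → Γ ⊢ φ → Γ ⊢ ψ
    ¬I     : ∀ {Γ φ} → (φ ∷ Γ) ⊢ ⊥' → Γ ⊢ ¬' φ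
    ¬E     : ∀ {Γ φ} → Γ ⊢ ¬' φ → Γ ⊢ φ → Γ ⊢ ⊥'
    ∀I     : ∀ {Γ φ} → map shift Γ ⊢ φ → Γ ⊢ ∀' φ
    ∀E     : ∀ {Γ φ} → Γ ⊢ ∀' φ → (t : Term L) → Γ ⊢ φ [ t ]
    ∃I     : ∀ {Γ φ} (t : Term L) → Γ ⊢ φ [ t ] → Γ ⊢ ∃' φ
    ∃E     : ∀ {Γ φ ψ} → Γ ⊢ ∃' φ → (φ ∷ map shift Γ) ⊢ shift ψ → Γ ⊢ ψ
    ≐refl  : ∀ {Γ} (t : Term L) → Γ ⊢ t ≐ t
    ≐subst : ∀ {Γ φ s t} → Γ ⊢ s ≐ t → Γ ⊢ φ [ s ] → Γ ⊢ φ [ t ]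

  Proves : (Formula L → Set) → Formula L → Set
  Proves T ψ = Σ (List (Formula L)) λ Γ → All T Γ × (Γ ⊢ ψ)

  Consistent : (Formula L → Set) → Set
  Consistent T = Proves T ⊥' → Data.Empty.⊥
    where import Data.Empty

  data QFree : Formula L → Set where
    qf⊥   : QFree ⊥'
    qfrel : ∀ r ts → QFree (rel r ts)
    qf≐   : ∀ s t → QFree (s ≐ t)
    qf¬   : ∀ {φ} → QFree φ → QFree (¬' φ)
    qf∧   : ∀ {φ ψ} → QFree φ → QFree ψ → QFree (φ ∧' ψ)
    qf∨   : ∀ {φ ψ} → QFree φ → QFree ψ → QFree (φ ∨' ψ)
    qf⇒   : ∀ {φ ψ} → QFree φ → QFree ψ → QFree (φ ⇒' ψ)

  data Σ* : ℕ → Formula L → Set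
  data Π* : ℕ → Formula L → Set

  data Σ* where
    qf   : ∀ {φ} → QFree φ → Σ* zero φ
    π    : ∀ {n φ} → Π* n φ → Σ* (suc n) φ
    and  : ∀ {n φ ψ} → Σ* (suc n) φ → Σ* (suc n) ψ → Σ* (suc n) (φ ∧' ψ)
    or   : ∀ {n φ ψ} → Σ* (suc n) φ → Σ* (suc n) ψ → Σ* (suc n) (φ ∨' ψ)
    ex   : ∀ {n φ} → Σ* (suc n) φ → Σ* (suc n) (∃' φ)
    neg  : ∀ {n φ} → Π* (suc n) φ → Σ* (suc n) (¬' φ)
    imp  : ∀ {n φ ψ} → Π* (suc n) φ → Σ* (suc n) ψ → Σ* (suc n) (φ ⇒' ψ)

  data Π* where
    qf   : ∀ {φ} → QFree φ → Π* zero φ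
    σ    : ∀ {n φ} → Σ* n φ → Π* (suc n) φ
    and  : ∀ {n φ ψ} → Π* (suc n) φ → Π* (suc n) ψ → Π* (suc n) (φ ∧' ψ)
    or   : ∀ {n φ ψ} → Π* (suc n) φ → Π* (suc n) ψ → Π* (suc n) (φ ∨' ψ)
    all  : ∀ {n φ} → Π* (suc n) φ → Π* (suc n) (∀' φ)
    neg  : ∀ {n φ} → Σ* (suc n) φ → Π* (suc n) (¬' φ)
    imp  : ∀ {n φ ψ} → Σ* (suc n) φ → Π* (suc n) ψ → Π* (suc n) (φ ⇒' ψ)

infixl 7 _q×_
infixl 6 _q+_
infix  5 _q=_
infixr 4 _q∧_
infixr 3 _q⇒_

data QTerm : Set where
  qv   : ℕ → QTerm
  q0   : QTerm
  qS   : QTerm → QTerm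
  _q+_ : QTerm → QTerm → QTerm
  _q×_ : QTerm → QTerm → QTerm

data QForm : Set where
  q⊥   : QForm
  _q=_ : QTerm → QTerm → QForm
  q¬   : QForm → QForm
  _q∧_ : QForm → QForm → QForm
  q∨   : QForm → QForm → QForm
  _q⇒_ : QForm → QForm → QForm
  q∀   : QForm → QForm
  q∃   : QForm → QForm

qLe : ℕ → ℕ → QForm
qLe i j = q∃ (qv 0 q+ qv (suc i) q= qv (suc j))

qLt : ℕ → ℕ → QForm
qLt i j = qLe i j q∧ q¬ (qv i q= qv j)

-- The axioms of Q, together with the equality axioms of the language of
-- arithmetic and the well-definedness (totality and uniqueness) of the
-- function symbols 0, S, +, ×. (The latter two groups are what is needed
-- for the relational translation below to be an interpretation.)
data QAxiom⁺ : QForm → Set where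
  Q1 : QAxiom⁺ (q∀ (q¬ (qS (qv 0) q= q0)))
  Q2 : QAxiom⁺ (q∀ (q∀ (qS (qv 1) q= qS (qv 0) q⇒ qv 1 q= qv 0)))
  Q3 : QAxiom⁺ (q∀ (q¬ (qv 0 q= q0) q⇒ q∃ (qv 1 q= qS (qv 0))))
  Q4 : QAxiom⁺ (q∀ (qv 0 q+ q0 q= qv 0))
  Q5 : QAxiom⁺ (q∀ (q∀ (qv 1 q+ qS (qv 0) q= qS (qv 1 q+ qv 0))))
  Q6 : QAxiom⁺ (q∀ (qv 0 q× q0 q= q0))
  Q7 : QAxiom⁺ (q∀ (q∀ (qv 1 q× qS (qv 0) q= qv 1 q× qv 0 q+ qv 1)))
  E1 : QAxiom⁺ (q∀ (qv 0 q= qv 0))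
  E2 : QAxiom⁺ (q∀ (q∀ (q∀ (q∀ (qv 3 q= qv 2 q∧ qv 1 q= qv 0 q⇒ (qv 3 q= qv 1 q⇒ qv 2 q= qv 0))))))
  E3 : QAxiom⁺ (q∀ (q∀ (qv 1 q= qv 0 q⇒ qS (qv 1) q= qS (qv 0))))
  E4 : QAxiom⁺ (q∀ (q∀ (q∀ (q∀ (qv 3 q= qv 2 q∧ qv 1 q= qv 0 q⇒ qv 3 q+ qv 1 q= qv 2 q+ qv 0)))))
  E5 : QAxiom⁺ (q∀ (q∀ (q∀ (q∀ (qv 3 q= qv 2 q∧ qv 1 q= qv 0 q⇒ qv 3 q× qv 1 q= qv 2 q× qv 0)))))
  F0 : QAxiom⁺ (q∃ (q0 q= qv 0))
  U0 : QAxiom⁺ (q∀ (q∀ (q0 q= qv 1 q∧ q0 q= qv 0 q⇒ qv 1 q= qv 0)))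
  FS : QAxiom⁺ (q∀ (q∃ (qS (qv 1) q= qv 0)))
  US : QAxiom⁺ (q∀ (q∀ (q∀ (qS (qv 2) q= qv 1 q∧ qS (qv 2) q= qv 0 q⇒ qv 1 q= qv 0))))
  F+ : QAxiom⁺ (q∀ (q∀ (q∃ (qv 2 q+ qv 1 q= qv 0))))
  U+ : QAxiom⁺ (q∀ (q∀ (q∀ (q∀ (qv 3 q+ qv 2 q= qv 1 q∧ qv 3 q+ qv 2 q= qv 0 q⇒ qv 1 q= qv 0)))))
  F× : QAxiom⁺ (q∀ (q∀ (q∃ (qv 2 q× qv 1 q= qv 0))))
  U× : QAxiom⁺ (q∀ (q∀ (q∀ (q∀ (qv 3 q× qv 2 q= qv 1 q∧ qv 3 q× qv 2 q= qv 0 q⇒ qv 1 q= qv 0)))))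

record QInterp (L : Lang) : Set where
  field
    Dom  : Formula L   -- N(x₀)
    Eq   : Formula L   -- x₀ = x₁
    Zero : Formula L   -- x₀ = 0
    Succ : Formula L   -- S x₀ = x₁
    Add  : Formula L   -- x₀ + x₁ = x₂
    Mul  : Formula L   -- x₀ × x₁ = x₂

module _ {L : Lang} (I : QInterp L) where
  open QInterp I

  private
    #_ : ℕ → Term L
    # i = var i
    sh2 : Term L → Term L
    sh2 = shiftT ∘ shiftT

  -- gr t ρ u : "the value of t (free Q-variables evaluated by ρ) is u"
  gr : QTerm → (ℕ → Term L) → Term L → Formula L
  gr (qv i)    ρ u = ρ i ≐ u
  gr q0        ρ u = Zero ⟨ u ∷ [] ⟩
  gr (qS t)    ρ u = ∃' (Dom ⟨ # 0 ∷ [] ⟩ ∧' gr t (shiftT ∘ ρ) (# 0)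
                         ∧' Succ ⟨ # 0 ∷ shiftT u ∷ [] ⟩)
  gr (t q+ s)  ρ u = ∃' (∃' (Dom ⟨ # 1 ∷ [] ⟩ ∧' Dom ⟨ # 0 ∷ [] ⟩
                         ∧' gr t (sh2 ∘ ρ) (# 1) ∧' gr s (sh2 ∘ ρ) (# 0)
                         ∧' Add ⟨ # 1 ∷ # 0 ∷ sh2 u ∷ [] ⟩))
  gr (t q× s)  ρ u = ∃' (∃' (Dom ⟨ # 1 ∷ [] ⟩ ∧' Dom ⟨ # 0 ∷ [] ⟩
                         ∧' gr t (sh2 ∘ ρ) (# 1) ∧' gr s (sh2 ∘ ρ) (# 0)
                         ∧' Mul ⟨ # 1 ∷ # 0 ∷ sh2 u ∷ [] ⟩))

  tr : QForm → (ℕ → Term L) → Formula L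
  tr q⊥        ρ = ⊥'
  tr (t q= s)  ρ = ∃' (∃' (Dom ⟨ # 1 ∷ [] ⟩ ∧' Dom ⟨ # 0 ∷ [] ⟩
                         ∧' gr t (sh2 ∘ ρ) (# 1) ∧' gr s (sh2 ∘ ρ) (# 0)
                         ∧' Eq ⟨ # 1 ∷ # 0 ∷ [] ⟩))
  tr (q¬ φ)    ρ = ¬' (tr φ ρ)
  tr (φ q∧ ψ)  ρ = tr φ ρ ∧' tr ψ ρ
  tr (q∨ φ ψ)  ρ = tr φ ρ ∨' tr ψ ρ
  tr (φ q⇒ ψ)  ρ = tr φ ρ ⇒' tr ψ ρ
  tr (q∀ φ)    ρ = ∀' (Dom ⟨ # 0 ∷ [] ⟩ ⇒' tr φ (# 0 ∷σ (shiftT ∘ ρ)))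
  tr (q∃ φ)    ρ = ∃' (Dom ⟨ # 0 ∷ [] ⟩ ∧' tr φ (# 0 ∷σ (shiftT ∘ ρ)))

  -- The sequence axiom for β(x, i, w) (free variables x = 0, i = 1, w = 2):
  -- ∀w ∀x ∀k ∃w' ∀i ∀y [ (N(k) ∧ i ≤ k) →
  --     (β(y,i,w') ↔ [(i < k ∧ β(y,i,w)) ∨ (i = k ∧ y = x)]) ]
  -- de Bruijn indices inside: y = 0, i = 1, w' = 2, k = 3, x = 4, w = 5.
  private
    ρik : ℕ → Term L
    ρik = listσ (# 1 ∷ # 3 ∷ [])

  seqAxiom : Formula L → Formula L
  seqAxiom β = ∀' (∀' (∀' (∃' (∀' (∀' (
      (Dom ⟨ # 3 ∷ [] ⟩ ∧' tr (qLe 0 1) ρik)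
      ⇒' (β ⟨ # 0 ∷ # 1 ∷ # 2 ∷ [] ⟩
          ⇔' ((tr (qLt 0 1) ρik ∧' β ⟨ # 0 ∷ # 1 ∷ # 5 ∷ [] ⟩)
              ∨' (tr (qv 0 q= qv 1) ρik ∧' (# 0 ≐ # 4))))))))))

record Sequential {L : Lang} (T : Formula L → Set) : Set where
  field
    interp   : QInterp L
    β        : Formula L
    DomFV    : FVBelow 1 (QInterp.Dom interp)
    EqFV     : FVBelow 2 (QInterp.Eq interp)
    ZeroFV   : FVBelow 1 (QInterp.Zero interp)
    SuccFV   : FVBelow 2 (QInterp.Succ interp)
    AddFV    : FVBelow 3 (QInterp.Add interp)
    MulFV    : FVBelow 3 (QInterp.Mul interp)
    βFV      : FVBelow 3 β
    interprets : ∀ φ → QAxiom⁺ φ → Proves T (tr interp φ var)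
    sequence   : Proves T (seqAxiom interp β)

{-# OPTIONS --safe #-}
module Submission where

open import Defs
open import Data.Bool using (Bool; _∧_; _∨_; false; if_then_else_; not; true) renaming (T to True)
open import Data.Bool.Properties using (T-∧)
open import Data.Empty using (⊥; ⊥-elim)
open import Data.Fin using (#_; Fin; fromℕ<; toℕ) renaming (suc to fsuc; zero to fzero)
open import Data.Fin.Properties using (fromℕ<-toℕ; toℕ-injective; toℕ<n)
open import Data.List using (List; []; _++_; _∷_; length; map)
open import Data.List.Membership.Propositional using (_∈_)
open import Data.List.Membership.Propositional.Properties using (∈-++⁺ʳ; ∈-++⁺ˡ; ∈-allFin; ∈-concat⁺′; ∈-lookup; ∈-map⁺; ∈-map⁻; ∈-upTo⁺)
open import Data.List.Properties using (map-cong; map-∘)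
open import Data.List.Relation.Binary.Subset.Propositional using (_⊆_)
open import Data.List.Relation.Binary.Subset.Propositional.Properties using (map⁺; xs⊆xs++ys; xs⊆ys++xs; ∷⁺ʳ)
open import Data.List.Relation.Unary.All using (All; []; _∷_)
open import Data.List.Relation.Unary.Any using (Any; here; there)
open import Data.Nat using (_+_; _<?_; _<_; _<ᵇ_; _∸_; _≟_; _≡ᵇ_; _≤_; _⊔_; pred; suc; s≤s; zero; z≤n; ℕ)
open import Data.Nat.Properties using (+-identityʳ; +-suc; <-irrefl; <-≤-trans; <ᵇ⇒<; <⇒<ᵇ; m+[n∸m]≡n; m≤m+n; m≤m⊔n; m≤n+m; m≤n⇒m<n∨m≡n; m≤n⇒m≤1+n; m≤n⊔m; n<1+n; n≤1+n; ≡⇒≡ᵇ; ≤-refl; ≤-trans; ≮⇒≥)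
open import Data.Product using (_,_; _×_; proj₁; proj₂; Σ; Σ-syntax)
open import Data.Sum using (_⊎_; inj₁; inj₂)
open import Data.Unit using (tt; ⊤)
open import Data.Vec using (Vec; []; _∷_; allFin; lookup; replicate)
open import Function using (_∘_; case_of_; id)
open import Function.Bundles using (Equivalence)
open import Relation.Binary.PropositionalEquality using (_≡_; cong; cong₂; refl; sym; trans) renaming (subst to ≡-subst)
open import Relation.Nullary using (no; yes; ¬_)
import Data.List as List
import Data.List.Relation.Unary.All as All
import Data.List.Relation.Unary.All.Properties as All
import Data.List.Relation.Unary.Any as Any
import Data.List.Relation.Unary.Any.Properties as Any
import Data.Vec as Vec
import Data.Vec.Properties as Vec

-- A Rosser argument, with provability from true Σ*ₙ-sentences in place of provability. A sequential
-- theory has, for each n, a formula defining truth of all standard Σ*ₙ-sentences, so there is a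
-- sentence ψ saying "for every p, if some true Σ*ₙ-sentence proves ψ with rank p, then some true
-- Σ*ₙ-sentence refutes ψ with rank q ≤ p". Let M ⊨ T. If T ⊢ ψ, then α ⊢ ψ for some α ∈ Σ*ₙ true in M,
-- with standard rank; hence M has a refutation of standard rank, whose premise is a standard sentence
-- true in M. It is therefore genuine, and M refutes ψ as well. Dually if T ⊢ ¬ ψ, as every number of M
-- is comparable with each standard one. Neither completeness nor enumerability of T is used, so ψ is
-- explicit and the proof constructive: M is a Henkin model whose truth is ¬¬-stable, and the standard
-- objects found in it are only ever needed to derive a contradiction.

-- Substitution and derivations

-- Robinson's arithmetic has no induction, and the sequence axiom gives sequences neither lengths
-- nor uniqueness. So every induction runs outside M, over standard formulas, ranks and numerals,
-- while inside M a derivation is only ever inverted step by step. This is why a derivation may be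
-- coded as a set each of whose members follows from others, with no demand of well-foundedness, and
-- why one format of clauses serves both the truth predicates and the proof predicate. Truth facts
-- need no further control, since their premises concern subformulas. Premises of an inference,
-- however, may contain arbitrary cut formulas, so a proof of a standard formula could wander off to
-- nonstandard ones. Hence facts about proofs carry a rank that drops at each step, and every
-- variable of an inference must be certified as a tree within that rank. Self-reference needs no
-- diagonal lemma: the search formulas have a parameter d and look for proofs and refutations of
-- `diag d`; then d is taken to be the pair of their own codes.

∧-split : ∀ {a b} → True (a ∧ b) → True a × True b
∧-split = Equivalence.to T-∧

∧-join : ∀ {a b} → True a → True b → True (a ∧ b)
∧-join p q = Equivalence.from T-∧ (p , q)

module _ {L : Lang} where

  mutual
    substT-agree : ∀ {ρ τ : ℕ → Term L} k t → True (boundT k t) → (∀ i → i < k → ρ i ≡ τ i)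
      → substT ρ t ≡ substT τ t
    substT-agree k (var i) b h = h i (<ᵇ⇒< i k b)
    substT-agree k (fun f ts) b h = cong (fun f) (substTs-agree k ts b h)

    substTs-agree : ∀ {ρ τ : ℕ → Term L} {m} k (ts : Vec (Term L) m) → True (boundTs k ts)
      → (∀ i → i < k → ρ i ≡ τ i) → substTs ρ ts ≡ substTs τ ts
    substTs-agree k [] b h = refl
    substTs-agree k (t ∷ ts) b h with b₁ , b₂ ← ∧-split {boundT k t} b =
      cong₂ _∷_ (substT-agree k t b₁ h) (substTs-agree k ts b₂ h)

  liftσ-agree : ∀ {ρ τ : ℕ → Term L} k → (∀ i → i < k → ρ i ≡ τ i)
    → ∀ i → i < suc k → liftσ ρ i ≡ liftσ τ i
  liftσ-agree k h zero _ = refl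
  liftσ-agree k h (suc i) (s≤s p) = cong shiftT (h i p)

  subst-agree : ∀ {ρ τ : ℕ → Term L} k φ → FVBelow k φ → (∀ i → i < k → ρ i ≡ τ i)
    → subst ρ φ ≡ subst τ φ
  subst-agree k ⊥' b h = refl
  subst-agree k (rel r ts) b h = cong (rel r) (substTs-agree k ts b h)
  subst-agree k (s ≐ t) b h with b₁ , b₂ ← ∧-split {boundT k s} b =
    cong₂ _≐_ (substT-agree k s b₁ h) (substT-agree k t b₂ h)
  subst-agree k (¬' φ) b h = cong ¬' (subst-agree k φ b h)
  subst-agree k (φ ∧' ψ) b h with b₁ , b₂ ← ∧-split {bound k φ} b =
    cong₂ _∧'_ (subst-agree k φ b₁ h) (subst-agree k ψ b₂ h)
  subst-agree k (φ ∨' ψ) b h with b₁ , b₂ ← ∧-split {bound k φ} b =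
    cong₂ _∨'_ (subst-agree k φ b₁ h) (subst-agree k ψ b₂ h)
  subst-agree k (φ ⇒' ψ) b h with b₁ , b₂ ← ∧-split {bound k φ} b =
    cong₂ _⇒'_ (subst-agree k φ b₁ h) (subst-agree k ψ b₂ h)
  subst-agree k (∀' φ) b h = cong ∀' (subst-agree (suc k) φ b (liftσ-agree k h))
  subst-agree k (∃' φ) b h = cong ∃' (subst-agree (suc k) φ b (liftσ-agree k h))

  mutual
    boundT-subst : ∀ {ρ : ℕ → Term L} k m t → True (boundT k t)
      → (∀ i → i < k → True (boundT m (ρ i))) → True (boundT m (substT ρ t))
    boundT-subst k m (var i) b h = h i (<ᵇ⇒< i k b)
    boundT-subst k m (fun f ts) b h = boundTs-subst k m ts b h

    boundTs-subst : ∀ {ρ : ℕ → Term L} {l} k m (ts : Vec (Term L) l) → True (boundTs k ts)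
      → (∀ i → i < k → True (boundT m (ρ i))) → True (boundTs m (substTs ρ ts))
    boundTs-subst k m [] b h = tt
    boundTs-subst k m (t ∷ ts) b h with b₁ , b₂ ← ∧-split {boundT k t} b =
      ∧-join (boundT-subst k m t b₁ h) (boundTs-subst k m ts b₂ h)

  liftσ-bound : ∀ {ρ : ℕ → Term L} k m → (∀ i → i < k → True (boundT m (ρ i)))
    → ∀ i → i < suc k → True (boundT (suc m) (liftσ ρ i))
  liftσ-bound k m h zero _ = tt
  liftσ-bound {ρ} k m h (suc i) (s≤s p) = boundT-subst m (suc m) (ρ i) (h i p) (λ j q → <⇒<ᵇ (s≤s q))

  bound-subst : ∀ {ρ : ℕ → Term L} k m φ → FVBelow k φ
    → (∀ i → i < k → True (boundT m (ρ i))) → FVBelow m (subst ρ φ)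
  bound-subst k m ⊥' b h = tt
  bound-subst k m (rel r ts) b h = boundTs-subst k m ts b h
  bound-subst k m (s ≐ t) b h with b₁ , b₂ ← ∧-split {boundT k s} b =
    ∧-join (boundT-subst k m s b₁ h) (boundT-subst k m t b₂ h)
  bound-subst k m (¬' φ) b h = bound-subst k m φ b h
  bound-subst k m (φ ∧' ψ) b h with b₁ , b₂ ← ∧-split {bound k φ} b =
    ∧-join (bound-subst k m φ b₁ h) (bound-subst k m ψ b₂ h)
  bound-subst k m (φ ∨' ψ) b h with b₁ , b₂ ← ∧-split {bound k φ} b =
    ∧-join (bound-subst k m φ b₁ h) (bound-subst k m ψ b₂ h)
  bound-subst k m (φ ⇒' ψ) b h with b₁ , b₂ ← ∧-split {bound k φ} b =
    ∧-join (bound-subst k m φ b₁ h) (bound-subst k m ψ b₂ h)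
  bound-subst k m (∀' φ) b h = bound-subst (suc k) (suc m) φ b (liftσ-bound k m h)
  bound-subst k m (∃' φ) b h = bound-subst (suc k) (suc m) φ b (liftσ-bound k m h)

  mutual
    substT-id : ∀ {ρ : ℕ → Term L} t → (∀ i → ρ i ≡ var i) → substT ρ t ≡ t
    substT-id (var i) h = h i
    substT-id (fun f ts) h = cong (fun f) (substTs-id ts h)

    substTs-id : ∀ {ρ : ℕ → Term L} {k} (ts : Vec (Term L) k) → (∀ i → ρ i ≡ var i) → substTs ρ ts ≡ ts
    substTs-id [] h = refl
    substTs-id (t ∷ ts) h = cong₂ _∷_ (substT-id t h) (substTs-id ts h)

  liftσ-id : ∀ {ρ : ℕ → Term L} → (∀ i → ρ i ≡ var i) → ∀ i → liftσ ρ i ≡ var i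
  liftσ-id h zero = refl
  liftσ-id h (suc i) = cong shiftT (h i)

  subst-id : ∀ {ρ : ℕ → Term L} φ → (∀ i → ρ i ≡ var i) → subst ρ φ ≡ φ
  subst-id ⊥' h = refl
  subst-id (rel r ts) h = cong (rel r) (substTs-id ts h)
  subst-id (s ≐ t) h = cong₂ _≐_ (substT-id s h) (substT-id t h)
  subst-id (¬' φ) h = cong ¬' (subst-id φ h)
  subst-id (φ ∧' ψ) h = cong₂ _∧'_ (subst-id φ h) (subst-id ψ h)
  subst-id (φ ∨' ψ) h = cong₂ _∨'_ (subst-id φ h) (subst-id ψ h)
  subst-id (φ ⇒' ψ) h = cong₂ _⇒'_ (subst-id φ h) (subst-id ψ h)
  subst-id (∀' φ) h = cong ∀' (subst-id φ (liftσ-id h))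
  subst-id (∃' φ) h = cong ∃' (subst-id φ (liftσ-id h))

  -- Apply `boundT-subst` to the identity substitution; this spares a second induction on the
  -- syntax, here and in the next two lemmas.
  boundT-mono : ∀ {k m} (t : Term L) → k ≤ m → True (boundT k t) → True (boundT m t)
  boundT-mono {k} {m} t p b = ≡-subst (True ∘ boundT m) (substT-id t λ _ → refl)
    (boundT-subst k m t b λ i q → <⇒<ᵇ (<-≤-trans q p))

  boundTs-mono : ∀ {k m l} (ts : Vec (Term L) l) → k ≤ m → True (boundTs k ts) → True (boundTs m ts)
  boundTs-mono {k} {m} ts p b = ≡-subst (True ∘ boundTs m) (substTs-id ts λ _ → refl)
    (boundTs-subst k m ts b λ i q → <⇒<ᵇ (<-≤-trans q p))

  bound-mono : ∀ {k m} (φ : Formula L) → k ≤ m → FVBelow k φ → FVBelow m φ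
  bound-mono {k} {m} φ p b = ≡-subst (FVBelow m) (subst-id φ λ _ → refl)
    (bound-subst k m φ b λ i q → <⇒<ᵇ (<-≤-trans q p))

  mutual
    fvT : (t : Term L) → Σ[ k ∈ ℕ ] True (boundT k t)
    fvT (var i) = suc i , <⇒<ᵇ (n<1+n i)
    fvT (fun f ts) = fvTs ts

    fvTs : ∀ {l} (ts : Vec (Term L) l) → Σ[ k ∈ ℕ ] True (boundTs k ts)
    fvTs [] = 0 , tt
    fvTs (t ∷ ts) with k , b ← fvT t | m , c ← fvTs ts =
      k ⊔ m , ∧-join (boundT-mono t (m≤m⊔n k m) b) (boundTs-mono ts (m≤n⊔m k m) c)

  fv₂ : ∀ (φ ψ : Formula L) → Σ[ k ∈ ℕ ] FVBelow k φ → Σ[ k ∈ ℕ ] FVBelow k ψ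
    → Σ[ k ∈ ℕ ] True (bound k φ ∧ bound k ψ)
  fv₂ φ ψ (k , b) (m , c) =
    k ⊔ m , ∧-join (bound-mono φ (m≤m⊔n k m) b) (bound-mono ψ (m≤n⊔m k m) c)

  -- Without function extensionality, pointwise equal substitutions or environments are not equal.
  -- Some bound on the free variables reduces `subst-cong`, `sat-cong` and `sat-≈` to the statements
  -- about bounded formulas.
  fv : (φ : Formula L) → Σ[ k ∈ ℕ ] FVBelow k φ
  fv ⊥' = 0 , tt
  fv (rel r ts) = fvTs ts
  fv (s ≐ t) with k , b ← fvT s | m , c ← fvT t =
    k ⊔ m , ∧-join (boundT-mono s (m≤m⊔n k m) b) (boundT-mono t (m≤n⊔m k m) c)
  fv (¬' φ) = fv φ
  fv (φ ∧' ψ) = fv₂ φ ψ (fv φ) (fv ψ)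
  fv (φ ∨' ψ) = fv₂ φ ψ (fv φ) (fv ψ)
  fv (φ ⇒' ψ) = fv₂ φ ψ (fv φ) (fv ψ)
  fv (∀' φ) with k , b ← fv φ = k , bound-mono φ (n≤1+n k) b
  fv (∃' φ) with k , b ← fv φ = k , bound-mono φ (n≤1+n k) b

  subst-cong : ∀ {ρ τ : ℕ → Term L} φ → (∀ i → ρ i ≡ τ i) → subst ρ φ ≡ subst τ φ
  subst-cong φ h with k , b ← fv φ = subst-agree k φ b (λ i _ → h i)

  mutual
    substT-∘ : ∀ (τ ρ : ℕ → Term L) t → substT τ (substT ρ t) ≡ substT (substT τ ∘ ρ) t
    substT-∘ τ ρ (var i) = refl
    substT-∘ τ ρ (fun f ts) = cong (fun f) (substTs-∘ τ ρ ts)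

    substTs-∘ : ∀ {k} (τ ρ : ℕ → Term L) (ts : Vec (Term L) k)
      → substTs τ (substTs ρ ts) ≡ substTs (substT τ ∘ ρ) ts
    substTs-∘ τ ρ [] = refl
    substTs-∘ τ ρ (t ∷ ts) = cong₂ _∷_ (substT-∘ τ ρ t) (substTs-∘ τ ρ ts)

  liftσ-shiftT : ∀ (τ : ℕ → Term L) t → substT (liftσ τ) (shiftT t) ≡ shiftT (substT τ t)
  liftσ-shiftT τ t = trans (substT-∘ (liftσ τ) _ t) (sym (substT-∘ _ τ t))

  liftσ-∘ : ∀ (τ ρ : ℕ → Term L) i → substT (liftσ τ) (liftσ ρ i) ≡ liftσ (substT τ ∘ ρ) i
  liftσ-∘ τ ρ zero = refl
  liftσ-∘ τ ρ (suc i) = liftσ-shiftT τ (ρ i)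

  subst-∘ : ∀ (τ ρ : ℕ → Term L) φ → subst τ (subst ρ φ) ≡ subst (substT τ ∘ ρ) φ
  subst-∘ τ ρ ⊥' = refl
  subst-∘ τ ρ (rel r ts) = cong (rel r) (substTs-∘ τ ρ ts)
  subst-∘ τ ρ (s ≐ t) = cong₂ _≐_ (substT-∘ τ ρ s) (substT-∘ τ ρ t)
  subst-∘ τ ρ (¬' φ) = cong ¬' (subst-∘ τ ρ φ)
  subst-∘ τ ρ (φ ∧' ψ) = cong₂ _∧'_ (subst-∘ τ ρ φ) (subst-∘ τ ρ ψ)
  subst-∘ τ ρ (φ ∨' ψ) = cong₂ _∨'_ (subst-∘ τ ρ φ) (subst-∘ τ ρ ψ)
  subst-∘ τ ρ (φ ⇒' ψ) = cong₂ _⇒'_ (subst-∘ τ ρ φ) (subst-∘ τ ρ ψ)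
  subst-∘ τ ρ (∀' φ) = cong ∀' (trans (subst-∘ (liftσ τ) (liftσ ρ) φ) (subst-cong φ (liftσ-∘ τ ρ)))
  subst-∘ τ ρ (∃' φ) = cong ∃' (trans (subst-∘ (liftσ τ) (liftσ ρ) φ) (subst-cong φ (liftσ-∘ τ ρ)))

  subst-shift : ∀ (ρ : ℕ → Term L) φ → subst (liftσ ρ) (shift φ) ≡ shift (subst ρ φ)
  subst-shift ρ φ = trans (subst-∘ (liftσ ρ) _ φ) (sym (subst-∘ _ ρ φ))

  map-subst-shift : ∀ (ρ : ℕ → Term L) Γ
    → map (subst (liftσ ρ)) (map shift Γ) ≡ map shift (map (subst ρ) Γ)
  map-subst-shift ρ Γ = trans (sym (map-∘ Γ)) (trans (map-cong (subst-shift ρ) Γ) (map-∘ Γ))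

  shiftT-inst : ∀ (u t : Term L) (ρ : ℕ → Term L) → substT (u ∷σ ρ) (shiftT t) ≡ substT ρ t
  shiftT-inst u t ρ = substT-∘ (u ∷σ ρ) _ t

  subst-inst : ∀ (ρ : ℕ → Term L) φ t → (subst (liftσ ρ) φ) [ substT ρ t ] ≡ subst ρ (φ [ t ])
  subst-inst ρ φ t = trans (subst-∘ _ (liftσ ρ) φ)
    (trans (subst-cong φ λ { zero → refl ; (suc i) → trans (shiftT-inst _ (ρ i) var) (substT-id (ρ i) λ _ → refl) })
      (sym (subst-∘ ρ _ φ)))

  subst-lift-inst : ∀ (ρ : ℕ → Term L) φ t → (subst (liftσ ρ) φ) [ t ] ≡ subst (t ∷σ ρ) φ
  subst-lift-inst ρ φ t = trans (subst-∘ _ (liftσ ρ) φ)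
    (subst-cong φ λ { zero → refl ; (suc i) → trans (shiftT-inst _ (ρ i) var) (substT-id (ρ i) λ _ → refl) })

  -- Used in the Henkin construction, where a free variable serving as a witness has to become the
  -- eigenvariable of `∃E`.
  ⊢-subst : ∀ (ρ : ℕ → Term L) {Γ φ} → Γ ⊢ φ → map (subst ρ) Γ ⊢ subst ρ φ
  ⊢-subst ρ (hyp x) = hyp (∈-map⁺ (subst ρ) x)
  ⊢-subst ρ (raa d) = raa (⊢-subst ρ d)
  ⊢-subst ρ (∧I d e) = ∧I (⊢-subst ρ d) (⊢-subst ρ e)
  ⊢-subst ρ (∧E₁ d) = ∧E₁ (⊢-subst ρ d)
  ⊢-subst ρ (∧E₂ d) = ∧E₂ (⊢-subst ρ d)
  ⊢-subst ρ (∨I₁ d) = ∨I₁ (⊢-subst ρ d)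
  ⊢-subst ρ (∨I₂ d) = ∨I₂ (⊢-subst ρ d)
  ⊢-subst ρ (∨E d e f) = ∨E (⊢-subst ρ d) (⊢-subst ρ e) (⊢-subst ρ f)
  ⊢-subst ρ (⇒I d) = ⇒I (⊢-subst ρ d)
  ⊢-subst ρ (⇒E d e) = ⇒E (⊢-subst ρ d) (⊢-subst ρ e)
  ⊢-subst ρ (¬I d) = ¬I (⊢-subst ρ d)
  ⊢-subst ρ (¬E d e) = ¬E (⊢-subst ρ d) (⊢-subst ρ e)
  ⊢-subst ρ {Γ} (∀I {φ = φ} d) =
    ∀I (≡-subst (_⊢ subst (liftσ ρ) φ) (map-subst-shift ρ Γ) (⊢-subst (liftσ ρ) d))
  ⊢-subst ρ {Γ} (∀E {φ = φ} d t) =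
    ≡-subst (map (subst ρ) Γ ⊢_) (subst-inst ρ φ t) (∀E (⊢-subst ρ d) (substT ρ t))
  ⊢-subst ρ {Γ} (∃I {φ = φ} t d) =
    ∃I (substT ρ t) (≡-subst (map (subst ρ) Γ ⊢_) (sym (subst-inst ρ φ t)) (⊢-subst ρ d))
  ⊢-subst ρ {Γ} (∃E {φ = φ} {ψ} d e) = ∃E (⊢-subst ρ d)
    (≡-subst (λ Δ → subst (liftσ ρ) φ ∷ Δ ⊢ shift (subst ρ ψ)) (map-subst-shift ρ Γ)
      (≡-subst (map (subst (liftσ ρ)) (φ ∷ map shift Γ) ⊢_) (subst-shift ρ ψ) (⊢-subst (liftσ ρ) e)))
  ⊢-subst ρ (≐refl t) = ≐refl (substT ρ t)
  ⊢-subst ρ {Γ} (≐subst {φ = φ} {s} {t} d e) =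
    ≡-subst (map (subst ρ) Γ ⊢_) (subst-inst ρ φ t)
      (≐subst (⊢-subst ρ d) (≡-subst (map (subst ρ) Γ ⊢_) (sym (subst-inst ρ φ s)) (⊢-subst ρ e)))

  weaken : ∀ {Γ Δ : List (Formula L)} {φ} → Γ ⊆ Δ → Γ ⊢ φ → Δ ⊢ φ
  weaken s (hyp x) = hyp (s x)
  weaken s (raa d) = raa (weaken (∷⁺ʳ _ s) d)
  weaken s (∧I d e) = ∧I (weaken s d) (weaken s e)
  weaken s (∧E₁ d) = ∧E₁ (weaken s d)
  weaken s (∧E₂ d) = ∧E₂ (weaken s d)
  weaken s (∨I₁ d) = ∨I₁ (weaken s d)
  weaken s (∨I₂ d) = ∨I₂ (weaken s d)
  weaken s (∨E d e f) = ∨E (weaken s d) (weaken (∷⁺ʳ _ s) e) (weaken (∷⁺ʳ _ s) f)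
  weaken s (⇒I d) = ⇒I (weaken (∷⁺ʳ _ s) d)
  weaken s (⇒E d e) = ⇒E (weaken s d) (weaken s e)
  weaken s (¬I d) = ¬I (weaken (∷⁺ʳ _ s) d)
  weaken s (¬E d e) = ¬E (weaken s d) (weaken s e)
  weaken s (∀I d) = ∀I (weaken (map⁺ shift s) d)
  weaken s (∀E d t) = ∀E (weaken s d) t
  weaken s (∃I t d) = ∃I t (weaken s d)
  weaken s (∃E d e) = ∃E (weaken s d) (weaken (∷⁺ʳ _ (map⁺ shift s)) e)
  weaken s (≐refl t) = ≐refl t
  weaken s (≐subst d e) = ≐subst (weaken s d) (weaken s e)

  cut : ∀ {Γ Δ : List (Formula L)} {φ} → All (Δ ⊢_) Γ → Γ ⊢ φ → Δ ⊢ φ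
  cut [] d = weaken (λ ()) d
  cut (e ∷ es) d = ⇒E (cut es (⇒I d)) e

  ⊥E : ∀ {Γ : List (Formula L)} {φ} → Γ ⊢ ⊥' → Γ ⊢ φ
  ⊥E d = raa (weaken there d)

-- Models

infix 2 _⟺_
_⟺_ : Set → Set → Set
A ⟺ B = (A → B) × (B → A)

⟺-refl : ∀ {A} → A ⟺ A
⟺-refl = id , id

⟺-trans : ∀ {A B C} → A ⟺ B → B ⟺ C → A ⟺ C
⟺-trans (f , g) (h , k) = h ∘ f , g ∘ k

⟺-≡ : ∀ {A B : Set} → A ≡ B → A ⟺ B
⟺-≡ refl = ⟺-refl

⟺-¬ : ∀ {A B} → A ⟺ B → (¬ A) ⟺ (¬ B)
⟺-¬ (f , g) = (λ n b → n (g b)) , (λ n a → n (f a))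

⟺-× : ∀ {A B C D} → A ⟺ B → C ⟺ D → (A × C) ⟺ (B × D)
⟺-× (f , g) (h , k) = (λ (a , c) → f a , h c) , (λ (b , d) → g b , k d)

⟺-→ : ∀ {A B C D : Set} → A ⟺ B → C ⟺ D → (A → C) ⟺ (B → D)
⟺-→ (f , g) (h , k) = (λ u b → h (u (g b))) , (λ u a → k (u (f a)))

⟺-∀ : ∀ {X : Set} {P Q : X → Set} → (∀ x → P x ⟺ Q x) → (∀ x → P x) ⟺ (∀ x → Q x)
⟺-∀ h = (λ p x → proj₁ (h x) (p x)) , (λ q x → proj₂ (h x) (q x))

⟺-Σ : ∀ {X : Set} {P Q : X → Set} → (∀ x → P x ⟺ Q x) → Σ X P ⟺ Σ X Q
⟺-Σ h = (λ (x , p) → x , proj₁ (h x) p) , (λ (x , q) → x , proj₂ (h x) q)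

infixr 5 _∷ᵉ_
_∷ᵉ_ : ∀ {D : Set} → D → (ℕ → D) → ℕ → D
(d ∷ᵉ e) zero = d
(d ∷ᵉ e) (suc i) = e i

-- Identity is interpreted by a relation of its own: the elements of the Henkin model are terms,
-- equal when the limit theory says so, and no quotient is formed.
record Structure (L : Lang) : Set₁ where
  infix 4 _≈_
  field
    D   : Set
    fn  : (f : Fin (nFun L)) → Vec D (funArity L f) → D
    rl  : (r : Fin (nRel L)) → Vec D (relArity L r) → Set
    _≈_ : D → D → Set

module Sat {L : Lang} (S : Structure L) where
  open Structure S

  mutual
    eval : (ℕ → D) → Term L → D
    eval e (var i) = e i
    eval e (fun f ts) = fn f (evals e ts)

    evals : ∀ {k} → (ℕ → D) → Vec (Term L) k → Vec D k
    evals e [] = []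
    evals e (t ∷ ts) = eval e t ∷ evals e ts

  -- Disjunction gets its negative reading, while ∃' keeps a genuine witness:
  -- the Henkin model provides witnesses, but does not decide disjunctions.
  sat : Formula L → (ℕ → D) → Set
  sat ⊥' e = ⊥
  sat (rel r ts) e = rl r (evals e ts)
  sat (s ≐ t) e = eval e s ≈ eval e t
  sat (¬' φ) e = ¬ sat φ e
  sat (φ ∧' ψ) e = sat φ e × sat ψ e
  sat (φ ∨' ψ) e = ¬ ((¬ sat φ e) × (¬ sat ψ e))
  sat (φ ⇒' ψ) e = sat φ e → sat ψ e
  sat (∀' φ) e = ∀ d → sat φ (d ∷ᵉ e)
  sat (∃' φ) e = Σ[ d ∈ D ] sat φ (d ∷ᵉ e)

  mutual
    eval-agree : ∀ {e e′ : ℕ → D} k t → True (boundT k t) → (∀ i → i < k → e i ≡ e′ i)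
      → eval e t ≡ eval e′ t
    eval-agree k (var i) b h = h i (<ᵇ⇒< i k b)
    eval-agree k (fun f ts) b h = cong (fn f) (evals-agree k ts b h)

    evals-agree : ∀ {e e′ : ℕ → D} {m} k (ts : Vec (Term L) m) → True (boundTs k ts)
      → (∀ i → i < k → e i ≡ e′ i) → evals e ts ≡ evals e′ ts
    evals-agree k [] b h = refl
    evals-agree k (t ∷ ts) b h with b₁ , b₂ ← ∧-split {boundT k t} b =
      cong₂ _∷_ (eval-agree k t b₁ h) (evals-agree k ts b₂ h)

  ∷ᵉ-agree : ∀ {e e′ : ℕ → D} {d} k → (∀ i → i < k → e i ≡ e′ i)
    → ∀ i → i < suc k → (d ∷ᵉ e) i ≡ (d ∷ᵉ e′) i
  ∷ᵉ-agree k h zero _ = refl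
  ∷ᵉ-agree k h (suc i) (s≤s p) = h i p

  sat-agree : ∀ {e e′ : ℕ → D} k φ → FVBelow k φ → (∀ i → i < k → e i ≡ e′ i) → sat φ e ⟺ sat φ e′
  sat-agree k ⊥' b h = ⟺-refl
  sat-agree k (rel r ts) b h = ⟺-≡ (cong (rl r) (evals-agree k ts b h))
  sat-agree k (s ≐ t) b h with b₁ , b₂ ← ∧-split {boundT k s} b =
    ⟺-≡ (cong₂ _≈_ (eval-agree k s b₁ h) (eval-agree k t b₂ h))
  sat-agree k (¬' φ) b h = ⟺-¬ (sat-agree k φ b h)
  sat-agree k (φ ∧' ψ) b h with b₁ , b₂ ← ∧-split {bound k φ} b =
    ⟺-× (sat-agree k φ b₁ h) (sat-agree k ψ b₂ h)
  sat-agree k (φ ∨' ψ) b h with b₁ , b₂ ← ∧-split {bound k φ} b =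
    ⟺-¬ (⟺-× (⟺-¬ (sat-agree k φ b₁ h)) (⟺-¬ (sat-agree k ψ b₂ h)))
  sat-agree k (φ ⇒' ψ) b h with b₁ , b₂ ← ∧-split {bound k φ} b =
    ⟺-→ (sat-agree k φ b₁ h) (sat-agree k ψ b₂ h)
  sat-agree k (∀' φ) b h = ⟺-∀ λ d → sat-agree (suc k) φ b (∷ᵉ-agree k h)
  sat-agree k (∃' φ) b h = ⟺-Σ λ d → sat-agree (suc k) φ b (∷ᵉ-agree k h)

  sat-cong : ∀ {e e′ : ℕ → D} φ → (∀ i → e i ≡ e′ i) → sat φ e ⟺ sat φ e′
  sat-cong φ h with k , b ← fv φ = sat-agree k φ b (λ i _ → h i)

  mutual
    eval-subst : ∀ e ρ t → eval e (substT ρ t) ≡ eval (eval e ∘ ρ) t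
    eval-subst e ρ (var i) = refl
    eval-subst e ρ (fun f ts) = cong (fn f) (evals-subst e ρ ts)

    evals-subst : ∀ {k} e ρ (ts : Vec (Term L) k) → evals e (substTs ρ ts) ≡ evals (eval e ∘ ρ) ts
    evals-subst e ρ [] = refl
    evals-subst e ρ (t ∷ ts) = cong₂ _∷_ (eval-subst e ρ t) (evals-subst e ρ ts)

  eval-liftσ : ∀ e d ρ i → eval (d ∷ᵉ e) (liftσ ρ i) ≡ (d ∷ᵉ (eval e ∘ ρ)) i
  eval-liftσ e d ρ zero = refl
  eval-liftσ e d ρ (suc i) = eval-subst (d ∷ᵉ e) _ (ρ i)

  sat-subst : ∀ φ e ρ → sat (subst ρ φ) e ⟺ sat φ (eval e ∘ ρ)
  sat-subst ⊥' e ρ = ⟺-refl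
  sat-subst (rel r ts) e ρ = ⟺-≡ (cong (rl r) (evals-subst e ρ ts))
  sat-subst (s ≐ t) e ρ = ⟺-≡ (cong₂ _≈_ (eval-subst e ρ s) (eval-subst e ρ t))
  sat-subst (¬' φ) e ρ = ⟺-¬ (sat-subst φ e ρ)
  sat-subst (φ ∧' ψ) e ρ = ⟺-× (sat-subst φ e ρ) (sat-subst ψ e ρ)
  sat-subst (φ ∨' ψ) e ρ = ⟺-¬ (⟺-× (⟺-¬ (sat-subst φ e ρ)) (⟺-¬ (sat-subst ψ e ρ)))
  sat-subst (φ ⇒' ψ) e ρ = ⟺-→ (sat-subst φ e ρ) (sat-subst ψ e ρ)
  sat-subst (∀' φ) e ρ = ⟺-∀ λ d → ⟺-trans (sat-subst φ (d ∷ᵉ e) (liftσ ρ)) (sat-cong φ (eval-liftσ e d ρ))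
  sat-subst (∃' φ) e ρ = ⟺-Σ λ d → ⟺-trans (sat-subst φ (d ∷ᵉ e) (liftσ ρ)) (sat-cong φ (eval-liftσ e d ρ))

  sat-shift : ∀ φ e d → sat (shift φ) (d ∷ᵉ e) ⟺ sat φ e
  sat-shift φ e d = sat-subst φ (d ∷ᵉ e) _

  sat-[] : ∀ φ e t → sat (φ [ t ]) e ⟺ sat φ (eval e t ∷ᵉ e)
  sat-[] φ e t = ⟺-trans (sat-subst φ e _) (sat-cong φ λ { zero → refl ; (suc i) → refl })

-- `≈-sub` is Leibniz's law for the first variable only, exactly what `≐subst` asks for. `stable` is
-- the substitute for classical logic: a proof by contradiction is available whenever the goal is of
-- the form `sat`.
record Model (L : Lang) : Set₁ where
  field
    structure : Structure L
  open Structure structure public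
  open Sat structure public
  field
    pt     : D
    ≈-refl : ∀ {a} → a ≈ a
    ≈-sub  : ∀ φ {e a b} → a ≈ b → sat φ (a ∷ᵉ e) → sat φ (b ∷ᵉ e)
    stable : ∀ φ {e} → ¬ ¬ sat φ e → sat φ e

  sound : ∀ {Γ φ} → Γ ⊢ φ → ∀ e → All (λ γ → sat γ e) Γ → sat φ e
  sound-shift : ∀ {Γ e} d → All (λ γ → sat γ e) Γ → All (λ γ → sat γ (d ∷ᵉ e)) (map shift Γ)
  sound-shift {e = e} d h = All.map⁺ (All.map (λ {γ} → proj₂ (sat-shift γ e d)) h)
  sound (hyp x) e h = All.lookup h x
  sound (raa {φ = φ} d) e h = stable φ λ n → sound d e (n ∷ h)
  sound (∧I d d₁) e h = sound d e h , sound d₁ e h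
  sound (∧E₁ d) e h = proj₁ (sound d e h)
  sound (∧E₂ d) e h = proj₂ (sound d e h)
  sound (∨I₁ d) e h = λ (a , b) → a (sound d e h)
  sound (∨I₂ d) e h = λ (a , b) → b (sound d e h)
  sound (∨E {χ = χ} d d₁ d₂) e h = stable χ λ n →
    sound d e h ((λ a → n (sound d₁ e (a ∷ h))) , (λ b → n (sound d₂ e (b ∷ h))))
  sound (⇒I d) e h a = sound d e (a ∷ h)
  sound (⇒E d d₁) e h = sound d e h (sound d₁ e h)
  sound (¬I d) e h a = sound d e (a ∷ h)
  sound (¬E d d₁) e h = sound d e h (sound d₁ e h)
  sound (∀I d) e h a = sound d (a ∷ᵉ e) (sound-shift a h)
  sound (∀E {φ = φ} d t) e h = proj₂ (sat-[] φ e t) (sound d e h (eval e t))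
  sound (∃I {φ = φ} t d) e h = eval e t , proj₁ (sat-[] φ e t) (sound d e h)
  sound (∃E {ψ = ψ} d d₁) e h with a , p ← sound d e h =
    proj₁ (sat-shift ψ e a) (sound d₁ (a ∷ᵉ e) (p ∷ sound-shift a h))
  sound (≐refl t) e h = ≈-refl
  sound (≐subst {φ = φ} {s} {t} d d₁) e h =
    proj₂ (sat-[] φ e t) (≈-sub φ (sound d e h) (proj₁ (sat-[] φ e s) (sound d₁ e h)))

  ≈-sym : ∀ {a b} → a ≈ b → b ≈ a
  ≈-sym {a} p = ≈-sub (var 0 ≐ var 1) {a ∷ᵉ λ _ → pt} p ≈-refl

  ≈-trans : ∀ {a b c} → a ≈ b → b ≈ c → a ≈ c
  ≈-trans {a} p q = ≈-sub (var 1 ≐ var 0) {a ∷ᵉ λ _ → pt} q p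

  private
    mix : (e e′ : ℕ → D) → ℕ → ℕ → D
    mix e e′ j i with i <? j
    ... | yes _ = e′ i
    ... | no _ = e i

    mix-< : ∀ e e′ j i → i < j → mix e e′ j i ≡ e′ i
    mix-< e e′ j i p with i <? j
    ... | yes _ = refl
    ... | no n = ⊥-elim (n p)

    hole : ℕ → ℕ → Term L
    hole j i with i ≟ j
    ... | yes _ = var 0
    ... | no _ = var (suc i)

    hole-before : ∀ e e′ j i → eval (e j ∷ᵉ mix e e′ j) (hole j i) ≡ mix e e′ j i
    hole-before e e′ j i with i ≟ j
    hole-before e e′ j i | no _ = refl
    hole-before e e′ j i | yes refl with i <? i
    ... | yes p = ⊥-elim (<-irrefl refl p)
    ... | no _ = refl

    hole-after : ∀ e e′ j i → eval (e′ j ∷ᵉ mix e e′ j) (hole j i) ≡ mix e e′ (suc j) i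
    hole-after e e′ j i with i ≟ j
    hole-after e e′ j i | yes refl with i <? suc i
    ... | yes _ = refl
    ... | no n = ⊥-elim (n (n<1+n i))
    hole-after e e′ j i | no i≢j with i <? j | i <? suc j
    ... | yes _ | yes _ = refl
    ... | no _ | no _ = refl
    ... | yes p | no n = ⊥-elim (n (m≤n⇒m≤1+n p))
    ... | no n | yes (s≤s p) with m≤n⇒m<n∨m≡n p
    ...   | inj₁ q = ⊥-elim (n q)
    ...   | inj₂ q = ⊥-elim (i≢j q)

    -- The values are exchanged one variable at a time. `hole j` moves variable j to position 0,
    -- where `≈-sub` can act on it, and `mix e e′ k` has the first k values exchanged already.
    sat-mix : ∀ φ {e e′ : ℕ → D} → (∀ i → e i ≈ e′ i) → ∀ k → sat φ e → sat φ (mix e e′ k)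
    sat-mix φ h zero s = s
    sat-mix φ {e} {e′} h (suc k) s =
      proj₁ (⟺-trans (sat-subst φ _ (hole k)) (sat-cong φ (hole-after e e′ k)))
        (≈-sub (subst (hole k) φ) (h k)
          (proj₂ (⟺-trans (sat-subst φ _ (hole k)) (sat-cong φ (hole-before e e′ k))) (sat-mix φ h k s)))

  sat-≈ : ∀ φ {e e′ : ℕ → D} → (∀ i → e i ≈ e′ i) → sat φ e → sat φ e′
  sat-≈ φ {e} {e′} h s with k , b ← fv φ =
    proj₁ (sat-agree k φ b (mix-< e e′ k)) (sat-mix φ h k s)

-- Codes of the syntax

data Tree : Set where
  leaf : ℕ → Tree
  nd   : Tree → Tree → Tree

-- Variable indices are unary trees and not labels of leaves: the rules for substitution recurse on
-- them, and the labels in codes of formulas remain below a fixed bound, so that finitely many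
-- clauses can quote them all.
codeN : ℕ → Tree
codeN zero = leaf 0
codeN (suc n) = nd (leaf 0) (codeN n)

decN : Tree → ℕ
decN (leaf _) = 0
decN (nd _ t) = suc (decN t)

decN-codeN : ∀ n → decN (codeN n) ≡ n
decN-codeN zero = refl
decN-codeN (suc n) = cong suc (decN-codeN n)

module _ {L : Lang} where
  mutual
    codeT : Term L → Tree
    codeT (var i) = nd (leaf 0) (codeN i)
    codeT (fun f ts) = nd (leaf 1) (nd (leaf (toℕ f)) (codeTs ts))

    codeTs : ∀ {k} → Vec (Term L) k → Tree
    codeTs [] = leaf 0
    codeTs (t ∷ ts) = nd (codeT t) (codeTs ts)

  codeF : Formula L → Tree
  codeF ⊥' = nd (leaf 0) (leaf 0)
  codeF (rel r ts) = nd (leaf 1) (nd (leaf (toℕ r)) (codeTs ts))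
  codeF (s ≐ t) = nd (leaf 2) (nd (codeT s) (codeT t))
  codeF (¬' φ) = nd (leaf 3) (codeF φ)
  codeF (φ ∧' ψ) = nd (leaf 4) (nd (codeF φ) (codeF ψ))
  codeF (φ ∨' ψ) = nd (leaf 5) (nd (codeF φ) (codeF ψ))
  codeF (φ ⇒' ψ) = nd (leaf 6) (nd (codeF φ) (codeF ψ))
  codeF (∀' φ) = nd (leaf 7) (codeF φ)
  codeF (∃' φ) = nd (leaf 8) (codeF φ)

  -- The decoders are total: junk decodes to var 0, resp. ⊥'.
  mutual
    decT : Tree → Term L
    decT (nd (leaf 0) i) = var (decN i)
    decT (nd (leaf 1) (nd (leaf f) ts)) with f <? nFun L
    ... | yes p = fun (fromℕ< p) (decTs _ ts)
    ... | no _ = var 0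
    decT _ = var 0

    decTs : ∀ k → Tree → Vec (Term L) k
    decTs zero _ = []
    decTs (suc k) (leaf _) = replicate (suc k) (var 0)
    decTs (suc k) (nd t ts) = decT t ∷ decTs k ts

  decF : Tree → Formula L
  decF (nd (leaf 1) (nd (leaf r) ts)) with r <? nRel L
  ... | yes p = rel (fromℕ< p) (decTs _ ts)
  ... | no _ = ⊥'
  decF (nd (leaf 2) (nd s t)) = decT s ≐ decT t
  decF (nd (leaf 3) a) = ¬' (decF a)
  decF (nd (leaf 4) (nd a b)) = decF a ∧' decF b
  decF (nd (leaf 5) (nd a b)) = decF a ∨' decF b
  decF (nd (leaf 6) (nd a b)) = decF a ⇒' decF b
  decF (nd (leaf 7) a) = ∀' (decF a)
  decF (nd (leaf 8) a) = ∃' (decF a)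
  decF _ = ⊥'

  decT-fun : ∀ f ts → decT (nd (leaf 1) (nd (leaf (toℕ f)) ts)) ≡ fun f (decTs _ ts)
  decT-fun f ts with toℕ f <? nFun L
  ... | yes p = cong (λ g → fun g (decTs (funArity L g) ts)) (fromℕ<-toℕ f p)
  ... | no n = ⊥-elim (n (toℕ<n f))

  decF-rel : ∀ r ts → decF (nd (leaf 1) (nd (leaf (toℕ r)) ts)) ≡ rel r (decTs _ ts)
  decF-rel r ts with toℕ r <? nRel L
  ... | yes p = cong (λ g → rel g (decTs (relArity L g) ts)) (fromℕ<-toℕ r p)
  ... | no n = ⊥-elim (n (toℕ<n r))

  mutual
    decT-codeT : ∀ t → decT (codeT t) ≡ t
    decT-codeT (var i) = cong var (decN-codeN i)
    decT-codeT (fun f ts) = trans (decT-fun f _) (cong (fun f) (decTs-codeTs ts))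

    decTs-codeTs : ∀ {k} (ts : Vec (Term L) k) → decTs k (codeTs ts) ≡ ts
    decTs-codeTs [] = refl
    decTs-codeTs (t ∷ ts) = cong₂ _∷_ (decT-codeT t) (decTs-codeTs ts)

  decF-codeF : ∀ φ → decF (codeF φ) ≡ φ
  decF-codeF ⊥' = refl
  decF-codeF (rel r ts) = trans (decF-rel r _) (cong (rel r) (decTs-codeTs ts))
  decF-codeF (s ≐ t) = cong₂ _≐_ (decT-codeT s) (decT-codeT t)
  decF-codeF (¬' φ) = cong ¬' (decF-codeF φ)
  decF-codeF (φ ∧' ψ) = cong₂ _∧'_ (decF-codeF φ) (decF-codeF ψ)
  decF-codeF (φ ∨' ψ) = cong₂ _∨'_ (decF-codeF φ) (decF-codeF ψ)
  decF-codeF (φ ⇒' ψ) = cong₂ _⇒'_ (decF-codeF φ) (decF-codeF ψ)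
  decF-codeF (∀' φ) = cong ∀' (decF-codeF φ)
  decF-codeF (∃' φ) = cong ∃' (decF-codeF φ)

-- Enumeration of all formulas

next : ℕ × ℕ → ℕ × ℕ
next (zero , y) = suc y , zero
next (suc x , y) = x , suc y

unpair : ℕ → ℕ × ℕ
unpair zero = 0 , 0
unpair (suc n) = next (unpair n)

-- Cantor's walk: the diagonal with sum s is traversed from (s, 0) to (0, s). The recursion follows
-- `next` backwards.
unpair-diagonal : ∀ s x y → x + y ≡ s → Σ[ n ∈ ℕ ] unpair n ≡ (x , y)
unpair-diagonal zero zero zero p = 0 , refl
unpair-diagonal (suc s) (suc x) zero p
  with n , q ← unpair-diagonal s zero x (trans (sym (+-identityʳ x)) (cong Data.Nat.pred p)) =
  suc n , cong next q
unpair-diagonal s x (suc y) p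
  with n , q ← unpair-diagonal s (suc x) y (trans (sym (+-suc x y)) p) =
  suc n , cong next q

unpair-surjective : ∀ x y → Σ[ n ∈ ℕ ] unpair n ≡ (x , y)
unpair-surjective x y = unpair-diagonal (x + y) x y refl

-- The fuel makes the decoding structurally recursive. In `formulaAt` the fuel is a component of the
-- number itself, so surjectivity only needs some fuel that suffices.
treeAt : ℕ → ℕ → Tree
treeAt zero n = leaf 0
treeAt (suc fuel) n with unpair n
... | zero , k = leaf k
... | suc _ , m with unpair m
...   | a , b = nd (treeAt fuel a) (treeAt fuel b)

treeAt-surjective : ∀ t → Σ[ k ∈ ℕ ] Σ[ n ∈ ℕ ] (∀ fuel → k ≤ fuel → treeAt fuel n ≡ t)
treeAt-surjective (leaf k) with n , p ← unpair-surjective 0 k = 1 , n , lem where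
  lem : ∀ fuel → 1 ≤ fuel → treeAt fuel n ≡ leaf k
  lem (suc fuel) _ rewrite p = refl
treeAt-surjective (nd s t)
  with k , a , h ← treeAt-surjective s | l , b , g ← treeAt-surjective t
  with m , p ← unpair-surjective a b
  with n , q ← unpair-surjective 1 m = suc (k ⊔ l) , n , lem where
  lem : ∀ fuel → suc (k ⊔ l) ≤ fuel → treeAt fuel n ≡ nd s t
  lem (suc fuel) (s≤s r) rewrite q | p =
    cong₂ nd (h fuel (≤-trans (m≤m⊔n k l) r)) (g fuel (≤-trans (m≤n⊔m k l) r))

module _ {L : Lang} where
  formulaAt : ℕ → Formula L
  formulaAt n with unpair n
  ... | fuel , m = decF (treeAt fuel m)

  formulaAt-surjective : ∀ φ → Σ[ n ∈ ℕ ] formulaAt n ≡ φ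
  formulaAt-surjective φ
    with k , m , h ← treeAt-surjective (codeF φ)
    with n , p ← unpair-surjective k m = n , lem where
    lem : formulaAt n ≡ φ
    lem rewrite p = trans (cong decF (h k ≤-refl)) (decF-codeF φ)

-- The Henkin model

module _ {L : Lang} where

  Theory : Set₁
  Theory = Formula L → Set

  infixl 5 _⊕_
  _⊕_ : Theory → Formula L → Theory
  (P ⊕ χ) φ = P φ ⊎ φ ≡ χ

  Proves-mono : ∀ {P Q : Theory} {φ} → (∀ γ → P γ → Q γ) → Proves P φ → Proves Q φ
  Proves-mono h (Γ , a , d) = Γ , All.map (h _) a , d

  Proves-hyp : ∀ {P : Theory} {φ} → P φ → Proves P φ
  Proves-hyp p = _ ∷ [] , p ∷ [] , hyp (here refl)

  Proves-map : ∀ {P : Theory} {φ ψ} → (∀ {Γ} → Γ ⊢ φ → Γ ⊢ ψ) → Proves P φ → Proves P ψ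
  Proves-map f (Γ , a , d) = Γ , a , f d

  Proves-map₂ : ∀ {P : Theory} {φ ψ χ} → (∀ {Γ} → Γ ⊢ φ → Γ ⊢ ψ → Γ ⊢ χ)
    → Proves P φ → Proves P ψ → Proves P χ
  Proves-map₂ f (Γ , a , d) (Δ , b , e) =
    Γ ++ Δ , All.++⁺ a b , f (weaken (xs⊆xs++ys Γ Δ) d) (weaken (xs⊆ys++xs Δ Γ) e)

  ⊕-split : ∀ {P : Theory} {χ Γ} → All (P ⊕ χ) Γ → Σ[ Δ ∈ List (Formula L) ] (All P Δ × Γ ⊆ χ ∷ Δ)
  ⊕-split [] = [] , [] , λ ()
  ⊕-split (inj₁ p ∷ ps) with Δ , a , s ← ⊕-split ps =
    _ ∷ Δ , p ∷ a , λ { (here refl) → there (here refl) ; (there q) → ∷⁺ʳ _ there (s q) }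
  ⊕-split (inj₂ refl ∷ ps) with Δ , a , s ← ⊕-split ps =
    Δ , a , λ { (here refl) → here refl ; (there q) → s q }

  Proves-¬I : ∀ {P : Theory} {φ} → Proves (P ⊕ φ) ⊥' → Proves P (¬' φ)
  Proves-¬I (Γ , a , d) with Δ , b , s ← ⊕-split a = Δ , b , ¬I (weaken s d)

  Proves-all : ∀ {Q : Theory} {Γ} → All (Proves Q) Γ → Σ[ Δ ∈ List (Formula L) ] (All Q Δ × All (Δ ⊢_) Γ)
  Proves-all [] = [] , [] , []
  Proves-all ((Γ₁ , a₁ , d₁) ∷ ps) with Γ₂ , a₂ , d₂ ← Proves-all ps =
    Γ₁ ++ Γ₂ , All.++⁺ a₁ a₂ ,
    weaken (xs⊆xs++ys Γ₁ Γ₂) d₁ ∷ All.map (weaken (xs⊆ys++xs Γ₂ Γ₁)) d₂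

  Proves-cut : ∀ {P Q : Theory} {φ} → (∀ γ → P γ → Proves Q γ) → Proves P φ → Proves Q φ
  Proves-cut h (Γ , a , d) with Δ , b , ds ← Proves-all (All.map (h _) a) = Δ , b , cut ds d

  ¬∀⇒∃¬ : ∀ {Γ} {φ : Formula L} → Γ ⊢ ¬' (∀' φ) → Γ ⊢ ∃' (¬' φ)
  ¬∀⇒∃¬ {Γ} {φ} d = raa (¬E (weaken there d) (∀I (raa (¬E (hyp (there (here refl)))
    (∃I (var 0) (≡-subst (λ ψ → ¬' φ ∷ map shift (¬' (∃' (¬' φ)) ∷ Γ) ⊢ ¬' ψ)
      (sym (trans (subst-lift-inst _ φ (var 0))
        (subst-id φ λ { zero → refl ; (suc i) → refl })))
      (hyp (here refl))))))))

  witness : Formula L → ℕ → Formula L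
  witness (∃' θ) v = θ [ var v ]
  witness φ v = φ

  private
    -- turns the free variable v into the variable bound by ∃E and shifts all others
    capture : ℕ → ℕ → Term L
    capture v i with i ≟ v
    ... | yes _ = var 0
    ... | no _ = var (suc i)

    capture-fresh : ∀ v i → i < v → capture v i ≡ var (suc i)
    capture-fresh v i p with i ≟ v
    ... | yes refl = ⊥-elim (<-irrefl refl p)
    ... | no _ = refl

    capture-self : ∀ v → capture v v ≡ var 0
    capture-self v with v ≟ v
    ... | yes _ = refl
    ... | no n = ⊥-elim (n refl)

    map-capture : ∀ v Γ → All (FVBelow v) Γ → map (subst (capture v)) Γ ≡ map shift Γ
    map-capture v [] [] = refl
    map-capture v (γ ∷ Γ) (b ∷ bs) =
      cong₂ _∷_ (subst-agree v γ b (capture-fresh v)) (map-capture v Γ bs)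

    capture-[] : ∀ v θ → FVBelow (suc v) θ → subst (capture v) (θ [ var v ]) ≡ θ
    capture-[] v θ b = trans (subst-∘ (capture v) _ θ)
      (trans (subst-agree (suc v) θ b (λ { zero _ → capture-self v ; (suc i) (s≤s p) → capture-fresh v i p }))
        (subst-id θ λ _ → refl))

  witness-cases : ∀ v χ → (Σ[ θ ∈ Formula L ] (χ ≡ ∃' θ)) ⊎ witness χ v ≡ χ
  witness-cases v (∃' θ) = inj₁ (θ , refl)
  witness-cases v ⊥' = inj₂ refl
  witness-cases v (rel _ _) = inj₂ refl
  witness-cases v (_ ≐ _) = inj₂ refl
  witness-cases v (¬' _) = inj₂ refl
  witness-cases v (_ ∧' _) = inj₂ refl
  witness-cases v (_ ∨' _) = inj₂ refl
  witness-cases v (_ ⇒' _) = inj₂ refl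
  witness-cases v (∀' _) = inj₂ refl

  -- The reason why adding a witness preserves consistency. All variables of χ and Γ lie below v, so
  -- `capture v` turns a refutation that uses θ [ var v ] into one from θ and the shifted context,
  -- which is the minor premise of `∃E`.
  witness-elim : ∀ v χ {Γ} → FVBelow v χ → All (FVBelow v) Γ → witness χ v ∷ χ ∷ Γ ⊢ ⊥' → χ ∷ Γ ⊢ ⊥'
  witness-elim v χ {Γ} b bs d with witness-cases v χ
  ... | inj₁ (θ , refl) = ∃E (hyp (here refl))
    (≡-subst (_⊢ ⊥') (cong₂ _∷_ (capture-[] v θ b) (map-capture v (∃' θ ∷ Γ) (b ∷ bs)))
      (⊢-subst (capture v) d))
  ... | inj₂ e = cut (hyp (here e) ∷ All.tabulate hyp) d

  witness-bound : ∀ v χ → FVBelow v χ → FVBelow (suc v) (witness χ v)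
  witness-bound v χ b with witness-cases v χ
  ... | inj₁ (θ , refl) = bound-subst (suc v) (suc v) θ b
    λ { zero _ → <⇒<ᵇ (n<1+n v) ; (suc i) p → <⇒<ᵇ (≤-trans (n≤1+n _) p) }
  ... | inj₂ e = ≡-subst (FVBelow (suc v)) (sym e) (bound-mono χ (n≤1+n v) b)

  module Henkin (T : Theory) (closed : ∀ φ → T φ → Sentence φ) (con : Consistent T) where

    mutual
      -- `used n` bounds the variables of `stage n`. As T consists of sentences, it starts at 0, and
      -- the free variables can act as Henkin constants without any extension of the language.
      used : ℕ → ℕ
      used zero = 0
      used (suc n) = suc (fresh n)

      fresh : ℕ → ℕ
      fresh n = used n ⊔ proj₁ (fv (formulaAt {L} n))

    -- Consistency is not decided: a formula belongs to the next stage together with evidence that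
    -- its addition is consistent. The price is that membership in the limit is only stable under
    -- double negation.
    stage : ℕ → Theory
    stage zero = T
    stage (suc n) φ = stage n φ
      ⊎ (Consistent (stage n ⊕ formulaAt n) × (φ ≡ formulaAt n ⊎ φ ≡ witness (formulaAt n) (fresh n)))

    formulaAt-fresh : ∀ n → FVBelow (fresh n) (formulaAt n)
    formulaAt-fresh n = bound-mono (formulaAt n) (m≤n⊔m (used n) _) (proj₂ (fv (formulaAt n)))

    stage-bound : ∀ n φ → stage n φ → FVBelow (used n) φ
    stage-bound zero φ t = closed φ t
    stage-bound (suc n) φ (inj₁ s) =
      bound-mono φ (≤-trans (m≤m⊔n (used n) _) (n≤1+n _)) (stage-bound n φ s)
    stage-bound (suc n) φ (inj₂ (_ , inj₁ refl)) = bound-mono φ (n≤1+n (fresh n)) (formulaAt-fresh n)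
    stage-bound (suc n) φ (inj₂ (_ , inj₂ refl)) = witness-bound (fresh n) (formulaAt n) (formulaAt-fresh n)

    stage-split : ∀ n {Γ} → All (stage (suc n)) Γ → Σ[ Δ ∈ List (Formula L) ]
      (All (stage n) Δ × (Γ ⊆ Δ
        ⊎ (Consistent (stage n ⊕ formulaAt n) × Γ ⊆ witness (formulaAt n) (fresh n) ∷ formulaAt n ∷ Δ)))
    stage-split n [] = [] , [] , inj₁ λ ()
    stage-split n (inj₁ s ∷ ss) with stage-split n ss
    ... | Δ , a , inj₁ h = _ ∷ Δ , s ∷ a , inj₁ (∷⁺ʳ _ h)
    ... | Δ , a , inj₂ (c , h) = _ ∷ Δ , s ∷ a , inj₂ (c ,
      λ { (here refl) → there (there (here refl)) ; (there q) → ∷⁺ʳ _ (∷⁺ʳ _ there) (h q) })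
    stage-split n (inj₂ (c , e) ∷ ss) with stage-split n ss
    ... | Δ , a , r = Δ , a , inj₂ (c , λ { (here refl) → new e ; (there q) → old r q })
      where
      new : ∀ {φ} → φ ≡ formulaAt n ⊎ φ ≡ witness (formulaAt n) (fresh n)
        → φ ∈ witness (formulaAt n) (fresh n) ∷ formulaAt n ∷ Δ
      new (inj₁ refl) = there (here refl)
      new (inj₂ refl) = here refl
      old : ∀ {Γ : List (Formula L)} {C : Set} → Γ ⊆ Δ ⊎ (C × Γ ⊆ witness (formulaAt n) (fresh n) ∷ formulaAt n ∷ Δ)
        → Γ ⊆ witness (formulaAt n) (fresh n) ∷ formulaAt n ∷ Δ
      old (inj₁ h) q = there (there (h q))
      old (inj₂ (_ , h)) q = h q

    stage-consistent : ∀ n → Consistent (stage n)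
    stage-consistent zero = con
    stage-consistent (suc n) (Γ , a , d) with stage-split n a
    ... | Δ , b , inj₁ h = stage-consistent n (Δ , b , weaken h d)
    ... | Δ , b , inj₂ (c , h) = c (formulaAt n ∷ Δ , inj₂ refl ∷ All.map inj₁ b ,
      witness-elim (fresh n) (formulaAt n) (formulaAt-fresh n)
        (All.map (λ {γ} s → bound-mono γ (m≤m⊔n (used n) _) (stage-bound n γ s)) b)
        (weaken h d))

    limit : Theory
    limit φ = Σ[ n ∈ ℕ ] stage n φ

    stage-mono : ∀ {m n} → m ≤ n → ∀ φ → stage m φ → stage n φ
    stage-mono {n = zero} z≤n φ s = s
    stage-mono {n = suc n} p φ s with m≤n⇒m<n∨m≡n p
    ... | inj₁ (s≤s q) = inj₁ (stage-mono q φ s)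
    ... | inj₂ refl = s

    limit-finite : ∀ {Γ} → All limit Γ → Σ[ n ∈ ℕ ] All (stage n) Γ
    limit-finite [] = 0 , []
    limit-finite ((m , s) ∷ ss) with n , a ← limit-finite ss =
      m ⊔ n , stage-mono (m≤m⊔n m n) _ s ∷ All.map (stage-mono (m≤n⊔m m n) _) a

    limit-consistent : Consistent limit
    limit-consistent (Γ , a , d) with n , b ← limit-finite a = stage-consistent n (Γ , b , d)

    -- φ occurs as some `formulaAt n`, and consistency with the limit entails consistency with
    -- `stage n`. Since the hypothesis is a negated statement, deductive closure and stability
    -- follow without case distinctions.
    limit-add : ∀ φ → Consistent (limit ⊕ φ) → limit φ
    limit-add φ c with n , refl ← formulaAt-surjective φ =
      suc n , inj₂ ((λ p → c (Proves-mono (λ { γ (inj₁ s) → inj₁ (n , s) ; γ (inj₂ q) → inj₂ q }) p)) , inj₁ refl)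

    limit-closed : ∀ {φ} → Proves limit φ → limit φ
    limit-closed {φ} p = limit-add φ λ q → limit-consistent (Proves-map₂ ¬E (Proves-¬I q) p)

    limit-stable : ∀ φ → ¬ ¬ limit φ → limit φ
    limit-stable φ h = limit-add φ λ q → h λ l →
      limit-consistent (Proves-map₂ ¬E (Proves-¬I q) (Proves-hyp l))

    limit-¬ : ∀ {φ} → limit (¬' φ) → ¬ limit φ
    limit-¬ p q = limit-consistent (Proves-map₂ ¬E (Proves-hyp p) (Proves-hyp q))

    limit-complete : ∀ {φ} → ¬ limit φ → limit (¬' φ)
    limit-complete {φ} h = limit-stable _ λ n → h (limit-add φ λ q → n (limit-closed (Proves-¬I q)))

    limit-map : ∀ {φ ψ} → (∀ {Γ} → Γ ⊢ φ → Γ ⊢ ψ) → limit φ → limit ψ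
    limit-map f p = limit-closed (Proves-map f (Proves-hyp p))

    limit-map₂ : ∀ {φ ψ χ} → (∀ {Γ} → Γ ⊢ φ → Γ ⊢ ψ → Γ ⊢ χ) → limit φ → limit ψ → limit χ
    limit-map₂ f p q = limit-closed (Proves-map₂ f (Proves-hyp p) (Proves-hyp q))

    limit-witness : ∀ θ → limit (∃' θ) → Σ[ t ∈ Term L ] limit (θ [ t ])
    limit-witness θ l with n , q ← formulaAt-surjective (∃' θ) =
      var (fresh n) , suc n , inj₂ (c , inj₂ (cong (λ χ → witness χ (fresh n)) (sym q)))
      where
      c : Consistent (stage n ⊕ formulaAt n)
      c p = limit-consistent
        (Proves-mono (λ { γ (inj₁ s) → n , s ; γ (inj₂ refl) → ≡-subst limit (sym q) l }) p)

    terms : Structure L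
    terms = record { D = Term L ; fn = fun ; rl = λ r ts → limit (rel r ts) ; _≈_ = λ s t → limit (s ≐ t) }

    open Sat terms

    mutual
      eval≡substT : ∀ e t → eval e t ≡ substT e t
      eval≡substT e (var i) = refl
      eval≡substT e (fun f ts) = cong (fun f) (evals≡substTs e ts)

      evals≡substTs : ∀ {k} e (ts : Vec (Term L) k) → evals e ts ≡ substTs e ts
      evals≡substTs e [] = refl
      evals≡substTs e (t ∷ ts) = cong₂ _∷_ (eval≡substT e t) (evals≡substTs e ts)

    subst-∷ᵉ : ∀ φ (e : ℕ → Term L) t → (subst (liftσ e) φ) [ t ] ≡ subst (t ∷ᵉ e) φ
    subst-∷ᵉ φ e t = trans (subst-lift-inst e φ t) (subst-cong φ λ { zero → refl ; (suc i) → refl })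

    truth : ∀ φ e → sat φ e ⟺ limit (subst e φ)
    truth ⊥' e = (λ ()) , λ l → limit-consistent (Proves-hyp l)
    truth (rel r ts) e = ⟺-≡ (cong (limit ∘ rel r) (evals≡substTs e ts))
    truth (s ≐ t) e = ⟺-≡ (cong₂ (λ u v → limit (u ≐ v)) (eval≡substT e s) (eval≡substT e t))
    truth (¬' φ) e = ⟺-trans (⟺-¬ (truth φ e)) (limit-complete , limit-¬)
    truth (φ ∧' ψ) e = ⟺-trans (⟺-× (truth φ e) (truth ψ e))
      ((λ (p , q) → limit-map₂ ∧I p q) , λ p → limit-map ∧E₁ p , limit-map ∧E₂ p)
    truth (φ ∨' ψ) e = ⟺-trans (⟺-¬ (⟺-× (⟺-¬ (truth φ e)) (⟺-¬ (truth ψ e))))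
      ((λ h → limit-stable _ λ n → h ((λ p → n (limit-map ∨I₁ p)) , λ q → n (limit-map ∨I₂ q))) ,
       λ p (m , n) → limit-consistent (Proves-map₂
         (λ d c → ∨E c (¬E (∧E₁ (weaken there d)) (hyp (here refl))) (¬E (∧E₂ (weaken there d)) (hyp (here refl))))
         (Proves-hyp (limit-map₂ ∧I (limit-complete m) (limit-complete n))) (Proves-hyp p)))
    truth (φ ⇒' ψ) e = ⟺-trans (⟺-→ (truth φ e) (truth ψ e))
      ((λ h → limit-stable _ λ n → n (limit-map
          (λ d → ⇒I (⊥E (¬E (weaken there d) (hyp (here refl)))))
          (limit-complete λ p → n (limit-map (λ d → ⇒I (weaken there d)) (h p))))) ,
       λ p q → limit-map₂ ⇒E p q)
    truth (∀' φ) e = ⟺-trans (⟺-∀ λ t → ⟺-trans (truth φ (t ∷ᵉ e)) (⟺-≡ (cong limit (sym (subst-∷ᵉ φ e t)))))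
      ((λ h → limit-stable _ λ n →
          case limit-witness _ (limit-map ¬∀⇒∃¬ (limit-complete n)) of λ (t , p) → limit-¬ p (h t)) ,
       λ p t → limit-map (λ d → ∀E d t) p)
    truth (∃' φ) e = ⟺-trans (⟺-Σ λ t → ⟺-trans (truth φ (t ∷ᵉ e)) (⟺-≡ (cong limit (sym (subst-∷ᵉ φ e t)))))
      ((λ (t , p) → limit-map (∃I t) p) , limit-witness _)

    model : Model L
    model = record
      { structure = terms
      ; pt = var 0
      ; ≈-refl = λ {t} → limit-closed ([] , [] , ≐refl t)
      ; ≈-sub = λ φ {e} {s} {t} p q → proj₂ (truth φ (t ∷ᵉ e)) (≡-subst limit (subst-∷ᵉ φ e t)
          (limit-map₂ ≐subst p (≡-subst limit (sym (subst-∷ᵉ φ e s)) (proj₁ (truth φ (s ∷ᵉ e)) q))))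
      ; stable = λ φ {e} h → proj₂ (truth φ e) (limit-stable _ λ n → h λ s → n (proj₁ (truth φ e) s))
      }

    model-⊨ : ∀ φ → T φ → ∀ e → sat φ e
    model-⊨ φ t e = proj₂ (truth φ e) (≡-subst limit
      (sym (trans (subst-agree 0 φ (closed φ t) (λ i ())) (subst-id φ λ _ → refl))) (0 , t))

-- Arithmetic in a model of a sequential theory

infixl 1 _>>=_
-- Case distinctions on undecided statements are made in the double-negation monad; `stable`, or a
-- contradictory goal, leads out of it.
_>>=_ : ∀ {A B : Set} → ¬ ¬ A → (A → ¬ ¬ B) → ¬ ¬ B
(m >>= f) k = m λ a → f a k

return : ∀ {A : Set} → A → ¬ ¬ A
return a k = k a

lem : ∀ (A : Set) → ¬ ¬ (A ⊎ ¬ A)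
lem A k = k (inj₂ λ a → k (inj₁ a))

module Arithmetic {L : Lang} {T : Formula L → Set} (S : Sequential T)
  (M : Model L) (M⊨T : ∀ φ → T φ → ∀ e → Model.sat M φ e) where

  open Sequential S using (interp; β; DomFV; EqFV; ZeroFV; SuccFV; AddFV; MulFV; βFV; interprets; sequence)
  open QInterp interp
  open Model M

  N Z : D → Set
  N a = sat Dom (λ _ → a)
  Z a = sat Zero (λ _ → a)

  E Sg : D → D → Set
  E a b = sat Eq (a ∷ᵉ λ _ → b)
  Sg a b = sat Succ (a ∷ᵉ λ _ → b)

  B : D → D → D → Set
  B a b c = sat β (a ∷ᵉ b ∷ᵉ λ _ → c)

  sat-⟨⟩ : ∀ k φ ts e e′ → FVBelow k φ → (∀ i → i < k → eval e (listσ ts i) ≡ e′ i)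
    → sat (φ ⟨ ts ⟩) e ⟺ sat φ e′
  sat-⟨⟩ k φ ts e e′ b h = ⟺-trans (sat-subst φ e (listσ ts)) (sat-agree k φ b h)

  sat₁ : ∀ φ → FVBelow 1 φ → ∀ s e → sat (φ ⟨ s ∷ [] ⟩) e ⟺ sat φ (λ _ → eval e s)
  sat₁ φ b s e = sat-⟨⟩ 1 φ (s ∷ []) e _ b λ { zero _ → refl ; (suc _) (s≤s ()) }

  sat₂ : ∀ φ → FVBelow 2 φ → ∀ s t e → sat (φ ⟨ s ∷ t ∷ [] ⟩) e ⟺ sat φ (eval e s ∷ᵉ λ _ → eval e t)
  sat₂ φ b s t e = sat-⟨⟩ 2 φ (s ∷ t ∷ []) e _ b
    λ { zero _ → refl ; (suc zero) _ → refl ; (suc (suc _)) (s≤s (s≤s ())) }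

  sat₃ : ∀ φ → FVBelow 3 φ → ∀ s t u e
    → sat (φ ⟨ s ∷ t ∷ u ∷ [] ⟩) e ⟺ sat φ (eval e s ∷ᵉ eval e t ∷ᵉ λ _ → eval e u)
  sat₃ φ b s t u e = sat-⟨⟩ 3 φ (s ∷ t ∷ u ∷ []) e _ b
    λ { zero _ → refl ; (suc zero) _ → refl ; (suc (suc zero)) _ → refl
      ; (suc (suc (suc _))) (s≤s (s≤s (s≤s ()))) }

  resp₁ : ∀ φ {a a′} → a ≈ a′ → sat φ (λ _ → a) → sat φ (λ _ → a′)
  resp₁ φ p = sat-≈ φ λ _ → p

  resp₂ : ∀ φ {a a′ b b′} → a ≈ a′ → b ≈ b′ → sat φ (a ∷ᵉ λ _ → b) → sat φ (a′ ∷ᵉ λ _ → b′)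
  resp₂ φ p q = sat-≈ φ λ { zero → p ; (suc _) → q }

  resp₃ : ∀ φ {a a′ b b′ c c′} → a ≈ a′ → b ≈ b′ → c ≈ c′
    → sat φ (a ∷ᵉ b ∷ᵉ λ _ → c) → sat φ (a′ ∷ᵉ b′ ∷ᵉ λ _ → c′)
  resp₃ φ p q r = sat-≈ φ λ { zero → p ; (suc zero) → q ; (suc (suc _)) → r }

  grS : QTerm → (ℕ → D) → D → Set
  grS (qv i) v u = v i ≈ u
  grS q0 v u = Z u
  grS (qS t) v u = Σ[ a ∈ D ] N a × grS t v a × Sg a u
  grS (t q+ s) v u = Σ[ a ∈ D ] Σ[ b ∈ D ] N a × N b × grS t v a × grS s v b × sat Add (a ∷ᵉ b ∷ᵉ λ _ → u)
  grS (t q× s) v u = Σ[ a ∈ D ] Σ[ b ∈ D ] N a × N b × grS t v a × grS s v b × sat Mul (a ∷ᵉ b ∷ᵉ λ _ → u)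

  trS : QForm → (ℕ → D) → Set
  trS q⊥ v = ⊥
  trS (t q= s) v = Σ[ a ∈ D ] Σ[ b ∈ D ] N a × N b × grS t v a × grS s v b × E a b
  trS (q¬ φ) v = ¬ trS φ v
  trS (φ q∧ ψ) v = trS φ v × trS ψ v
  trS (q∨ φ ψ) v = ¬ ((¬ trS φ v) × (¬ trS ψ v))
  trS (φ q⇒ ψ) v = trS φ v → trS ψ v
  trS (q∀ φ) v = ∀ d → N d → trS φ (d ∷ᵉ v)
  trS (q∃ φ) v = Σ[ d ∈ D ] N d × trS φ (d ∷ᵉ v)

  private
    shift₁ : ∀ (ρ : ℕ → Term L) {e : ℕ → D} (v : ℕ → D) d → (∀ i → eval e (ρ i) ≡ v i)
      → ∀ i → eval (d ∷ᵉ e) (shiftT (ρ i)) ≡ v i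
    shift₁ ρ {e} v d h i = trans (eval-subst (d ∷ᵉ e) _ (ρ i)) (h i)

    shift₂ : ∀ (ρ : ℕ → Term L) {e : ℕ → D} (v : ℕ → D) d c → (∀ i → eval e (ρ i) ≡ v i)
      → ∀ i → eval (c ∷ᵉ d ∷ᵉ e) (shiftT (shiftT (ρ i))) ≡ v i
    shift₂ ρ {e} v d c h = shift₁ (λ i → shiftT (ρ i)) v c (shift₁ ρ v d h)

    eval-sh2 : ∀ d c e u → eval (c ∷ᵉ d ∷ᵉ e) (shiftT (shiftT u)) ≡ eval e u
    eval-sh2 d c e u = shift₂ (λ _ → u) {e} (λ _ → eval e u) d c (λ _ → refl) 0

  sat-gr : ∀ t ρ u e v → (∀ i → eval e (ρ i) ≡ v i) → sat (gr interp t ρ u) e ⟺ grS t v (eval e u)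
  sat-gr₂ : ∀ φ → FVBelow 3 φ → ∀ t s ρ u e v → (∀ i → eval e (ρ i) ≡ v i) → ∀ a b →
    sat (Dom ⟨ var 1 ∷ [] ⟩ ∧' Dom ⟨ var 0 ∷ [] ⟩
      ∧' gr interp t (λ i → shiftT (shiftT (ρ i))) (var 1) ∧' gr interp s (λ i → shiftT (shiftT (ρ i))) (var 0)
      ∧' φ ⟨ var 1 ∷ var 0 ∷ shiftT (shiftT u) ∷ [] ⟩) (b ∷ᵉ a ∷ᵉ e)
    ⟺ (N a × N b × grS t v a × grS s v b × sat φ (a ∷ᵉ b ∷ᵉ λ _ → eval e u))
  sat-gr (qv i) ρ u e v h = ⟺-≡ (cong (_≈ eval e u) (h i))
  sat-gr q0 ρ u e v h = sat₁ Zero ZeroFV u e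
  sat-gr (qS t) ρ u e v h = ⟺-Σ λ a → ⟺-× (sat₁ Dom DomFV (var 0) _)
    (⟺-× (sat-gr t _ (var 0) _ v (shift₁ ρ v a h))
      (⟺-trans (sat₂ Succ SuccFV (var 0) (shiftT u) _)
        (⟺-≡ (cong (λ x → sat Succ (a ∷ᵉ λ _ → x)) (eval-subst (a ∷ᵉ e) _ u)))))
  sat-gr (t q+ s) ρ u e v h = ⟺-Σ λ a → ⟺-Σ λ b → sat-gr₂ Add AddFV t s ρ u e v h a b
  sat-gr (t q× s) ρ u e v h = ⟺-Σ λ a → ⟺-Σ λ b → sat-gr₂ Mul MulFV t s ρ u e v h a b
  sat-gr₂ φ bφ t s ρ u e v h a b =
    ⟺-× (sat₁ Dom DomFV (var 1) _) (⟺-× (sat₁ Dom DomFV (var 0) _)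
      (⟺-× (sat-gr t _ (var 1) _ v (shift₂ ρ v a b h)) (⟺-× (sat-gr s _ (var 0) _ v (shift₂ ρ v a b h))
        (⟺-trans (sat₃ φ bφ (var 1) (var 0) (shiftT (shiftT u)) _)
          (⟺-≡ (cong (λ x → sat φ (a ∷ᵉ b ∷ᵉ λ _ → x)) (eval-sh2 a b e u)))))))

  sat-tr : ∀ φ ρ e v → (∀ i → eval e (ρ i) ≡ v i) → sat (tr interp φ ρ) e ⟺ trS φ v
  private
    sat-tr-under : ∀ φ ρ e v → (∀ i → eval e (ρ i) ≡ v i) → ∀ d →
      sat (tr interp φ (var 0 ∷σ (shiftT ∘ ρ))) (d ∷ᵉ e) ⟺ trS φ (d ∷ᵉ v)
    sat-tr-under φ ρ e v h d =
      sat-tr φ _ _ _ λ { zero → refl ; (suc i) → shift₁ ρ v d h i }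
  sat-tr q⊥ ρ e v h = ⟺-refl
  sat-tr (t q= s) ρ e v h = ⟺-Σ λ a → ⟺-Σ λ b →
    ⟺-× (sat₁ Dom DomFV (var 1) _) (⟺-× (sat₁ Dom DomFV (var 0) _)
      (⟺-× (sat-gr t _ (var 1) _ v (shift₂ ρ v a b h)) (⟺-× (sat-gr s _ (var 0) _ v (shift₂ ρ v a b h))
        (sat₂ Eq EqFV (var 1) (var 0) _))))
  sat-tr (q¬ φ) ρ e v h = ⟺-¬ (sat-tr φ ρ e v h)
  sat-tr (φ q∧ ψ) ρ e v h = ⟺-× (sat-tr φ ρ e v h) (sat-tr ψ ρ e v h)
  sat-tr (q∨ φ ψ) ρ e v h = ⟺-¬ (⟺-× (⟺-¬ (sat-tr φ ρ e v h)) (⟺-¬ (sat-tr ψ ρ e v h)))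
  sat-tr (φ q⇒ ψ) ρ e v h = ⟺-→ (sat-tr φ ρ e v h) (sat-tr ψ ρ e v h)
  sat-tr (q∀ φ) ρ e v h = ⟺-∀ λ d → ⟺-→ (sat₁ Dom DomFV (var 0) _) (sat-tr-under φ ρ e v h d)
  sat-tr (q∃ φ) ρ e v h = ⟺-Σ λ d → ⟺-× (sat₁ Dom DomFV (var 0) _) (sat-tr-under φ ρ e v h d)

  abstract
    Proves⇒sat : ∀ {φ} → Proves T φ → ∀ e → sat φ e
    Proves⇒sat (Γ , a , d) e = sound d e (All.map (λ {γ} t → M⊨T γ t e) a)

  abstract
    axiom : ∀ {φ} → QAxiom⁺ φ → trS φ (λ _ → pt)
    axiom {φ} a = proj₁ (sat-tr φ var (λ _ → pt) _ λ _ → refl) (Proves⇒sat (interprets φ a) _)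

  infix 4 _,°_
  record Nat° : Set where
    constructor _,°_
    field
      el  : D
      isN : N el
  open Nat° public

  infix 4 _~_
  record _~_ (a b : Nat°) : Set where
    constructor ⟪_⟫
    field eq : E (el a) (el b)
  open _~_ public

  E-var : ∀ v i j → trS (qv i q= qv j) v → E (v i) (v j)
  E-var v i j (a , b , _ , _ , p , q , e) = resp₂ Eq (≈-sym p) (≈-sym q) e

  var-E : ∀ v i j → N (v i) → N (v j) → E (v i) (v j) → trS (qv i q= qv j) v
  var-E v i j n m e = v i , v j , n , m , ≈-refl , ≈-refl , e

  abstract
    ~-refl : ∀ {a} → a ~ a
    ~-refl {a ,° n} = ⟪ E-var (a ∷ᵉ λ _ → pt) 0 0 (axiom E1 a n) ⟫

    -- E2 is the congruence axiom for equality itself. Together with reflexivity it has symmetry and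
    -- transitivity as instances.
    ~-euclid : ∀ {a b c d} → a ~ b → c ~ d → a ~ c → b ~ d
    ~-euclid {a ,° na} {b ,° nb} {c ,° nc} {d ,° md} ⟪ p ⟫ ⟪ q ⟫ ⟪ r ⟫ =
      let v = d ∷ᵉ c ∷ᵉ b ∷ᵉ a ∷ᵉ λ _ → pt in
      ⟪ E-var v 2 0 (axiom E2 a na b nb c nc d md
        (var-E v 3 2 na nb p , var-E v 1 0 nc md q) (var-E v 3 1 na nc r)) ⟫

  ~-sym : ∀ {a b} → a ~ b → b ~ a
  ~-sym p = ~-euclid p ~-refl ~-refl

  ~-trans : ∀ {a b c} → a ~ b → b ~ c → a ~ c
  ~-trans p q = ~-euclid ~-refl q p

  E-refl : ∀ {a} → N a → E a a
  E-refl {a} n = eq (~-refl {a ,° n})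

  ~-of-≈ : ∀ {a b} → el a ≈ el b → a ~ b
  ~-of-≈ {a} p = ⟪ resp₂ Eq ≈-refl p (E-refl (isN a)) ⟫

  abstract
    zero°-Z : Σ[ a ∈ Nat° ] Z (el a)
    -- The witness is the value a inside the translated equation and not the quantified element: the
    -- latter is only `Eq`-equal to a, and `Zero` is not known to respect `Eq`. The same choice is
    -- made for the other operations.
    zero°-Z with _ , _ , a , _ , n , _ , z , _ ← axiom F0 = (a ,° n) , z

    suc°-Sg : ∀ a → Σ[ b ∈ Nat° ] Sg (el a) (el b)
    suc°-Sg (a ,° na) with _ , _ , b , _ , nb , _ , (c , _ , p , s) , _ ← axiom FS a na =
      (b ,° nb) , resp₂ Succ (≈-sym p) ≈-refl s

  zero° : Nat°
  zero° = proj₁ zero°-Z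

  suc° : Nat° → Nat°
  suc° a = proj₁ (suc°-Sg a)

  abstract
    Z-unique : ∀ {a b : Nat°} → Z (el a) → Z (el b) → a ~ b
    Z-unique {a ,° na} {b ,° nb} p q = ⟪ E-var (b ∷ᵉ a ∷ᵉ λ _ → pt) 1 0 (axiom U0 a na b nb
      ((a , a , na , na , p , ≈-refl , E-refl na) , b , b , nb , nb , q , ≈-refl , E-refl nb)) ⟫

    Sg-unique : ∀ {a b c : Nat°} → Sg (el a) (el b) → Sg (el a) (el c) → b ~ c
    Sg-unique {a ,° na} {b ,° nb} {c ,° nc} p q =
      ⟪ E-var (c ∷ᵉ b ∷ᵉ a ∷ᵉ λ _ → pt) 1 0 (axiom US a na b nb c nc
      ((b , b , nb , nb , (a , na , ≈-refl , p) , ≈-refl , E-refl nb) ,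
        c , c , nc , nc , (a , na , ≈-refl , q) , ≈-refl , E-refl nc)) ⟫

    Sg-cong : ∀ {a a′ b b′ : Nat°} → a ~ a′ → Sg (el a) (el b) → Sg (el a′) (el b′) → b ~ b′
    Sg-cong {a ,° na} {a′ ,° na′} {b} {b′} ⟪ p ⟫ s s′
      with c , c′ , nc , nc′ , (_ , _ , x , t) , (_ , _ , x′ , t′) , q ← axiom E3 a na a′ na′
        (var-E (a′ ∷ᵉ a ∷ᵉ λ _ → pt) 1 0 na na′ p) =
      ~-trans (Sg-unique {a ,° na} {b} {c ,° nc} s (resp₂ Succ (≈-sym x) ≈-refl t))
        (~-trans {c ,° nc} {c′ ,° nc′} ⟪ q ⟫
          (Sg-unique {a′ ,° na′} {c′ ,° nc′} {b′} (resp₂ Succ (≈-sym x′) ≈-refl t′) s′))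

  graph : Formula L → Nat° → Nat° → Nat° → Set
  graph φ a b c = sat φ (el a ∷ᵉ el b ∷ᵉ λ _ → el c)

  record Operation (φ : Formula L) : Set where
    field
      total     : ∀ a b → Σ[ c ∈ Nat° ] graph φ a b c
      congruent : ∀ {a a′ b b′ c c′} → a ~ a′ → b ~ b′ → graph φ a b c → graph φ a′ b′ c′ → c ~ c′
  open Operation

  -- The form in which grS, hence each of the axioms F, U and E, mentions Add and Mul.
  valueS : Formula L → D → D → D → Set
  valueS φ a b u = Σ[ c ∈ D ] Σ[ d ∈ D ] N c × N d × a ≈ c × b ≈ d × sat φ (c ∷ᵉ d ∷ᵉ λ _ → u)

  -- The three hypotheses are the unfolded axioms of totality, uniqueness and congruence, so that
  -- addition and multiplication can be treated alike.
  operation : ∀ φ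
    → (∀ a → N a → ∀ b → N b → Σ[ w ∈ D ] N w × (Σ[ u ∈ D ] Σ[ v ∈ D ] N u × N v × valueS φ a b u × w ≈ v × E u v))
    → (∀ a → N a → ∀ b → N b → ∀ c → N c → ∀ d → N d
        → (Σ[ u ∈ D ] Σ[ v ∈ D ] N u × N v × valueS φ a b u × c ≈ v × E u v)
          × (Σ[ u ∈ D ] Σ[ v ∈ D ] N u × N v × valueS φ a b u × d ≈ v × E u v)
        → trS (qv 1 q= qv 0) (d ∷ᵉ c ∷ᵉ b ∷ᵉ a ∷ᵉ λ _ → pt))
    → (∀ a → N a → ∀ a′ → N a′ → ∀ b → N b → ∀ b′ → N b′
        → trS (qv 3 q= qv 2 q∧ qv 1 q= qv 0) (b′ ∷ᵉ b ∷ᵉ a′ ∷ᵉ a ∷ᵉ λ _ → pt)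
        → Σ[ u ∈ D ] Σ[ v ∈ D ] N u × N v × valueS φ a b u × valueS φ a′ b′ v × E u v)
    → Operation φ
  operation φ F U C = record { total = tot ; congruent = con }
    where
    tot : ∀ a b → Σ[ c ∈ Nat° ] graph φ a b c
    tot (a ,° na) (b ,° nb) with _ , _ , c , _ , nc , _ , (_ , _ , _ , _ , p , q , s) , _ ← F a na b nb =
      (c ,° nc) , resp₃ φ (≈-sym p) (≈-sym q) ≈-refl s
    uni : ∀ {a b c d} → graph φ a b c → graph φ a b d → c ~ d
    uni {a ,° na} {b ,° nb} {c ,° nc} {d ,° md} p q =
      ⟪ E-var (d ∷ᵉ c ∷ᵉ b ∷ᵉ a ∷ᵉ λ _ → pt) 1 0 (U a na b nb c nc d md
      ((c , c , nc , nc , (a , b , na , nb , ≈-refl , ≈-refl , p) , ≈-refl , E-refl nc) ,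
        d , d , md , md , (a , b , na , nb , ≈-refl , ≈-refl , q) , ≈-refl , E-refl md)) ⟫
    con : ∀ {a a′ b b′ c c′} → a ~ a′ → b ~ b′ → graph φ a b c → graph φ a′ b′ c′ → c ~ c′
    con {a ,° na} {a′ ,° na′} {b ,° nb} {b′ ,° nb′} {c} {c′} ⟪ p ⟫ ⟪ q ⟫ s s′ =
      let v = b′ ∷ᵉ b ∷ᵉ a′ ∷ᵉ a ∷ᵉ λ _ → pt
          d , d′ , md , md′ , (_ , _ , _ , _ , x , y , t) , (_ , _ , _ , _ , x′ , y′ , t′) , r =
            C a na a′ na′ b nb b′ nb′ (var-E v 3 2 na na′ p , var-E v 1 0 nb nb′ q)
      in ~-trans (uni {a ,° na} {b ,° nb} {c} {d ,° md} s (resp₃ φ (≈-sym x) (≈-sym y) ≈-refl t))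
        (~-trans ⟪ r ⟫ (uni {a′ ,° na′} {b′ ,° nb′} {d′ ,° md′} {c′} (resp₃ φ (≈-sym x′) (≈-sym y′) ≈-refl t′) s′))

  abstract
    addition : Operation Add
    addition = operation Add (axiom F+) (axiom U+) (axiom E4)

    multiplication : Operation Mul
    multiplication = operation Mul (axiom F×) (axiom U×) (axiom E5)

  infixl 6 _+°_
  _+°_ : Nat° → Nat° → Nat°
  a +° b = proj₁ (total addition a b)

  infixl 7 _×°_
  _×°_ : Nat° → Nat° → Nat°
  a ×° b = proj₁ (total multiplication a b)

  value : QTerm → (ℕ → Nat°) → Nat°
  value (qv i) v = v i
  value q0 v = zero°
  value (qS t) v = suc° (value t v)
  value (t q+ s) v = value t v +° value s v
  value (t q× s) v = value t v ×° value s v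

  gr-value : ∀ t {v w} → (∀ i → el (v i) ≡ w i) → Σ[ u ∈ Nat° ] (grS t w (el u) × u ~ value t v)
  gr-value (qv i) {v} h = v i , ≡-subst (_≈ el (v i)) (h i) ≈-refl , ~-refl
  gr-value q0 h = zero° , proj₂ zero°-Z , ~-refl
  gr-value (qS t) {v} h with u , g , p ← gr-value t {v} h =
    suc° u , (el u , isN u , g , proj₂ (suc°-Sg u)) ,
    Sg-cong p (proj₂ (suc°-Sg u)) (proj₂ (suc°-Sg _))
  gr-value (t q+ s) {v} h with u , g , p ← gr-value t {v} h | w , k , q ← gr-value s {v} h =
    u +° w , (_ , _ , isN u , isN w , g , k , proj₂ (total addition u w)) ,
    congruent addition p q (proj₂ (total addition u w)) (proj₂ (total addition _ _))
  gr-value (t q× s) {v} h with u , g , p ← gr-value t {v} h | w , k , q ← gr-value s {v} h =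
    u ×° w , (_ , _ , isN u , isN w , g , k , proj₂ (total multiplication u w)) ,
    congruent multiplication p q (proj₂ (total multiplication u w)) (proj₂ (total multiplication _ _))

  gr-unique : ∀ t {v w} (u : Nat°) → (∀ i → el (v i) ≡ w i) → grS t w (el u) → u ~ value t v
  gr-unique (qv i) {v} u h g = ~-sym (~-of-≈ (≡-subst (_≈ el u) (sym (h i)) g))
  gr-unique q0 u h g = Z-unique g (proj₂ zero°-Z)
  gr-unique (qS t) {v} u h (a , na , g , s) =
    Sg-cong (gr-unique t {v} (a ,° na) h g) s (proj₂ (suc°-Sg _))
  gr-unique (t q+ s) {v} u h (a , b , na , nb , g , k , r) =
    congruent addition (gr-unique t {v} (a ,° na) h g) (gr-unique s {v} (b ,° nb) h k) r (proj₂ (total addition _ _))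
  gr-unique (t q× s) {v} u h (a , b , na , nb , g , k , r) =
    congruent multiplication (gr-unique t {v} (a ,° na) h g) (gr-unique s {v} (b ,° nb) h k) r (proj₂ (total multiplication _ _))

  -- The translation is relational: each term is unravelled into graphs of its operations. `trN` is
  -- its functional reading with chosen values of 0, S, + and ×, unique up to `_~_`; in this form
  -- the axioms of Q can be used as they are written.
  trN : QForm → (ℕ → Nat°) → Set
  trN q⊥ v = ⊥
  trN (t q= s) v = value t v ~ value s v
  trN (q¬ φ) v = ¬ trN φ v
  trN (φ q∧ ψ) v = trN φ v × trN ψ v
  trN (q∨ φ ψ) v = ¬ ((¬ trN φ v) × (¬ trN ψ v))
  trN (φ q⇒ ψ) v = trN φ v → trN ψ v
  trN (q∀ φ) v = ∀ a → trN φ (a ∷ᵉ v)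
  trN (q∃ φ) v = Σ[ a ∈ Nat° ] trN φ (a ∷ᵉ v)

  trS-N : ∀ φ {v w} → (∀ i → el (v i) ≡ w i) → trS φ w ⟺ trN φ v
  private
    trS-N-under : ∀ φ {v w} → (∀ i → el (v i) ≡ w i) → ∀ a → trS φ (el a ∷ᵉ w) ⟺ trN φ (a ∷ᵉ v)
    trS-N-under φ h a = trS-N φ λ { zero → refl ; (suc i) → h i }
  trS-N q⊥ h = ⟺-refl
  trS-N (t q= s) {v} h =
    (λ (a , b , na , nb , g , k , p) →
      ~-trans (~-sym (gr-unique t {v} (a ,° na) h g)) (~-trans ⟪ p ⟫ (gr-unique s {v} (b ,° nb) h k))) ,
    λ p → let a , g , q = gr-value t {v} h ; b , k , r = gr-value s {v} h in
      el a , el b , isN a , isN b , g , k , eq (~-trans q (~-trans p (~-sym r)))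
  trS-N (q¬ φ) h = ⟺-¬ (trS-N φ h)
  trS-N (φ q∧ ψ) h = ⟺-× (trS-N φ h) (trS-N ψ h)
  trS-N (q∨ φ ψ) h = ⟺-¬ (⟺-× (⟺-¬ (trS-N φ h)) (⟺-¬ (trS-N ψ h)))
  trS-N (φ q⇒ ψ) h = ⟺-→ (trS-N φ h) (trS-N ψ h)
  trS-N (q∀ φ) h = (λ f a → proj₁ (trS-N-under φ h a) (f (el a) (isN a)))
    , λ f d n → proj₂ (trS-N-under φ h (d ,° n)) (f (d ,° n))
  trS-N (q∃ φ) h = (λ (d , n , p) → (d ,° n) , proj₁ (trS-N-under φ h (d ,° n)) p)
    , λ (a , p) → el a , isN a , proj₂ (trS-N-under φ h a) p

  abstract
    arith : ∀ {φ} → QAxiom⁺ φ → trN φ (λ _ → zero°)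
    arith {φ} a = proj₁ (trS-N φ λ _ → refl)
      (proj₁ (sat-tr φ var (λ _ → el zero°) _ λ _ → refl) (Proves⇒sat (interprets φ a) _))

  ~-suc : ∀ {a b} → a ~ b → suc° a ~ suc° b
  ~-suc p = Sg-cong p (proj₂ (suc°-Sg _)) (proj₂ (suc°-Sg _))

  ~-+ : ∀ {a a′ b b′} → a ~ a′ → b ~ b′ → a +° b ~ a′ +° b′
  ~-+ p q = congruent addition p q (proj₂ (total addition _ _)) (proj₂ (total addition _ _))

  suc≉zero : ∀ {a} → ¬ suc° a ~ zero°
  suc≉zero p = arith Q1 _ p

  suc°-inj : ∀ {a b} → suc° a ~ suc° b → a ~ b
  suc°-inj p = arith Q2 _ _ p

  zero-or-suc : ∀ a → ¬ ¬ (a ~ zero° ⊎ Σ[ b ∈ Nat° ] a ~ suc° b)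
  zero-or-suc a = lem (a ~ zero°) >>= λ
    { (inj₁ p) → return (inj₁ p)
    ; (inj₂ n) → return (inj₂ (arith Q3 a n)) }

  +-zero° : ∀ a → a +° zero° ~ a
  +-zero° a = arith Q4 a

  +-suc° : ∀ a b → a +° suc° b ~ suc° (a +° b)
  +-suc° a b = arith Q5 a b

  -- Standard numbers and the order

  num : ℕ → Nat°
  num zero = zero°
  num (suc k) = suc° (num k)

  num-inj : ∀ {j k} → num j ~ num k → j ≡ k
  num-inj {zero} {zero} p = refl
  num-inj {zero} {suc k} p = ⊥-elim (suc≉zero (~-sym p))
  num-inj {suc j} {zero} p = ⊥-elim (suc≉zero p)
  num-inj {suc j} {suc k} p = cong suc (num-inj (suc°-inj p))

  num-cong : ∀ {j k} → j ≡ k → num j ~ num k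
  num-cong refl = ~-refl

  num-+ : ∀ j k → num j +° num k ~ num (k + j)
  num-+ j zero = +-zero° (num j)
  num-+ j (suc k) = ~-trans (+-suc° (num j) (num k)) (~-suc (num-+ j k))

  -- Addition recurses on its right argument and Q does not prove commutativity. With a standard
  -- right summand, the induction on k can take place outside the model.
  suc-+-num : ∀ a k → suc° a +° num k ~ suc° (a +° num k)
  suc-+-num a zero = ~-trans (+-zero° (suc° a)) (~-suc (~-sym (+-zero° a)))
  suc-+-num a (suc k) = ~-trans (+-suc° (suc° a) (num k))
    (~-suc (~-trans (suc-+-num a k) (~-sym (+-suc° a (num k)))))

  zero-+-num : ∀ k → zero° +° num k ~ num k
  zero-+-num k = ~-trans (num-+ 0 k) (num-cong (+-identityʳ k))

  infix 4 _≤°_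
  _≤°_ : Nat° → Nat° → Set
  a ≤° b = Σ[ z ∈ Nat° ] z +° a ~ b

  ≤°-resp : ∀ {a a′ b b′} → a ~ a′ → b ~ b′ → a ≤° b → a′ ≤° b′
  ≤°-resp p q (z , r) = z , ~-trans (~-+ ~-refl (~-sym p)) (~-trans r q)

  num-≤ : ∀ {j k} → j ≤ k → num j ≤° num k
  num-≤ {j} {k} p = num (k ∸ j) , ~-trans (num-+ (k ∸ j) j) (num-cong (m+[n∸m]≡n p))

  -- Numbers below a standard one are standard. By Q3, a is zero or a successor of some b; in the
  -- latter case z +° a is the successor of z +° b, and both sides of the equation drop by one.
  ≤°-num : ∀ k a → a ≤° num k → ¬ ¬ (Σ[ j ∈ ℕ ] j ≤ k × a ~ num j)
  ≤°-num k a (z , p) = zero-or-suc a >>= λ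
    { (inj₁ q) → return (0 , z≤n , q)
    ; (inj₂ (b , q)) → below k b q (~-trans (~-sym (+-suc° z b)) (~-trans (~-+ ~-refl (~-sym q)) p)) }
    where
    below : ∀ k b → a ~ suc° b → suc° (z +° b) ~ num k → ¬ ¬ (Σ[ j ∈ ℕ ] j ≤ k × a ~ num j)
    below zero b q r = ⊥-elim (suc≉zero r)
    below (suc k) b q r = ≤°-num k b (z , suc°-inj r) >>= λ
      { (j , s , t) → return (suc j , s≤s s , ~-trans q (~-suc t)) }

  -- If z +° num k ~ a, the step to `suc k` depends on z: zero means that a is `num k`, and a
  -- successor is passed from z to the standard summand by `suc-+-num`.
  ≤°-compare : ∀ k a → ¬ ¬ (a ≤° num k ⊎ num k ≤° a)
  ≤°-compare zero a = return (inj₂ (a , +-zero° a))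
  ≤°-compare (suc k) a = ≤°-compare k a >>= λ
    { (inj₁ p) → ≤°-num k a p >>= λ
      { (j , q , r) → return (inj₁ (≤°-resp (~-sym r) ~-refl (num-≤ (m≤n⇒m≤1+n q)))) }
    ; (inj₂ (z , p)) → zero-or-suc z >>= λ
      { (inj₁ q) → return (inj₁ (≤°-resp
          (~-trans (~-sym (zero-+-num k)) (~-trans (~-+ (~-sym q) ~-refl) p)) ~-refl (num-≤ (n≤1+n k))))
      ; (inj₂ (y , q)) → return (inj₂ (y , ~-trans (+-suc° y (num k))
          (~-trans (~-sym (suc-+-num y k)) (~-trans (~-+ (~-sym q) ~-refl) p)))) } }

  B-resp : ∀ {a a′ b b′ c c′} → a ≈ a′ → b ≈ b′ → c ≈ c′ → B a b c → B a′ b′ c′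
  B-resp = resp₃ β

  abstract
    -- The sequence axiom read in M: entries before k are copied from w, the one at k becomes x.
    -- Positions that are not known to be at most k remain uncontrolled.
    append : ∀ w x k → Σ[ w′ ∈ D ] (∀ (i : Nat°) y → i ≤° k →
      B y (el i) w′ ⟺ (¬ ¬ (((¬ i ~ k) × B y (el i) w) ⊎ (i ~ k × y ≈ x))))
    append w x k with w′ , f ← Proves⇒sat sequence (λ _ → pt) w x (el k) = w′ , λ i y p →
      let v = λ j → listσ {L} (var 1 ∷ var 3 ∷ []) j
          e = y ∷ᵉ el i ∷ᵉ w′ ∷ᵉ el k ∷ᵉ x ∷ᵉ w ∷ᵉ λ _ → pt
          v° = i ∷ᵉ λ _ → k
          w° = el i ∷ᵉ λ _ → el k
          le : sat (tr interp (qLe 0 1) v) e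
          le = proj₂ (sat-tr (qLe 0 1) v e _ (λ _ → refl))
            (proj₂ (trS-N (qLe 0 1) {v°} {w°} λ { zero → refl ; (suc _) → refl }) p)
          eqv : sat (tr interp (qv 0 q= qv 1) v) e ⟺ (i ~ k)
          eqv = ⟺-trans (sat-tr (qv 0 q= qv 1) v e _ (λ _ → refl))
            (trS-N (qv 0 q= qv 1) {v°} {w°} λ { zero → refl ; (suc _) → refl })
          to , from = f (el i) y (proj₂ (sat₁ Dom DomFV (var 3) e) (isN k) , le)
      in (λ b n → to (proj₂ (sat₃ β βFV (var 0) (var 1) (var 2) e) b)
            ((λ ((_ , ne) , b′) → n (inj₁ ((λ q → ne (proj₂ eqv q)) , proj₁ (sat₃ β βFV (var 0) (var 1) (var 5) e) b′)))
            , λ (q , r) → n (inj₂ (proj₁ eqv q , r))))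
       , λ nn → proj₁ (sat₃ β βFV (var 0) (var 1) (var 2) e) (from λ (m , n) → nn λ
            { (inj₁ (ne , b)) → m ((le , λ q → ne (proj₁ eqv q)) , proj₂ (sat₃ β βFV (var 0) (var 1) (var 5) e) b)
            ; (inj₂ (q , r)) → n (proj₂ eqv q , r) })

-- Trees coded by sequences

-- Trees with holes: patterns have variables in the holes, descriptions of
-- elements of a model have elements there.
infixr 5 _·_
data Shape (A : Set) : Set where
  at  : A → Shape A
  lf  : ℕ → Shape A
  _·_ : Shape A → Shape A → Shape A

bind : ∀ {A B : Set} → (A → Shape B) → Shape A → Shape B
bind f (at a) = f a
bind f (lf k) = lf k
bind f (s · t) = bind f s · bind f t

embed : ∀ {A} → Tree → Shape A
embed (leaf k) = lf k
embed (nd s t) = embed s · embed t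

bind-embed : ∀ {A B : Set} (f : A → Shape B) t → bind f (embed t) ≡ embed t
bind-embed f (leaf k) = refl
bind-embed f (nd s t) = cong₂ _·_ (bind-embed f s) (bind-embed f t)

numQ : ℕ → QTerm
numQ zero = q0
numQ (suc k) = qS (numQ k)

-- Arguments of these formulas are (indices of) variables.
module Formulas {L : Lang} (I : QInterp L) (β : Formula L) where
  open QInterp I

  natF : ℕ → Formula L
  natF x = subst (λ _ → var x) Dom

  arithF : QForm → ℕ → ℕ → Formula L
  arithF φ x y = tr I φ (var x ∷σ λ _ → var y)

  isNumF : ℕ → ℕ → Formula L
  isNumF k x = natF x ∧' arithF (qv 0 q= numQ k) x x

  leF : ℕ → ℕ → Formula L
  leF = arithF (qLe 0 1)

  entryF : ℕ → ℕ → ℕ → Formula L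
  entryF y i w = subst (var y ∷σ var i ∷σ λ _ → var w) β

  -- The position ranges over all elements that are `Eq`-equal to the numeral, because β is not
  -- assumed to respect `Eq`. The equivalence makes u the only entry there, which is what allows
  -- decoding.
  atF : ℕ → ℕ → ℕ → Formula L
  atF k x u = ∀' (isNumF k 0 ⇒' ∀' (entryF 0 1 (2 + x) ⇔' (var 0 ≐ var (2 + u))))

  -- Trees are sequences of length 1 or 3; entry 0 is 1 + k for a leaf labelled k and 0 for a pair.
  leafF : ℕ → ℕ → Formula L
  leafF k x = ∃' (atF 0 (1 + x) 0 ∧' isNumF (suc k) 0)

  pairF : ℕ → ℕ → ℕ → Formula L
  pairF y z x = ∃' (atF 0 (1 + x) 0 ∧' isNumF 0 0) ∧' atF 1 x y ∧' atF 2 x z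

  -- A coded finite set is a sequence w with a last position l, as sequences carry no length of
  -- their own.
  memF : ℕ → ℕ → ℕ → Formula L
  memF e w l = ∃' (natF 0 ∧' leF 0 (1 + l) ∧' entryF (1 + e) 0 (1 + w))

module Coding {L : Lang} {T : Formula L → Set} (S : Sequential T)
  (M : Model L) (M⊨T : ∀ φ → T φ → ∀ e → Model.sat M φ e) where

  open Arithmetic S M M⊨T public
  open Sequential S using (interp; β)
  open Formulas interp β public
  open Model M

  ≈-stable : ∀ {a b} → ¬ ¬ a ≈ b → a ≈ b
  ≈-stable {a} {b} = stable (var 0 ≐ var 1) {a ∷ᵉ λ _ → b}

  sat-nat : ∀ x e → sat (natF x) e ⟺ N (e x)
  sat-nat x e = sat-subst (QInterp.Dom interp) e _

  sat-arith : ∀ φ x y e (m : N (e x)) (n : N (e y))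
    → sat (arithF φ x y) e ⟺ trN φ ((e x ,° m) ∷ᵉ λ _ → (e y ,° n))
  sat-arith φ x y e m n = ⟺-trans (sat-tr φ _ e _ λ _ → refl)
    (trS-N φ λ { zero → refl ; (suc _) → refl })

  infix 4 _,ⁿ_
  record IsNum (k : ℕ) (a : D) : Set where
    constructor _,ⁿ_
    field
      isNat : N a
      ~num  : (a ,° isNat) ~ num k

  value-numQ : ∀ k v → value (numQ k) v ≡ num k
  value-numQ zero v = refl
  value-numQ (suc k) v = cong suc° (value-numQ k v)

  sat-isNum : ∀ k x e → sat (isNumF k x) e ⟺ IsNum k (e x)
  sat-isNum k x e =
    (λ (n , p) → let n′ = proj₁ (sat-nat x e) n in
      n′ ,ⁿ ≡-subst (_ ~_) (value-numQ k _) (proj₁ (sat-arith (qv 0 q= numQ k) x x e n′ n′) p)) ,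
    λ (n ,ⁿ p) → proj₂ (sat-nat x e) n
      , proj₂ (sat-arith (qv 0 q= numQ k) x x e n n) (≡-subst (_ ~_) (sym (value-numQ k _)) p)

  IsNum-num : ∀ k → IsNum k (el (num k))
  IsNum-num k = isN (num k) ,ⁿ ~-refl

  IsNum-≈ : ∀ {k a b} → a ≈ b → IsNum k a → IsNum k b
  IsNum-≈ p (n ,ⁿ q) = resp₁ (QInterp.Dom interp) p n ,ⁿ ~-trans (~-of-≈ (≈-sym p)) q

  IsNum-unique : ∀ {j k a} → IsNum j a → IsNum k a → j ≡ k
  IsNum-unique (m ,ⁿ p) (n ,ⁿ q) = num-inj (~-trans (~-sym p) (~-trans (~-of-≈ ≈-refl) q))

  sat-le : ∀ i k e (m : N (e i)) (n : N (e k)) → sat (leF i k) e ⟺ ((e i ,° m) ≤° (e k ,° n))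
  sat-le i k e m n = sat-arith (qLe 0 1) i k e m n

  sat-entry : ∀ y i w e → sat (entryF y i w) e ⟺ B (e y) (e i) (e w)
  sat-entry y i w e = ⟺-trans (sat-subst β e _)
    (sat-cong β λ { zero → refl ; (suc zero) → refl ; (suc (suc _)) → refl })

  record At (k : ℕ) (x u : D) : Set where
    constructor mkAt
    field entry : ∀ i → IsNum k i → ∀ v → B v i x ⟺ (v ≈ u)
  open At

  sat-at : ∀ k x u e → sat (atF k x u) e ⟺ At k (e x) (e u)
  sat-at k x u e = ⟺-trans (⟺-∀ λ i → ⟺-→ (sat-isNum k 0 _) (⟺-∀ λ v → ⟺-× (⟺-→ en ⟺-refl) (⟺-→ ⟺-refl en)))
    (mkAt , entry)
    where
    en : ∀ {i v} → sat (entryF 0 1 (2 + x)) (v ∷ᵉ i ∷ᵉ e) ⟺ B v i (e x)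
    en {i} {v} = sat-entry 0 1 (2 + x) (v ∷ᵉ i ∷ᵉ e)

  At-unique : ∀ {k x u v} → At k x u → At k x v → u ≈ v
  At-unique {k} p q = proj₁ (entry q _ (IsNum-num k) _) (proj₂ (entry p _ (IsNum-num k) _) ≈-refl)

  At-≈ : ∀ {k x x′ u u′} → x ≈ x′ → u ≈ u′ → At k x u → At k x′ u′
  At-≈ p q a = mkAt λ i n v →
    (λ b → ≈-trans (proj₁ (entry a i n v) (B-resp ≈-refl ≈-refl (≈-sym p) b)) q)
    , λ r → B-resp ≈-refl ≈-refl p (proj₂ (entry a i n v) (≈-trans r (≈-sym q)))

  Leaf : ℕ → D → Set
  Leaf k x = Σ[ u ∈ D ] (At 0 x u × IsNum (suc k) u)

  Pair : D → D → D → Set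
  Pair y z x = (Σ[ u ∈ D ] (At 0 x u × IsNum 0 u)) × At 1 x y × At 2 x z

  sat-leaf : ∀ k x e → sat (leafF k x) e ⟺ Leaf k (e x)
  sat-leaf k x e = ⟺-Σ λ u → ⟺-× (sat-at 0 (1 + x) 0 _) (sat-isNum (suc k) 0 _)

  sat-pair : ∀ y z x e → sat (pairF y z x) e ⟺ Pair (e y) (e z) (e x)
  sat-pair y z x e = ⟺-× (⟺-Σ λ u → ⟺-× (sat-at 0 (1 + x) 0 _) (sat-isNum 0 0 _))
    (⟺-× (sat-at 1 x y e) (sat-at 2 x z e))

  Leaf-≈ : ∀ {k x x′} → x ≈ x′ → Leaf k x → Leaf k x′
  Leaf-≈ p (u , a , n) = u , At-≈ p ≈-refl a , n

  Leaf-unique : ∀ {j k x} → Leaf j x → Leaf k x → j ≡ k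
  Leaf-unique {j} {k} (u , a , n) (v , b , m) =
    cong pred (IsNum-unique {suc j} {suc k} (IsNum-≈ {suc j} (At-unique {0} a b) n) m)

  Leaf-Pair : ∀ {k y z x} → Leaf k x → ¬ Pair y z x
  Leaf-Pair {k} (u , a , n) ((v , b , m) , _)
    with () ← IsNum-unique {suc k} {0} (IsNum-≈ {suc k} (At-unique {0} a b) n) m

  Pair-≈ : ∀ {y z x x′} → x ≈ x′ → Pair y z x → Pair y z x′
  Pair-≈ p ((u , a , n) , b , c) = (u , At-≈ p ≈-refl a , n) , At-≈ p ≈-refl b , At-≈ p ≈-refl c

  Pair-unique : ∀ {y z y′ z′ x} → Pair y z x → Pair y′ z′ x → y ≈ y′ × z ≈ z′
  Pair-unique (_ , a , b) (_ , c , d) = At-unique {1} a c , At-unique {2} b d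

  abstract
    sequence-of : ∀ (xs : ℕ → D) k → Σ[ w ∈ D ]
      (∀ j → j ≤ k → ∀ i → i ~ num j → ∀ y → B y (el i) w ⟺ (y ≈ xs j))
    -- Any element can be the initial sequence, as nothing is copied from it to position 0.
    sequence-of xs zero with w , h ← append pt (xs 0) (num 0) = w , λ
      { zero _ i p y → let f , g = h i y (≤°-resp (~-sym p) ~-refl (num-≤ {0} {0} z≤n)) in
        (λ b → ≈-stable λ n → f b λ { (inj₁ (q , _)) → q p ; (inj₂ (_ , q)) → n q })
        , λ q → g (return (inj₂ (p , q))) }
    sequence-of xs (suc k) with w , h ← sequence-of xs k
      with w′ , h′ ← append w (xs (suc k)) (num (suc k)) = w′ , entry′
      where
      entry′ : ∀ j → j ≤ suc k → ∀ i → i ~ num j → ∀ y → B y (el i) w′ ⟺ (y ≈ xs j)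
      entry′ j r i p y with h′ i y (≤°-resp (~-sym p) ~-refl (num-≤ r)) | m≤n⇒m<n∨m≡n r
      ... | f , g | inj₁ (s≤s s) =
        (λ b → ≈-stable λ n → f b λ
          { (inj₁ (_ , c)) → n (proj₁ (h j s i p y) c)
          ; (inj₂ (q , _)) → <-irrefl (num-inj (~-trans (~-sym p) q)) (s≤s s) })
        , λ q → g (return (inj₁ ((λ q′ → <-irrefl (num-inj (~-trans (~-sym p) q′)) (s≤s s)) , proj₂ (h j s i p y) q)))
      ... | f , g | inj₂ refl =
        (λ b → ≈-stable λ n → f b λ { (inj₁ (q , _)) → q p ; (inj₂ (_ , q)) → n q })
        , λ q → g (return (inj₂ (p , q)))

  At-sequence : ∀ xs k {j} → j ≤ k → At j (proj₁ (sequence-of xs k)) (xs j)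
  At-sequence xs k {j} r = mkAt λ { i (n ,ⁿ p) v → proj₂ (sequence-of xs k) j r (i ,° n) p v }

  leaf-exists : ∀ k → Σ[ x ∈ D ] Leaf k x
  leaf-exists k = _ , _ , At-sequence (λ _ → el (num (suc k))) 0 z≤n , IsNum-num (suc k)

  pair-exists : ∀ y z → Σ[ x ∈ D ] Pair y z x
  pair-exists y z = _ , (_ , At-sequence xs 2 z≤n , IsNum-num 0)
    , At-sequence xs 2 (s≤s z≤n) , At-sequence xs 2 (s≤s (s≤s z≤n))
    where xs = el (num 0) ∷ᵉ y ∷ᵉ λ _ → z

  Rep : Shape D → D → Set
  Rep (at a) x = x ≈ a
  Rep (lf k) x = Leaf k x
  Rep (s · t) x = Σ[ y ∈ D ] Σ[ z ∈ D ] (Pair y z x × Rep s y × Rep t z)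

  Rep-≈ : ∀ s {x x′} → x ≈ x′ → Rep s x → Rep s x′
  Rep-≈ (at a) p r = ≈-trans (≈-sym p) r
  Rep-≈ (lf k) p r = Leaf-≈ p r
  Rep-≈ (s · t) p (y , z , q , r) = y , z , Pair-≈ p q , r

  Rep-exists : ∀ s → Σ[ x ∈ D ] Rep s x
  Rep-exists (at a) = a , ≈-refl
  Rep-exists (lf k) = leaf-exists k
  Rep-exists (s · t) with y , p ← Rep-exists s | z , q ← Rep-exists t | x , r ← pair-exists (proj₁ (Rep-exists s)) (proj₁ (Rep-exists t)) =
    x , y , z , r , p , q

  IsTree : Tree → D → Set
  IsTree t = Rep (embed t)

  -- A tree has many representatives, yet an element represents at most one tree: entry 0 separates
  -- leaves from pairs and distinct labels from each other, since distinct numerals differ by Q1 and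
  -- Q2.
  IsTree-unique : ∀ s t {x} → IsTree s x → IsTree t x → s ≡ t
  IsTree-unique (leaf j) (leaf k) p q = cong leaf (Leaf-unique p q)
  IsTree-unique (leaf j) (nd _ _) p (_ , _ , q , _) = ⊥-elim (Leaf-Pair p q)
  IsTree-unique (nd _ _) (leaf k) (_ , _ , p , _) q = ⊥-elim (Leaf-Pair q p)
  IsTree-unique (nd s t) (nd s′ t′) (y , z , p , r , r₁) (y′ , z′ , q , r′ , r₁′)
    with a , b ← Pair-unique q p =
    cong₂ nd (IsTree-unique s s′ r (Rep-≈ (embed s′) a r′)) (IsTree-unique t t′ r₁ (Rep-≈ (embed t′) b r₁′))

  Mem : D → D → Nat° → Set
  Mem e w l = Σ[ i ∈ Nat° ] (i ≤° l × B e (el i) w)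

  sat-mem : ∀ x w l e (n : N (e l)) → sat (memF x w l) e ⟺ Mem (e x) (e w) (e l ,° n)
  sat-mem x w l e n =
    (λ (i , m , p , b) → let m′ = proj₁ (sat-nat 0 (i ∷ᵉ e)) m in
      (i ,° m′) , proj₁ (sat-le 0 (1 + l) (i ∷ᵉ e) m′ n) p , proj₁ (sat-entry (1 + x) 0 (1 + w) (i ∷ᵉ e)) b)
    , λ ((i ,° m) , p , b) → i , proj₂ (sat-nat 0 (i ∷ᵉ e)) m
      , proj₂ (sat-le 0 (1 + l) (i ∷ᵉ e) m n) p , proj₂ (sat-entry (1 + x) 0 (1 + w) (i ∷ᵉ e)) b

  nth : D → List D → ℕ → D
  nth x xs zero = x
  nth x [] (suc j) = x
  nth x (y ∷ xs) (suc j) = nth y xs j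

  nth⇒Any : ∀ {P : D → Set} x xs j → j ≤ length xs → P (nth x xs j) → Any P (x ∷ xs)
  nth⇒Any x xs zero _ p = here p
  nth⇒Any x (y ∷ xs) (suc j) (s≤s r) p = there (nth⇒Any y xs j r p)

  Any⇒nth : ∀ {P : D → Set} x xs → Any P (x ∷ xs) → Σ[ j ∈ ℕ ] (j ≤ length xs × P (nth x xs j))
  Any⇒nth x xs (here p) = 0 , z≤n , p
  Any⇒nth x (y ∷ xs) (there a) with j , r , p ← Any⇒nth y xs a = suc j , s≤s r , p

  -- The list is nonempty because positions run from 0 to l inclusive. Here l is standard, so by
  -- `≤°-num` a member sits at a standard position, up to double negation.
  finite-set : ∀ x xs → Σ[ w ∈ D ] Σ[ l ∈ Nat° ]
    (∀ e → (Mem e w l → ¬ ¬ Any (e ≈_) (x ∷ xs)) × (Any (e ≈_) (x ∷ xs) → Mem e w l))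
  finite-set x xs with w , h ← sequence-of (nth x xs) (length xs) = w , num (length xs) , λ e →
    (λ (i , p , b) → ≤°-num (length xs) i p >>= λ
      { (j , r , q) → return (nth⇒Any x xs j r (proj₁ (h j r i q e) b)) })
    , λ a → let j , r , p = Any⇒nth x xs a in
      num j , num-≤ r , proj₂ (h j r (num j) ~-refl e) p

-- Definable closures of clause systems

-- The number of variables of a clause.
K : ℕ
K = 8

Pat : Set
Pat = Shape (Fin K)

-- head ⇐ body, provided that side holds of the variables (as var 0, …, var 7)
record Clause (L : Lang) : Set where
  constructor _⇐_∣_
  field
    head : Pat
    body : List Pat
    side : Formula L

infix 2 _⇐_∣_

infixr 5 _++ᵉ_
_++ᵉ_ : ∀ {k} {D : Set} → Vec D k → (ℕ → D) → ℕ → D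
[] ++ᵉ e = e
(x ∷ xs) ++ᵉ e = x ∷ᵉ (xs ++ᵉ e)

++ᵉ-< : ∀ {k} {D : Set} (xs : Vec D k) {e e′ : ℕ → D} i → i < k → (xs ++ᵉ e) i ≡ (xs ++ᵉ e′) i
++ᵉ-< (x ∷ xs) zero p = refl
++ᵉ-< (x ∷ xs) (suc i) (s≤s p) = ++ᵉ-< xs i p

++ᵉ-+ : ∀ {k} {D : Set} (xs : Vec D k) {e : ℕ → D} j → (xs ++ᵉ e) (k + j) ≡ e j
++ᵉ-+ [] j = refl
++ᵉ-+ (x ∷ xs) j = ++ᵉ-+ xs j

++ᵉ-≥ : ∀ {k} {D : Set} (xs : Vec D k) {d : D} i → k ≤ i → (xs ++ᵉ λ _ → d) i ≡ d
++ᵉ-≥ [] i p = refl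
++ᵉ-≥ (x ∷ xs) (suc i) (s≤s p) = ++ᵉ-≥ xs i p

++ᵉ-toℕ : ∀ {k} {D : Set} (xs : Vec D k) {e : ℕ → D} i → (xs ++ᵉ e) (toℕ i) ≡ lookup xs i
++ᵉ-toℕ (x ∷ xs) fzero = refl
++ᵉ-toℕ (x ∷ xs) (fsuc i) = ++ᵉ-toℕ xs i

module _ {L : Lang} where
  -- Sends all variables from k on to variable 0. This caps the free variables of a formula by
  -- construction, so that side formulas cannot refer beyond the clause and the Rosser sentence is
  -- visibly closed.
  clip : ℕ → ℕ → Term L
  clip k i with i <? k
  ... | yes _ = var i
  ... | no _ = var 0

  ⊤' : Formula L
  ⊤' = ⊥' ⇒' ⊥'

  orF andF : List (Formula L) → Formula L
  orF [] = ⊥'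
  orF (φ ∷ φs) = φ ∨' orF φs
  andF [] = ⊤'
  andF (φ ∷ φs) = φ ∧' andF φs

  ∃^ : ℕ → Formula L → Formula L
  ∃^ zero φ = φ
  ∃^ (suc k) φ = ∃^ k (∃' φ)

module SystemFormulas {L : Lang} (I : QInterp L) (β : Formula L) where
  open Formulas I β

  shapeF : ∀ {A} → Shape A → (A → ℕ) → ℕ → Formula L
  shapeF (at a) ρ x = var x ≐ var (ρ a)
  shapeF (lf k) ρ x = leafF k x
  shapeF (s · t) ρ x = ∃' (∃' (pairF 1 0 (2 + x) ∧' shapeF s (λ a → 2 + ρ a) 1 ∧' shapeF t (λ a → 2 + ρ a) 0))

  memberF : (w l : ℕ) → Pat → Formula L
  memberF w l p = ∃' (shapeF p (suc ∘ toℕ) 0 ∧' memF 0 (1 + w) (1 + l))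

  clauseF : (x w l : ℕ) → Clause L → Formula L
  clauseF x w l (h ⇐ bs ∣ φ) =
    ∃^ K (shapeF h toℕ (K + x) ∧' subst (clip K) φ ∧' andF (map (memberF (K + w) (K + l)) bs))

  closedF : List (Clause L) → (w l : ℕ) → Formula L
  closedF P w l = ∀' (memF 0 (1 + w) (1 + l) ⇒' orF (map (clauseF 0 (1 + w) (1 + l)) P))

  -- Derivability of (the element denoted by) x from the clauses P: x belongs to a coded finite set
  -- each member of which is the head of a clause whose body lies in the set. No well-foundedness is
  -- demanded; the systems below bring their own decreasing measures.
  derF : List (Clause L) → ℕ → Formula L
  derF P x = ∃' (∃' (natF 0 ∧' memF (2 + x) 1 0 ∧' closedF P 1 0))

module Systems {L : Lang} {T : Formula L → Set} (S : Sequential T)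
  (M : Model L) (M⊨T : ∀ φ → T φ → ∀ e → Model.sat M φ e) where

  open Coding S M M⊨T public
  open Sequential S using (interp; β)
  open SystemFormulas interp β public
  open Model M

  sat-∃^ : ∀ k φ e → sat (∃^ k φ) e ⟺ (Σ[ xs ∈ Vec D k ] sat φ (xs ++ᵉ e))
  sat-∃^ zero φ e = ([] ,_) , λ { ([] , p) → p }
  sat-∃^ (suc k) φ e = ⟺-trans (sat-∃^ k (∃' φ) e)
    ((λ (xs , x , p) → x ∷ xs , p) , λ { (x ∷ xs , p) → xs , x , p })

  sat-or : ∀ φs e → sat (orF φs) e ⟺ (¬ ¬ Any (λ φ → sat φ e) φs)
  sat-or [] e = (λ ()) , λ n → n λ ()
  sat-or (φ ∷ φs) e =
    (λ h n → h ((λ p → n (here p)) , λ q → proj₁ (sat-or φs e) q λ a → n (there a)))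
    , λ h (m , n) → h λ { (here p) → m p ; (there a) → n (proj₂ (sat-or φs e) (return a)) }

  sat-and : ∀ φs e → sat (andF φs) e ⟺ All (λ φ → sat φ e) φs
  sat-and [] e = (λ _ → []) , λ _ ()
  sat-and (φ ∷ φs) e = (λ (p , q) → p ∷ proj₁ (sat-and φs e) q) , λ { (p ∷ q) → p , proj₂ (sat-and φs e) q }

  sat-shape : ∀ {A} s (ρ : A → ℕ) x e → sat (shapeF s ρ x) e ⟺ Rep (bind (λ a → at (e (ρ a))) s) (e x)
  sat-shape (at a) ρ x e = ⟺-refl
  sat-shape (lf k) ρ x e = sat-leaf k x e
  sat-shape (s · t) ρ x e = ⟺-Σ λ y → ⟺-Σ λ z → ⟺-× (sat-pair 1 0 (2 + x) _)
    (⟺-× (sat-shape s _ 1 (z ∷ᵉ y ∷ᵉ e)) (sat-shape t _ 0 (z ∷ᵉ y ∷ᵉ e)))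

  bind-≡ : ∀ {A B : Set} {f g : A → Shape B} s → (∀ a → f a ≡ g a) → bind f s ≡ bind g s
  bind-≡ (at a) h = h a
  bind-≡ (lf k) h = refl
  bind-≡ (s · t) h = cong₂ _·_ (bind-≡ s h) (bind-≡ t h)

  inst : Pat → Vec D K → Shape D
  inst p xs = bind (at ∘ lookup xs) p

  sideEnv : Vec D K → ℕ → D
  sideEnv xs = xs ++ᵉ λ _ → lookup xs fzero

  StepAt : (D → Set) → D → Clause L → Set
  StepAt R e (h ⇐ bs ∣ φ) = Σ[ xs ∈ Vec D K ]
    (Rep (inst h xs) e × sat φ (sideEnv xs) × All (λ b → Σ[ d ∈ D ] (Rep (inst b xs) d × R d)) bs)

  Step : List (Clause L) → (D → Set) → D → Set
  Step P R e = Any (StepAt R e) P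

  StepAt-map : ∀ {R R′ : D → Set} e c → (∀ {d} → R d → R′ d) → StepAt R e c → StepAt R′ e c
  StepAt-map e c f (xs , h , s , b) = xs , h , s , All.map (λ (d , r , p) → d , r , f p) b

  Step-map : ∀ {R R′ : D → Set} P {e} → (∀ {d} → R d → R′ d) → Step P R e → Step P R′ e
  Step-map P {e} f = Any.map λ {c} → StepAt-map e c f

  Step-≈ : ∀ {R : D → Set} P {e e′} → e ≈ e′ → Step P R e → Step P R e′
  Step-≈ P p = Any.map λ {c} (xs , h , r) → xs , Rep-≈ (inst (Clause.head c) xs) p h , r

  sat-clip : ∀ φ xs e → sat (subst (clip K) φ) (xs ++ᵉ e) ⟺ sat φ (sideEnv xs)
  sat-clip φ xs@(_ ∷ _) e = ⟺-trans (sat-subst φ _ (clip K)) (sat-cong φ clipped)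
    where
    clipped : ∀ i → eval (xs ++ᵉ e) (clip K i) ≡ sideEnv xs i
    clipped i with i <? K
    ... | yes p = ++ᵉ-< xs i p
    ... | no n = sym (++ᵉ-≥ xs i (≮⇒≥ n))

  sat-member : ∀ w l p xs e (n : N (e l)) → sat (memberF (K + w) (K + l) p) (xs ++ᵉ e)
    ⟺ (Σ[ d ∈ D ] (Rep (inst p xs) d × Mem d (e w) (e l ,° n)))
  sat-member w l p xs e n = ⟺-Σ λ d → ⟺-×
    (⟺-trans (sat-shape p (suc ∘ toℕ) 0 (d ∷ᵉ xs ++ᵉ e))
      (⟺-≡ (cong (λ s → Rep s d) (bind-≡ p λ i → cong at (++ᵉ-toℕ xs i)))))
    (mem d (++ᵉ-+ xs {e} w) (++ᵉ-+ xs {e} l))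
    where
    mem : ∀ d → (xs ++ᵉ e) (K + w) ≡ e w → (xs ++ᵉ e) (K + l) ≡ e l
      → sat (memF 0 (1 + (K + w)) (1 + (K + l))) (d ∷ᵉ xs ++ᵉ e) ⟺ Mem d (e w) (e l ,° n)
    mem d p q = ⟺-trans (sat-mem 0 _ _ (d ∷ᵉ xs ++ᵉ e) (≡-subst N (sym q) n)) (move p q)
      where
      move : ∀ {a b c d z} {m : N d} → a ≡ c → (q : b ≡ d) → Mem z a (b ,° ≡-subst N (sym q) m) ⟺ Mem z c (d ,° m)
      move refl refl = ⟺-refl

  abstract
    sat-clause : ∀ x w l c e (n : N (e l)) → sat (clauseF x w l c) e ⟺ StepAt (λ d → Mem d (e w) (e l ,° n)) (e x) c
    sat-clause x w l (h ⇐ bs ∣ φ) e n = ⟺-trans (sat-∃^ K (shapeF h toℕ (K + x) ∧' subst (clip K) φ ∧' andF (map (memberF (K + w) (K + l)) bs)) e) (⟺-Σ λ xs → ⟺-×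
      (⟺-trans (sat-shape h toℕ (K + x) (xs ++ᵉ e))
        (⟺-≡ (cong₂ Rep (bind-≡ h λ i → cong at (++ᵉ-toℕ xs i)) (++ᵉ-+ xs x))))
      (⟺-× (sat-clip φ xs e) (⟺-trans (sat-and (map (memberF (K + w) (K + l)) bs) (xs ++ᵉ e)) (members xs bs))))
      where
      members : ∀ xs bs → All (λ ψ → sat ψ (xs ++ᵉ e)) (map (memberF (K + w) (K + l)) bs)
        ⟺ All (λ b → Σ[ d ∈ D ] (Rep (inst b xs) d × Mem d (e w) (e l ,° n))) bs
      members xs bs = (λ a → All.map (λ {b} → proj₁ (sat-member w l b xs e n)) (All.map⁻ a))
        , λ a → All.map⁺ (All.map (λ {b} → proj₂ (sat-member w l b xs e n)) a)

  Closed : List (Clause L) → D → Nat° → Set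
  Closed P w l = ∀ e → Mem e w l → ¬ ¬ Step P (λ d → Mem d w l) e

  sat-closed : ∀ P w l e (n : N (e l)) → sat (closedF P w l) e ⟺ Closed P (e w) (e l ,° n)
  sat-closed P w l e n = ⟺-∀ λ d → ⟺-→ (sat-mem 0 (1 + w) (1 + l) (d ∷ᵉ e) n)
    (⟺-trans (sat-or (map (clauseF 0 (1 + w) (1 + l)) P) (d ∷ᵉ e)) (⟺-¬ (⟺-¬ (steps d))))
    where
    steps : ∀ d → Any (λ φ → sat φ (d ∷ᵉ e)) (map (clauseF 0 (1 + w) (1 + l)) P)
      ⟺ Step P (λ d → Mem d (e w) (e l ,° n)) d
    steps d = (λ a → Any.map (λ {c} → proj₁ (sat-clause 0 (1 + w) (1 + l) c (d ∷ᵉ e) n)) (Any.map⁻ a))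
      , λ a → Any.map⁺ (Any.map (λ {c} → proj₂ (sat-clause 0 (1 + w) (1 + l) c (d ∷ᵉ e) n)) a)

  record Der (P : List (Clause L)) (x : D) : Set where
    constructor der
    field
      set    : D
      size   : Nat°
      member : Mem x set size
      closed : Closed P set size

  abstract
    sat-der : ∀ P x e → sat (derF P x) e ⟺ Der P (e x)
    sat-der P x e =
      (λ (w , l , n , m , c) → let n′ = proj₁ (sat-nat 0 (l ∷ᵉ w ∷ᵉ e)) n in
        der w (l ,° n′) (proj₁ (sat-mem (2 + x) 1 0 (l ∷ᵉ w ∷ᵉ e) n′) m)
          (proj₁ (sat-closed P 1 0 (l ∷ᵉ w ∷ᵉ e) n′) c))
      , λ { (der w (l ,° n′) m c) → w , l , proj₂ (sat-nat 0 (l ∷ᵉ w ∷ᵉ e)) n′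
        , proj₂ (sat-mem (2 + x) 1 0 (l ∷ᵉ w ∷ᵉ e) n′) m , proj₂ (sat-closed P 1 0 (l ∷ᵉ w ∷ᵉ e) n′) c }

  Der-stable : ∀ P {x} → ¬ ¬ Der P x → Der P x
  Der-stable P {x} nn = proj₁ (sat-der P 0 (λ _ → x))
    (stable (derF P 0) λ n → nn λ d → n (proj₂ (sat-der P 0 _) d))

  -- The set that derives x derives the premises too. This inversion stands in for induction on
  -- derivations; its repetition ends because the user recurses on a standard term, formula or rank.
  Der-step : ∀ P {x} → Der P x → ¬ ¬ Step P (Der P) x
  Der-step P (der w l m c) = c _ m >>= λ s → return (Step-map P (λ m′ → der w l m′ c) s)

  -- Well-founded derivations, built outside the model. Their finitely many nodes form a coded
  -- closed set, so completeness proofs build towers whereas soundness proofs invert `Der`.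
  data Tower (P : List (Clause L)) (e : D) : Set where
    tower : ∀ {c} → c ∈ P → ∀ xs → Rep (inst (Clause.head c) xs) e → sat (Clause.side c) (sideEnv xs)
      → All (λ b → Σ[ d ∈ D ] (Rep (inst b xs) d × Tower P d)) (Clause.body c) → Tower P e

  private
    Supported : List (Clause L) → List D → Set
    Supported P ds = All (Step P (_∈ ds)) ds

    Supported-++ : ∀ P {ds ds′} → Supported P ds → Supported P ds′ → Supported P (ds ++ ds′)
    Supported-++ P {ds} a b = All.++⁺ (All.map (Step-map P ∈-++⁺ˡ) a) (All.map (Step-map P (∈-++⁺ʳ ds)) b)

    flatten : ∀ {P e} → Tower P e → Σ[ ds ∈ List D ] (e ∈ ds × Supported P ds)
    flattens : ∀ {P xs bs} → All (λ b → Σ[ d ∈ D ] (Rep (inst b xs) d × Tower P d)) bs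
      → Σ[ ds ∈ List D ] (All (λ b → Σ[ d ∈ D ] (Rep (inst b xs) d × d ∈ ds)) bs × Supported P ds)
    flatten {P} {e} (tower {c} c∈P xs h s bs) with ds , a , q ← flattens {xs = xs} bs =
      e ∷ ds , here refl ,
      Any.map (λ { refl → StepAt-map e c there (xs , h , s , a) }) c∈P ∷ All.map (Step-map P there) q
    flattens [] = [] , [] , []
    flattens {P} {xs} ((d , r , t) ∷ ts) with ds , a , q ← flattens {xs = xs} ts | ds′ , m , q′ ← flatten t =
      ds′ ++ ds , (d , r , ∈-++⁺ˡ m) ∷ All.map (λ (d , r , m) → d , r , ∈-++⁺ʳ ds′ m) a , Supported-++ P q′ q

  Tower⇒Der : ∀ {P e} → Tower P e → Der P e
  Tower⇒Der {P} {e} t with flatten t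
  ... | d ∷ ds , m , a with w , l , h ← finite-set d ds =
    der w l (proj₂ (h e) (Any.map (λ { refl → ≈-refl }) m)) λ e′ m′ → proj₁ (h e′) m′ >>= λ b →
      return (elim b a)
    where
    elim : ∀ {e′ ds′} → Any (e′ ≈_) ds′ → All (Step P (_∈ d ∷ ds)) ds′ → Step P (λ d′ → Mem d′ w l) e′
    elim (here p) (s ∷ _) = Step-≈ P (≈-sym p) (Step-map P (λ i → proj₂ (h _) (Any.map (λ { refl → ≈-refl }) i)) s)
    elim (there b) (_ ∷ a) = elim b a

  -- What a clause with head p can contribute to an element of known shape.
  Match : Pat → Shape D → Vec D K → Set
  Match (at i) s xs = Rep s (lookup xs i)
  Match (lf j) (lf k) xs = ⊤
  Match (p · q) (s · t) xs = Match p s xs × Match q t xs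
  Match p (at d) xs = Rep (inst p xs) d
  Match _ _ xs = ⊥

  clash : Pat → Shape D → Bool
  clash (lf j) (lf k) = not (j ≡ᵇ k)
  clash (lf j) (_ · _) = true
  clash (_ · _) (lf k) = true
  clash (p · q) (s · t) = clash p s ∨ clash q t
  clash _ _ = false

  Leaf-≡ᵇ : ∀ {j k x} → Leaf j x → Leaf k x → True (j ≡ᵇ k)
  Leaf-≡ᵇ {j} {k} p q = ≡⇒≡ᵇ j k (Leaf-unique p q)

  match : ∀ p s xs {e} → Rep (inst p xs) e → Rep s e → Match p s xs × clash p s ≡ false
  match (at i) s xs r q = Rep-≈ s r q , refl
  match (lf j) (lf k) xs r q with j ≡ᵇ k | Leaf-≡ᵇ r q
  ... | true | _ = tt , refl
  match (lf j) (at d) xs r q = Leaf-≈ q r , refl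
  match (lf j) (s · t) xs r (_ , _ , q , _) = ⊥-elim (Leaf-Pair r q)
  match (p · p′) (lf k) xs (_ , _ , r , _) q = ⊥-elim (Leaf-Pair q r)
  match (p · p′) (at d) xs r q = Rep-≈ (inst (p · p′) xs) q r , refl
  match (p · p′) (s · t) xs (y , z , r , r₁ , r₂) (y′ , z′ , q , q₁ , q₂)
    with a , b ← Pair-unique q r
    with m₁ , c₁ ← match p s xs r₁ (Rep-≈ s a q₁) | m₂ , c₂ ← match p′ t xs r₂ (Rep-≈ t b q₂) =
    (m₁ , m₂) , cong₂ _∨_ c₁ c₂

  Case : (D → Set) → Shape D → Clause L → Set
  Case R s (h ⇐ bs ∣ φ) = Σ[ xs ∈ Vec D K ]
    (Match h s xs × sat φ (sideEnv xs) × All (λ b → Σ[ d ∈ D ] (Rep (inst b xs) d × R d)) bs)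

  -- Clauses whose head clashes with the shape disappear by computation. For a fact about a formula
  -- with a known outermost symbol only the few relevant clauses are left to be matched.
  Cases : List (Clause L) → (D → Set) → Shape D → Set
  Cases [] R s = ⊥
  Cases (c ∷ P) R s = if clash (Clause.head c) s then Cases P R s else (Case R s c ⊎ Cases P R s)

  cases : ∀ P {R s e} → Rep s e → Step P R e → Cases P R s
  cases (c ∷ P) {R} {s} r (here (xs , h , q , b))
    with m , e ← match (Clause.head c) s xs h r rewrite e = inj₁ (xs , m , q , b)
  cases (c ∷ P) {R} {s} r (there a) with clash (Clause.head c) s
  ... | true = cases P r a
  ... | false = inj₂ (cases P r a)

-- Partial truth predicates

data Sign : Set where
  pos neg⁻ : Sign

opp : Sign → Sign
opp pos = neg⁻
opp neg⁻ = pos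

module _ {L : Lang} where
  -- Class pos n and Class neg⁻ n are syntax-directed versions of Σ*ₙ and Π*ₙ.
  Class : Sign → ℕ → Formula L → Set
  Class sg n ⊥' = ⊤
  Class sg n (rel r ts) = ⊤
  Class sg n (s ≐ t) = ⊤
  Class sg n (¬' φ) = Class (opp sg) n φ
  Class sg n (φ ∧' ψ) = Class sg n φ × Class sg n ψ
  Class sg n (φ ∨' ψ) = Class sg n φ × Class sg n ψ
  Class sg n (φ ⇒' ψ) = Class (opp sg) n φ × Class sg n ψ
  Class sg zero (∀' φ) = ⊥
  Class pos (suc n) (∀' φ) = Class neg⁻ n (∀' φ)
  Class neg⁻ (suc n) (∀' φ) = Class neg⁻ (suc n) φ
  Class sg zero (∃' φ) = ⊥
  Class pos (suc n) (∃' φ) = Class pos (suc n) φ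
  Class neg⁻ (suc n) (∃' φ) = Class pos n (∃' φ)

  -- The inclusions `π` and `σ` leave no trace in the formula. A syntax-directed class has to absorb
  -- them, for both signs and at every subformula.
  Class-up : ∀ sg sg′ n φ → Class sg n φ → Class sg′ (suc n) φ
  Class-up sg sg′ n ⊥' c = tt
  Class-up sg sg′ n (rel r ts) c = tt
  Class-up sg sg′ n (s ≐ t) c = tt
  Class-up sg sg′ n (¬' φ) c = Class-up (opp sg) (opp sg′) n φ c
  Class-up sg sg′ n (φ ∧' ψ) (c , d) = Class-up sg sg′ n φ c , Class-up sg sg′ n ψ d
  Class-up sg sg′ n (φ ∨' ψ) (c , d) = Class-up sg sg′ n φ c , Class-up sg sg′ n ψ d
  Class-up sg sg′ n (φ ⇒' ψ) (c , d) = Class-up (opp sg) (opp sg′) n φ c , Class-up sg sg′ n ψ d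
  Class-up neg⁻ pos (suc n) (∀' φ) c = c
  Class-up neg⁻ neg⁻ (suc n) (∀' φ) c = Class-up neg⁻ neg⁻ (suc n) φ c
  Class-up pos pos (suc n) (∀' φ) c = Class-up neg⁻ neg⁻ n (∀' φ) c
  Class-up pos neg⁻ (suc n) (∀' φ) c = Class-up neg⁻ neg⁻ (suc n) φ (Class-up neg⁻ neg⁻ n (∀' φ) c)
  Class-up pos neg⁻ (suc n) (∃' φ) c = c
  Class-up pos pos (suc n) (∃' φ) c = Class-up pos pos (suc n) φ c
  Class-up neg⁻ neg⁻ (suc n) (∃' φ) c = Class-up pos pos n (∃' φ) c
  Class-up neg⁻ pos (suc n) (∃' φ) c = Class-up pos pos (suc n) φ (Class-up pos pos n (∃' φ) c)

  QFree⇒Class : ∀ {φ} sg n → QFree φ → Class sg n φ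
  QFree⇒Class sg n qf⊥ = tt
  QFree⇒Class sg n (qfrel r ts) = tt
  QFree⇒Class sg n (qf≐ s t) = tt
  QFree⇒Class sg n (qf¬ q) = QFree⇒Class (opp sg) n q
  QFree⇒Class sg n (qf∧ q r) = QFree⇒Class sg n q , QFree⇒Class sg n r
  QFree⇒Class sg n (qf∨ q r) = QFree⇒Class sg n q , QFree⇒Class sg n r
  QFree⇒Class sg n (qf⇒ q r) = QFree⇒Class (opp sg) n q , QFree⇒Class sg n r

  Σ*⇒Class : ∀ {n φ} → Σ* n φ → Class pos n φ
  Π*⇒Class : ∀ {n φ} → Π* n φ → Class neg⁻ n φ
  Σ*⇒Class (qf q) = QFree⇒Class pos 0 q
  Σ*⇒Class {suc n} {φ} (π p) = Class-up neg⁻ pos n φ (Π*⇒Class p)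
  Σ*⇒Class (and s t) = Σ*⇒Class s , Σ*⇒Class t
  Σ*⇒Class (or s t) = Σ*⇒Class s , Σ*⇒Class t
  Σ*⇒Class (ex s) = Σ*⇒Class s
  Σ*⇒Class (neg p) = Π*⇒Class p
  Σ*⇒Class (imp p s) = Π*⇒Class p , Σ*⇒Class s
  Π*⇒Class (qf q) = QFree⇒Class neg⁻ 0 q
  Π*⇒Class {suc n} {φ} (σ s) = Class-up pos neg⁻ n φ (Σ*⇒Class s)
  Π*⇒Class (and s t) = Π*⇒Class s , Π*⇒Class t
  Π*⇒Class (or s t) = Π*⇒Class s , Π*⇒Class t
  Π*⇒Class (all s) = Π*⇒Class s
  Π*⇒Class (neg s) = Σ*⇒Class s
  Π*⇒Class (imp s p) = Σ*⇒Class s , Π*⇒Class p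

pattern v0 = fzero
pattern v1 = fsuc v0
pattern v2 = fsuc v1
pattern v3 = fsuc v2
pattern v4 = fsuc v3
pattern v5 = fsuc v4
pattern v6 = fsuc v5
pattern v7 = fsuc v6

listS : ∀ {A k} → Vec (Shape A) k → Shape A
listS [] = lf 0
listS (s ∷ ss) = s · listS ss

valP valsP : ∀ {A} → Shape A → Shape A → Shape A → Shape A
valP c s x = lf 0 · c · s · x
valsP cs s xs = lf 1 · cs · s · xs

-- Falsity is a fact of its own and not the absence of truth. Negation and implication therefore
-- stay on one level, and only quantifiers of the wrong kind appeal to underivability.
truthP : ∀ {A} → Sign → Shape A → Shape A → Shape A
truthP sg c s = lf (tag sg) · c · s
  where
  tag : Sign → ℕ
  tag pos = 2
  tag neg⁻ = 3

module TruthFormulas {L : Lang} (I : QInterp L) (β : Formula L) where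
  open Formulas I β
  open SystemFormulas I β

  vars : ∀ k → Vec (Term L) k
  vars k = Vec.map (var ∘ toℕ) (allFin k)

  -- φ speaks of the k entries of the list l as var 0, …, var (k - 1).
  onListF : (k l : ℕ) → Formula L → Formula L
  onListF k l φ = ∃^ k (shapeF (listS (Vec.map at (allFin k))) toℕ (k + l) ∧' φ)

  -- Here the finiteness of the language matters: a code of a symbol is compared with each symbol in
  -- turn, and each disjunct uses the symbol itself.
  symbolF : ∀ n (arity : Fin n → ℕ) → (f l : ℕ) → (Fin n → Formula L) → Formula L
  symbolF n arity f l φ = orF (map (λ g → leafF (toℕ g) f ∧' onListF (arity g) l (φ g)) (List.allFin n))

  applyF : (f l x : ℕ) → Formula L
  applyF f l x = symbolF (nFun L) (funArity L) f l λ g → var (funArity L g + x) ≐ fun g (vars _)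

  signedF : Sign → Formula L → Formula L
  signedF pos φ = φ
  signedF neg⁻ φ = ¬' φ

  relF : Sign → (r l : ℕ) → Formula L
  relF sg r l = symbolF (nRel L) (relArity L) r l λ g → signedF sg (rel g (vars _))

  underivableF : List (Clause L) → Pat → Formula L
  underivableF P p = ¬' (∃' (shapeF p (suc ∘ toℕ) 0 ∧' derF P 0))

  unary : Sign → Sign → Clause L
  unary sg s₁ = truthP sg (lf 3 · at v0) (at v1) ⇐ truthP s₁ (at v0) (at v1) ∷ [] ∣ ⊤'

  first second : ℕ → Sign → Sign → Clause L
  first k sg s₁ = truthP sg (lf k · at v0 · at v1) (at v2) ⇐ truthP s₁ (at v0) (at v2) ∷ [] ∣ ⊤'
  second k sg s₂ = truthP sg (lf k · at v0 · at v1) (at v2) ⇐ truthP s₂ (at v1) (at v2) ∷ [] ∣ ⊤'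

  both : ℕ → Sign → Sign → Sign → Clause L
  both k sg s₁ s₂ = truthP sg (lf k · at v0 · at v1) (at v2)
    ⇐ truthP s₁ (at v0) (at v2) ∷ truthP s₂ (at v1) (at v2) ∷ [] ∣ ⊤'

  -- The partial truth definitions. An assignment is a list of elements; once it
  -- is exhausted, its final leaf is the value of all remaining variables. Thus
  -- every assignment is total and sentences need no special treatment.
  -- Quantifiers of the wrong kind drop to the preceding level.
  truth : ℕ → List (Clause L)
  sameLevel : ℕ → Formula L
  dropLevel : ℕ → Pat → Formula L
  truth n =
      (valP (lf 0 · lf 0) (at v0 · at v1) (at v0) ⇐ [] ∣ ⊤')
    ∷ (valP (lf 0 · lf 0 · at v0) (at v1 · at v2) (at v3) ⇐ valP (lf 0 · at v0) (at v2) (at v3) ∷ [] ∣ ⊤')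
    ∷ (valP (lf 0 · at v0) (at v1) (at v1) ⇐ [] ∣ leafF 0 1)
    ∷ (valP (lf 1 · at v0 · at v1) (at v2) (at v3) ⇐ valsP (at v1) (at v2) (at v4) ∷ [] ∣ applyF 0 4 3)
    ∷ (valsP (lf 0) (at v0) (lf 0) ⇐ [] ∣ ⊤')
    ∷ (valsP (at v0 · at v1) (at v2) (at v3 · at v4)
        ⇐ valP (at v0) (at v2) (at v3) ∷ valsP (at v1) (at v2) (at v4) ∷ [] ∣ ⊤')
    ∷ (truthP neg⁻ (lf 0 · lf 0) (at v0) ⇐ [] ∣ ⊤')
    ∷ (truthP pos (lf 1 · at v0 · at v1) (at v2) ⇐ valsP (at v1) (at v2) (at v3) ∷ [] ∣ relF pos 0 3)
    ∷ (truthP neg⁻ (lf 1 · at v0 · at v1) (at v2) ⇐ valsP (at v1) (at v2) (at v3) ∷ [] ∣ relF neg⁻ 0 3)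
    ∷ (truthP pos (lf 2 · at v0 · at v1) (at v2)
        ⇐ valP (at v0) (at v2) (at v3) ∷ valP (at v1) (at v2) (at v4) ∷ [] ∣ (var 3 ≐ var 4))
    ∷ (truthP neg⁻ (lf 2 · at v0 · at v1) (at v2)
        ⇐ valP (at v0) (at v2) (at v3) ∷ valP (at v1) (at v2) (at v4) ∷ [] ∣ ¬' (var 3 ≐ var 4))
    ∷ unary pos neg⁻ ∷ unary neg⁻ pos
    ∷ both 4 pos pos pos ∷ first 4 neg⁻ neg⁻ ∷ second 4 neg⁻ neg⁻
    ∷ first 5 pos pos ∷ second 5 pos pos ∷ both 5 neg⁻ neg⁻ neg⁻
    ∷ first 6 pos neg⁻ ∷ second 6 pos pos ∷ both 6 neg⁻ pos neg⁻
    ∷ (truthP neg⁻ (lf 7 · at v0) (at v1) ⇐ truthP neg⁻ (at v0) (at v2 · at v1) ∷ [] ∣ sameLevel n)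
    ∷ (truthP pos (lf 7 · at v0) (at v1) ⇐ [] ∣ dropLevel n (truthP neg⁻ (lf 7 · at v0) (at v1)))
    ∷ (truthP pos (lf 8 · at v0) (at v1) ⇐ truthP pos (at v0) (at v2 · at v1) ∷ [] ∣ sameLevel n)
    ∷ (truthP neg⁻ (lf 8 · at v0) (at v1) ⇐ [] ∣ dropLevel n (truthP pos (lf 8 · at v0) (at v1)))
    ∷ []
  sameLevel zero = ⊥'
  sameLevel (suc n) = ⊤'
  dropLevel zero p = ⊥'
  dropLevel (suc n) p = underivableF (truth n) p

module Truth {L : Lang} {T : Formula L → Set} (S : Sequential T)
  (M : Model L) (M⊨T : ∀ φ → T φ → ∀ e → Model.sat M φ e) where

  open Systems S M M⊨T public
  open Sequential S using (interp; β)
  open TruthFormulas interp β public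
  open Model M

  data EnvRep : (ℕ → D) → D → Set where
    const : ∀ {e s} → Leaf 0 s → (∀ i → e i ≈ s) → EnvRep e s
    _∷_   : ∀ {e s s′ x} → Pair x s′ s × e 0 ≈ x → EnvRep (e ∘ suc) s′ → EnvRep e s

  EnvRep-≈ : ∀ {e s s′} → s ≈ s′ → EnvRep e s → EnvRep e s′
  EnvRep-≈ p (const l h) = const (Leaf-≈ p l) λ i → ≈-trans (h i) p
  EnvRep-≈ p ((q , r) ∷ es) = (Pair-≈ p q , r) ∷ es

  -- Inversion yields facts about an element c that represents a code. With the shape in place of c
  -- the induction hypothesis becomes applicable.
  into : ∀ s t {k c y} → Rep s c → Rep (lf k · at c · t) y → Rep (lf k · s · t) y
  into s t r (_ , _ , p , q , _ , _ , p′ , q′ , r′) = _ , _ , p , q , _ , _ , p′ , Rep-≈ s (≈-sym q′) r , r′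

  evals-vars : ∀ {k} (as : Vec D k) e → evals (as ++ᵉ e) (vars k) ≡ as
  evals-vars {k} as e = trans (evals-map (allFin k))
    (trans (Vec.map-cong (++ᵉ-toℕ as) (allFin k)) (Vec.map-lookup-allFin as))
    where
    evals-map : ∀ {m} (is : Vec (Fin k) m) → evals (as ++ᵉ e) (Vec.map (var ∘ toℕ) is) ≡ Vec.map (λ i → (as ++ᵉ e) (toℕ i)) is
    evals-map [] = refl
    evals-map (i ∷ is) = cong (_ ∷_) (evals-map is)

  bind-listS : ∀ {A B : Set} {k} (f : A → Shape B) (ss : Vec (Shape A) k) → bind f (listS ss) ≡ listS (Vec.map (bind f) ss)
  bind-listS f [] = refl
  bind-listS f (s ∷ ss) = cong (_ ·_) (bind-listS f ss)

  IsList : ∀ {k} → Vec D k → D → Set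
  IsList as = Rep (listS (Vec.map at as))

  sat-onList : ∀ k l φ e → sat (onListF k l φ) e ⟺ (Σ[ as ∈ Vec D k ] (IsList as (e l) × sat φ (as ++ᵉ e)))
  sat-onList k l φ e = ⟺-trans (sat-∃^ k (shapeF (listS (Vec.map at (allFin k))) toℕ (k + l) ∧' φ) e)
    (⟺-Σ λ as → ⟺-× (⟺-trans (sat-shape (listS (Vec.map at (allFin k))) toℕ (k + l) (as ++ᵉ e))
      (⟺-≡ (cong₂ Rep (trans (bind-listS _ (Vec.map at (allFin k)))
        (cong listS (trans (sym (Vec.map-∘ _ at (allFin k)))
          (trans (Vec.map-cong (λ i → cong at (++ᵉ-toℕ as i)) (allFin k))
            (trans (Vec.map-∘ at (lookup as) (allFin k)) (cong (Vec.map at) (Vec.map-lookup-allFin as)))))))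
        (++ᵉ-+ as l)))) ⟺-refl)

  IsList-unique : ∀ {k} (as bs : Vec D k) {x e} → IsList as x → IsList bs x → ∀ i → (as ++ᵉ e) i ≈ (bs ++ᵉ e) i
  IsList-unique [] [] p q i = ≈-refl
  IsList-unique (a ∷ as) (b ∷ bs) (y , z , p , q , r) (y′ , z′ , p′ , q′ , r′) i with Pair-unique p p′
  IsList-unique (a ∷ as) (b ∷ bs) (y , z , p , q , r) (y′ , z′ , p′ , q′ , r′) zero | u , v =
    ≈-trans (≈-sym q) (≈-trans u q′)
  IsList-unique (a ∷ as) (b ∷ bs) (y , z , p , q , r) (y′ , z′ , p′ , q′ , r′) (suc i) | u , v =
    IsList-unique as bs (Rep-≈ (listS (Vec.map at as)) v r) r′ i

  fn-cong : ∀ f (as bs : Vec D (funArity L f)) {x} → IsList as x → IsList bs x → fn f as ≈ fn f bs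
  fn-cong f as bs p q = proj₁ (conv as)
    (sat-≈ (fun f (vars _) ≐ var (funArity L f + 0)) (λ i → ≈-sym (IsList-unique as bs p q i)) (proj₂ (conv bs) ≈-refl))
    where
    conv : ∀ cs → sat (fun f (vars _) ≐ var (funArity L f + 0)) (cs ++ᵉ λ _ → fn f bs) ⟺ (fn f cs ≈ fn f bs)
    conv cs = ⟺-≡ (cong₂ (λ u v → fn f u ≈ v) (evals-vars cs _) (++ᵉ-+ cs 0))

  rl-cong : ∀ r (as bs : Vec D (relArity L r)) {x} → IsList as x → IsList bs x → rl r as → rl r bs
  rl-cong r as bs p q h = ≡-subst (rl r) (evals-vars bs _)
    (sat-≈ (rel r (vars _)) {as ++ᵉ λ _ → pt} (IsList-unique as bs p q) (≡-subst (rl r) (sym (evals-vars as _)) h))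

  sat-symbol : ∀ n arity (φ : Fin n → Formula L) g f l e {Q : Vec D (arity g) → Set} → Leaf (toℕ g) (e f)
    → (∀ as → sat (φ g) (as ++ᵉ e) ⟺ Q as)
    → sat (symbolF n arity f l φ) e ⟺ (¬ ¬ (Σ[ as ∈ Vec D (arity g) ] (IsList as (e l) × Q as)))
  sat-symbol n arity φ g f l e {Q} lg h =
    ⟺-trans (sat-or (map body (List.allFin n)) e) (⟺-¬ (⟺-¬ (to ∘ Any.map⁻ , from)))
    where
    body : Fin n → Formula L
    body g = leafF (toℕ g) f ∧' onListF (arity g) l (φ g)
    to : ∀ {gs} → Any (λ g → sat (body g) e) gs → Σ[ as ∈ Vec D (arity g) ] (IsList as (e l) × Q as)
    to (here {g′} (p , q)) with refl ← toℕ-injective (Leaf-unique lg (proj₁ (sat-leaf (toℕ g′) f e) p))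
      with as , r , s ← proj₁ (sat-onList (arity g) l (φ g) e) q = as , r , proj₁ (h as) s
    to (there a) = to a
    from : Σ[ as ∈ Vec D (arity g) ] (IsList as (e l) × Q as) → Any (λ φ → sat φ e) (map body (List.allFin n))
    from (as , r , s) = Any.map⁺ (Any.map (λ { refl → proj₂ (sat-leaf (toℕ g) f e) lg ,
      proj₂ (sat-onList (arity g) l (φ g) e) (as , r , proj₂ (h as) s) }) (∈-allFin g))

  sat-apply : ∀ g f l x e → Leaf (toℕ g) (e f) → sat (applyF f l x) e
    ⟺ (¬ ¬ (Σ[ as ∈ Vec D (funArity L g) ] (IsList as (e l) × e x ≈ fn g as)))
  sat-apply g f l x e lg = sat-symbol (nFun L) (funArity L)
    (λ g → var (funArity L g + x) ≐ fun g (vars _)) g f l e lg λ as →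
    ⟺-≡ (cong₂ (λ u w → u ≈ fn g w) (++ᵉ-+ as {e} x) (evals-vars as e))

  Signed : Sign → Set → Set
  Signed pos A = A
  Signed neg⁻ A = ¬ A

  sat-signed : ∀ sg φ e → sat (signedF sg φ) e ≡ Signed sg (sat φ e)
  sat-signed pos φ e = refl
  sat-signed neg⁻ φ e = refl

  sat-rel : ∀ sg g f l e → Leaf (toℕ g) (e f) → sat (relF sg f l) e
    ⟺ (¬ ¬ (Σ[ as ∈ Vec D (relArity L g) ] (IsList as (e l) × Signed sg (rl g as))))
  sat-rel sg g f l e lg = sat-symbol (nRel L) (relArity L)
    (λ g → signedF sg (rel g (vars _))) g f l e lg λ as →
    ⟺-≡ (trans (sat-signed sg (rel g (vars _)) _) (cong (Signed sg ∘ rl g) (evals-vars as e)))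

  ⟦_,_,_,_,_⟧ : D → D → D → D → D → Vec D K
  ⟦ a , b , c , d , f ⟧ = a ∷ b ∷ c ∷ d ∷ f ∷ pt ∷ pt ∷ pt ∷ []

  apply-clause : ∀ n (i : Fin 26) → List.lookup (truth n) i ∈ truth n
  apply-clause n i = ∈-lookup i

  premise : ∀ {P} s → (∀ {d} → Rep s d → Tower P d) → Σ[ d ∈ D ] (Rep s d × Tower P d)
  premise s h with d , r ← Rep-exists s = d , r , h r

  premise¬¬ : ∀ {P} s → (∀ {d} → Rep s d → ¬ ¬ Tower P d) → ¬ ¬ (Σ[ d ∈ D ] (Rep s d × Tower P d))
  premise¬¬ s h with d , r ← Rep-exists s = h r >>= λ t → return (d , r , t)

  side-≈ : ∀ (xs : Vec D K) (i : Fin K) {a} → lookup xs i ≈ a → sideEnv xs (toℕ i) ≈ a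
  side-≈ xs i p = ≡-subst (_≈ _) (sym (++ᵉ-toℕ xs i)) p

  invert : ∀ P {s y} → Rep s y → Der P y → ¬ ¬ Cases P (Der P) s
  invert P {s} r d = Der-step P d >>= λ st → return (cases P {s = s} r st)


  var-sound : ∀ n i {e s x y} → EnvRep e s → Rep (valP (embed (codeT {L} (var i))) (at s) (at x)) y
    → Der (truth n) y → x ≈ e i
  var-sound n zero (const l h) r d = ≈-stable (invert (truth n) {valP (lf 0 · lf 0) (at _) (at _)} r d >>= λ
    { (inj₁ (xs , (_ , _ , (_ , _ , p , _) , _) , _)) → ⊥-elim (Leaf-Pair l p)
    ; (inj₂ (inj₁ (xs , (_ , _ , m , m′) , _))) → return (≈-trans (≈-sym m′) (≈-trans m (≈-sym (h 0))))
    ; (inj₂ (inj₂ ())) })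
  var-sound n zero ((p , q) ∷ es) r d = ≈-stable (invert (truth n) {valP (lf 0 · lf 0) (at _) (at _)} r d >>= λ
    { (inj₁ (xs , (_ , _ , (_ , _ , p′ , a , _) , m) , _)) →
        return (≈-trans (≈-sym m) (≈-trans (≈-sym a) (≈-trans (proj₁ (Pair-unique p′ p)) (≈-sym q))))
    ; (inj₂ (inj₁ (xs , (_ , _ , m , m′) , l , _))) →
        ⊥-elim (Leaf-Pair (Leaf-≈ (side-≈ xs v1 m) (proj₁ (sat-leaf 0 1 (sideEnv xs)) l)) p)
    ; (inj₂ (inj₂ ())) })
  var-sound n (suc i) (const l h) r d = ≈-stable (invert (truth n) {valP (lf 0 · lf 0 · embed (codeN i)) (at _) (at _)} r d >>= λ
    { (inj₁ (xs , (_ , _ , (_ , _ , p , _) , _) , _)) → ⊥-elim (Leaf-Pair l p)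
    ; (inj₂ (inj₁ (xs , (_ , _ , m , m′) , _))) → return (≈-trans (≈-sym m′) (≈-trans m (≈-sym (h (suc i)))))
    ; (inj₂ (inj₂ ())) })
  var-sound n (suc i) ((p , q) ∷ es) r d = ≈-stable (invert (truth n) {valP (lf 0 · lf 0 · embed (codeN i)) (at _) (at _)} r d >>= λ
    { (inj₁ (xs , (_ , (_ , _ , mi) , (_ , _ , p′ , _ , b) , m) , _ ,
        (_ , (_ , _ , p₁ , l₁ , _ , _ , p₂ , (_ , _ , p₃ , l₃ , a₃) , r₂) , d′) ∷ [])) →
        return (≈-trans (≈-sym m) (var-sound n i
          (EnvRep-≈ (≈-trans (≈-sym (proj₂ (Pair-unique p′ p))) b) es)
          (_ , _ , p₁ , l₁ , _ , _ , p₂ , (_ , _ , p₃ , l₃ , Rep-≈ (embed (codeN i)) (≈-sym a₃) mi) , r₂) d′))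
    ; (inj₂ (inj₁ (xs , (_ , _ , m , m′) , l , _))) →
        ⊥-elim (Leaf-Pair (Leaf-≈ (side-≈ xs v1 m) (proj₁ (sat-leaf 0 1 (sideEnv xs)) l)) p)
    ; (inj₂ (inj₂ ())) })

  val-sound : ∀ n t {e s x y} → EnvRep e s → Rep (valP (embed (codeT t)) (at s) (at x)) y
    → Der (truth n) y → x ≈ eval e t
  vals-sound : ∀ n {k} (ts : Vec (Term L) k) {e s l y} → EnvRep e s
    → Rep (valsP (embed (codeTs ts)) (at s) (at l)) y → Der (truth n) y → ¬ ¬ IsList (evals e ts) l
  val-sound n (var i) er r d = var-sound n i er r d
  val-sound n (fun f ts) {e} er r d = ≈-stable
    (invert (truth n) {valP (lf 1 · lf (toℕ f) · embed (codeTs ts)) (at _) (at _)} r d >>= λ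
    { (inj₁ (xs , (_ , (_ , mf , mts) , ms , mx) , ap , (_ , r′ , d′) ∷ [])) →
        proj₁ (sat-apply f 0 4 3 (sideEnv xs) (Leaf-≈ (≈-sym (side-≈ xs v0 ≈-refl)) mf)) ap >>= λ
        { (as , il , q) →
          vals-sound n ts (EnvRep-≈ (≈-sym ms) er) (into (embed (codeTs ts)) (at _ · at _) mts r′) d′ >>= λ il′ →
          return (≈-trans (≈-sym (side-≈ xs v3 mx)) (≈-trans q
            (fn-cong f as (evals e ts) (Rep-≈ (listS (Vec.map at as)) (side-≈ xs v4 ≈-refl) il) il′))) }
    ; (inj₂ ()) })
  vals-sound n [] er r d = invert (truth n) {valsP (lf 0) (at _) (at _)} r d >>= λ
    { (inj₁ (xs , (_ , _ , _ , l) , _)) → return l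
    ; (inj₂ ()) }
  vals-sound n (t ∷ ts) {e} er r d = invert (truth n) {valsP (embed (codeT t) · embed (codeTs ts)) (at _) (at _)} r d >>= λ
    { (inj₁ (xs , (_ , (mt , mts) , ms , (_ , _ , p , a , b)) , _ , (_ , r₁ , d₁) ∷ (_ , r₂ , d₂) ∷ [])) →
        vals-sound n ts (EnvRep-≈ (≈-sym ms) er) (into (embed (codeTs ts)) (at _ · at _) mts r₂) d₂ >>= λ il →
        return (_ , _ , p , ≈-trans a (val-sound n t (EnvRep-≈ (≈-sym ms) er) (into (embed (codeT t)) (at _ · at _) mt r₁) d₁)
          , Rep-≈ (listS (Vec.map at (evals e ts))) (≈-sym b) il)
    ; (inj₂ ()) }

  signed-stable : ∀ sg φ {e} → ¬ ¬ Signed sg (sat φ e) → Signed sg (sat φ e)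
  signed-stable pos φ n = stable φ n
  signed-stable neg⁻ φ n = λ p → n λ k → k p

  val-tower : ∀ n t {e s x y} → EnvRep e s → x ≈ eval e t → Rep (valP (embed (codeT t)) (at s) (at x)) y
    → Tower (truth n) y
  vals-tower : ∀ n {k} (ts : Vec (Term L) k) {e s l y} → EnvRep e s → IsList (evals e ts) l
    → Rep (valsP (embed (codeTs ts)) (at s) (at l)) y → Tower (truth n) y
  val-tower n (var i) (const l h) q (_ , _ , p₁ , l₁ , _ , _ , p₂ , (_ , c , p₃ , l₃ , _) , (s , x , p₄ , s≈ , x≈)) =
    tower (apply-clause n (# 2)) ⟦ c , s , pt , pt , pt ⟧
      (_ , _ , p₁ , l₁ , _ , _ , p₂ , (_ , _ , p₃ , l₃ , ≈-refl) , (_ , _ , p₄ , ≈-refl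
        , ≈-trans x≈ (≈-trans q (≈-trans (h i) (≈-sym s≈)))))
      (proj₂ (sat-leaf 0 1 (sideEnv ⟦ c , s , pt , pt , pt ⟧)) (Leaf-≈ (≈-sym s≈) l)) []
  val-tower n (var zero) (_∷_ {s′ = s′} {x′} (p , r) es) q
    (_ , _ , p₁ , l₁ , _ , _ , p₂ , (_ , _ , p₃ , l₃ , z) , (s , x , p₄ , s≈ , x≈)) =
    tower (apply-clause n (# 0)) ⟦ x′ , s′ , pt , pt , pt ⟧
      (_ , _ , p₁ , l₁ , _ , _ , p₂ , (_ , _ , p₃ , l₃ , z) , (_ , _ , p₄
        , (_ , _ , Pair-≈ (≈-sym s≈) p , ≈-refl , ≈-refl) , ≈-trans x≈ (≈-trans q r)))
      id []
  val-tower n (var (suc i)) {x = x} (_∷_ {s′ = s′} {x′} (p , r) es) q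
    (_ , _ , p₁ , l₁ , _ , _ , p₂ , (_ , _ , p₃ , l₃ , (_ , c , p₅ , l₅ , rc)) , (_ , _ , p₄ , s≈ , x≈)) =
    tower (apply-clause n (# 1)) ⟦ c , x′ , s′ , x , pt ⟧
      (_ , _ , p₁ , l₁ , _ , _ , p₂ , (_ , _ , p₃ , l₃ , (_ , _ , p₅ , l₅ , ≈-refl)) , (_ , _ , p₄
        , (_ , _ , Pair-≈ (≈-sym s≈) p , ≈-refl , ≈-refl) , x≈))
      id
      (premise (valP (lf 0 · at c) (at s′) (at x))
        (λ { (_ , _ , a₁ , b₁ , _ , _ , a₂ , (_ , _ , a₃ , b₃ , c≈) , rest) →
          val-tower n (var i) es q (_ , _ , a₁ , b₁ , _ , _ , a₂ , (_ , _ , a₃ , b₃ , Rep-≈ (embed (codeN i)) (≈-sym c≈) rc) , rest) })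
        ∷ [])
  val-tower n (fun f ts) {e} {s} {x} er q
    (_ , _ , p₁ , l₁ , _ , _ , p₂ , (_ , _ , p₃ , l₃ , (cf , cts , p₅ , lf₅ , rts)) , rest)
    = tower (apply-clause n (# 3)) xs
      (_ , _ , p₁ , l₁ , _ , _ , p₂ , (_ , _ , p₃ , l₃ , (_ , _ , p₅ , ≈-refl , ≈-refl)) , rest)
      (proj₂ (sat-apply f 0 4 3 (sideEnv xs) lf₅) (return (evals e ts , il , q)))
      (premise (valsP (at cts) (at s) (at l)) (λ r → vals-tower n ts er il (into (embed (codeTs ts)) (at s · at l) rts r)) ∷ [])
    where
    l = proj₁ (Rep-exists (listS (Vec.map at (evals e ts))))
    il = proj₂ (Rep-exists (listS (Vec.map at (evals e ts))))
    xs = ⟦ cf , cts , s , x , l ⟧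
  vals-tower n [] {s = s} er il (_ , _ , p₁ , l₁ , _ , _ , p₂ , z , (_ , _ , p₄ , s≈ , l≈)) =
    tower (apply-clause n (# 4)) ⟦ s , pt , pt , pt , pt ⟧
      (_ , _ , p₁ , l₁ , _ , _ , p₂ , z , (_ , _ , p₄ , s≈ , Leaf-≈ (≈-sym l≈) il)) id []
  vals-tower n (t ∷ ts) {s = s} er (a , l , p , a≈ , il)
    (_ , _ , p₁ , l₁ , _ , _ , p₂ , (ct , cts , p₃ , rt , rts) , (_ , _ , p₄ , s≈ , l≈)) =
    tower (apply-clause n (# 5)) ⟦ ct , cts , s , a , l ⟧
      (_ , _ , p₁ , l₁ , _ , _ , p₂ , (_ , _ , p₃ , ≈-refl , ≈-refl)
        , (_ , _ , p₄ , s≈ , (_ , _ , Pair-≈ (≈-sym l≈) p , ≈-refl , ≈-refl)))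
      id
      (premise (valP (at ct) (at s) (at a)) (λ r → val-tower n t er a≈ (into (embed (codeT t)) (at s · at a) rt r))
        ∷ premise (valsP (at cts) (at s) (at l)) (λ r → vals-tower n ts er il (into (embed (codeTs ts)) (at s · at l) rts r)) ∷ [])

  val-exists : ∀ n t {e s c} → EnvRep e s → IsTree (codeT t) c
    → Σ[ d ∈ D ] (Rep (valP (at c) (at s) (at (eval e t))) d × Tower (truth n) d)
  val-exists n t {e} {s} {c} er rc = premise (valP (at c) (at s) (at (eval e t)))
    λ r → val-tower n t er ≈-refl (into (embed (codeT t)) (at s · at _) rc r)

  into₁ : ∀ t {j k a b y} → Rep (lf j · (lf k · at a) · at b) y → IsTree t a → Rep (lf j · (lf k · embed t) · at b) y
  into₁ t (_ , _ , p , l , _ , _ , p′ , (_ , _ , p″ , l″ , a≈) , s≈) m =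
    _ , _ , p , l , _ , _ , p′ , (_ , _ , p″ , l″ , Rep-≈ (embed t) (≈-sym a≈) m) , s≈

  -- Stated for every element representing the fact, as representatives are not unique. Both are
  -- proved by recursion on the standard formula.
  FactSound FactComplete : ℕ → Sign → Formula L → Set
  FactSound n sg φ = ∀ {e s y} → EnvRep e s → Rep (truthP sg (embed (codeF φ)) (at s)) y
    → Der (truth n) y → Signed sg (sat φ e)
  FactComplete n sg φ = ∀ {e s y} → EnvRep e s → Signed sg (sat φ e)
    → Rep (truthP sg (embed (codeF φ)) (at s)) y → ¬ ¬ Tower (truth n) y

  push : ∀ {e s x} → EnvRep e s → ∀ {s′} → Rep (at x · at s) s′ → EnvRep (x ∷ᵉ e) s′
  push er (_ , _ , p , a , b) = (p , ≈-sym a) ∷ EnvRep-≈ (≈-sym b) er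

  sound-premise : ∀ n sg φ → FactSound n sg φ → ∀ {e s a b} → EnvRep e s → b ≈ s → IsTree (codeF φ) a
    → Σ[ d ∈ D ] (Rep (truthP sg (at a) (at b)) d × Der (truth n) d) → Signed sg (sat φ e)
  sound-premise n sg φ h er p m (_ , r , d) = h (EnvRep-≈ (≈-sym p) er) (into (embed (codeF φ)) (at _) m r) d

  sound-under : ∀ n sg φ → FactSound n sg φ → ∀ {e s a b x} → EnvRep e s → b ≈ s → IsTree (codeF φ) a
    → Σ[ d ∈ D ] (Rep (truthP sg (at a) (at x · at b)) d × Der (truth n) d) → Signed sg (sat φ (x ∷ᵉ e))
  sound-under n sg φ h er p m (_ , (_ , _ , p₁ , l₁ , c , s′ , p₂ , c≈ , rs) , d) =
    h (push (EnvRep-≈ (≈-sym p) er) rs) (_ , _ , p₁ , l₁ , c , s′ , p₂ , Rep-≈ (embed (codeF φ)) (≈-sym c≈) m , ≈-refl) d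

  first-sound : ∀ n k sg s₁ φ t → FactSound n s₁ φ → ∀ {e s} → EnvRep e s
    → Case (Der (truth n)) (truthP sg (lf k · embed (codeF φ) · embed t) (at s)) (first k sg s₁) → Signed s₁ (sat φ e)
  first-sound n k sg s₁ φ t h er (_ , (_ , (_ , m , _) , ms) , _ , b ∷ []) = sound-premise n s₁ φ h er ms m b

  second-sound : ∀ n k sg s₂ ψ t → FactSound n s₂ ψ → ∀ {e s} → EnvRep e s
    → Case (Der (truth n)) (truthP sg (lf k · embed t · embed (codeF ψ)) (at s)) (second k sg s₂) → Signed s₂ (sat ψ e)
  second-sound n k sg s₂ ψ t h er (_ , (_ , (_ , _ , m) , ms) , _ , b ∷ []) = sound-premise n s₂ ψ h er ms m b

  both-sound : ∀ n k sg s₁ s₂ φ ψ → FactSound n s₁ φ → FactSound n s₂ ψ → ∀ {e s} → EnvRep e s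
    → Case (Der (truth n)) (truthP sg (lf k · embed (codeF φ) · embed (codeF ψ)) (at s)) (both k sg s₁ s₂)
    → Signed s₁ (sat φ e) × Signed s₂ (sat ψ e)
  both-sound n k sg s₁ s₂ φ ψ h h′ er (_ , (_ , (_ , m , m′) , ms) , _ , b ∷ b′ ∷ []) =
    sound-premise n s₁ φ h er ms m b , sound-premise n s₂ ψ h′ er ms m′ b′

  sat-underivable : ∀ P p xs → sat (underivableF P p) (sideEnv xs) ⟺ (¬ (Σ[ d ∈ D ] (Rep (inst p xs) d × Der P d)))
  sat-underivable P p xs = ⟺-¬ (⟺-Σ λ d → ⟺-×
    (⟺-trans (sat-shape p (suc ∘ toℕ) 0 (d ∷ᵉ sideEnv xs))
      (⟺-≡ (cong (λ s → Rep s d) (bind-≡ p λ i → cong at (++ᵉ-toℕ xs i)))))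
    (sat-der P 0 (d ∷ᵉ sideEnv xs)))

  -- Both directions are needed from the level below, since underivability exchanges them: soundness
  -- of a dropped quantifier rests on completeness there, and completeness on soundness.
  Previous : ℕ → Set
  Previous zero = ⊤
  Previous (suc n) = ∀ sg φ → Class sg n φ → FactSound n sg φ × FactComplete n sg φ

  fact-sound : ∀ n → Previous n → ∀ sg φ → Class sg n φ → FactSound n sg φ

  fact-sound n prev pos ⊥' _ er r d =
    -- No clause concludes the truth of falsum, so `Cases` computes to the empty type.
    invert (truth n) {truthP pos (lf 0 · lf 0) (at _)} r d λ ()
  fact-sound n prev neg⁻ ⊥' _ er r d = id
  fact-sound n prev pos (rel q ts) _ {e} er r d = stable (rel q ts)
    (invert (truth n) {truthP pos (embed (codeF (rel q ts))) (at _)} r d >>= λ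
    { (inj₁ (xs , (_ , (_ , mq , mts) , ms) , h , (_ , r′ , d′) ∷ [])) →
        proj₁ (sat-rel pos q 0 3 (sideEnv xs) (Leaf-≈ (≈-sym (side-≈ xs v0 ≈-refl)) mq)) h >>= λ
        { (as , il , p) →
          vals-sound n ts (EnvRep-≈ (≈-sym ms) er) (into (embed (codeTs ts)) (at _ · at _) mts r′) d′ >>= λ il′ →
          return (rl-cong q as (evals e ts) (Rep-≈ (listS (Vec.map at as)) (side-≈ xs v3 ≈-refl) il) il′ p) }
    ; (inj₂ ()) })
  fact-sound n prev neg⁻ (rel q ts) _ {e} er r d = signed-stable neg⁻ (rel q ts)
    (invert (truth n) {truthP neg⁻ (embed (codeF (rel q ts))) (at _)} r d >>= λ
    { (inj₁ (xs , (_ , (_ , mq , mts) , ms) , h , (_ , r′ , d′) ∷ [])) →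
        proj₁ (sat-rel neg⁻ q 0 3 (sideEnv xs) (Leaf-≈ (≈-sym (side-≈ xs v0 ≈-refl)) mq)) h >>= λ
        { (as , il , p) →
          vals-sound n ts (EnvRep-≈ (≈-sym ms) er) (into (embed (codeTs ts)) (at _ · at _) mts r′) d′ >>= λ il′ →
          return (λ p′ → p (rl-cong q (evals e ts) as il′ (Rep-≈ (listS (Vec.map at as)) (side-≈ xs v3 ≈-refl) il) p′)) }
    ; (inj₂ ()) })
  fact-sound n prev pos (t ≐ u) _ {e} er r d = ≈-stable
    (invert (truth n) {truthP pos (embed (codeF (t ≐ u))) (at _)} r d >>= λ
    { (inj₁ (xs , (_ , (_ , mt , mu) , ms) , h , (_ , r₁ , d₁) ∷ (_ , r₂ , d₂) ∷ [])) →
        return (≈-trans (≈-sym (val-sound n t (EnvRep-≈ (≈-sym ms) er) (into (embed (codeT t)) (at _ · at _) mt r₁) d₁))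
          (≈-trans (≈-trans (≈-sym (side-≈ xs v3 ≈-refl)) (≈-trans h (side-≈ xs v4 ≈-refl)))
            (val-sound n u (EnvRep-≈ (≈-sym ms) er) (into (embed (codeT u)) (at _ · at _) mu r₂) d₂)))
    ; (inj₂ ()) })
  fact-sound n prev neg⁻ (t ≐ u) _ {e} er r d = signed-stable neg⁻ (t ≐ u)
    (invert (truth n) {truthP neg⁻ (embed (codeF (t ≐ u))) (at _)} r d >>= λ
    { (inj₁ (xs , (_ , (_ , mt , mu) , ms) , h , (_ , r₁ , d₁) ∷ (_ , r₂ , d₂) ∷ [])) →
        return λ p → h (≈-trans (side-≈ xs v3 (val-sound n t (EnvRep-≈ (≈-sym ms) er) (into (embed (codeT t)) (at _ · at _) mt r₁) d₁))
          (≈-trans p (≈-sym (side-≈ xs v4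
            (val-sound n u (EnvRep-≈ (≈-sym ms) er) (into (embed (codeT u)) (at _ · at _) mu r₂) d₂)))))
    ; (inj₂ ()) })
  fact-sound n prev pos (¬' φ) c er r d = signed-stable neg⁻ φ
    (invert (truth n) {truthP pos (embed (codeF (¬' φ))) (at _)} r d >>= λ
    { (inj₁ (xs , (_ , (_ , m) , ms) , _ , b ∷ [])) →
        return (sound-premise n neg⁻ φ (fact-sound n prev neg⁻ φ c) er ms m b)
    ; (inj₂ ()) })
  fact-sound n prev neg⁻ (¬' φ) c er r d = signed-stable neg⁻ (¬' φ)
    (invert (truth n) {truthP neg⁻ (embed (codeF (¬' φ))) (at _)} r d >>= λ
    { (inj₁ (xs , (_ , (_ , m) , ms) , _ , b ∷ [])) →
        return λ k → k (sound-premise n pos φ (fact-sound n prev pos φ c) er ms m b)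
    ; (inj₂ ()) })
  fact-sound n prev pos (φ ∧' ψ) (c , c′) er r d = signed-stable pos (φ ∧' ψ) (invert (truth n) {truthP pos (embed (codeF (φ ∧' ψ))) (at _)} r d >>= λ
    { (inj₁ x) → let p , q = both-sound n 4 pos pos pos φ ψ (fact-sound n prev pos φ c) (fact-sound n prev pos ψ c′) er x in return (p , q)
    ; (inj₂ ()) })
  fact-sound n prev neg⁻ (φ ∧' ψ) (c , c′) er r d = signed-stable neg⁻ (φ ∧' ψ) (invert (truth n) {truthP neg⁻ (embed (codeF (φ ∧' ψ))) (at _)} r d >>= λ
    { (inj₁ x) → let p = first-sound n 4 neg⁻ neg⁻ φ (codeF ψ) (fact-sound n prev neg⁻ φ c) er x in return λ (a , _) → p a
    ; (inj₂ (inj₁ x)) → let p = second-sound n 4 neg⁻ neg⁻ ψ (codeF φ) (fact-sound n prev neg⁻ ψ c′) er x in return λ (_ , b) → p b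
    ; (inj₂ (inj₂ ())) })
  fact-sound n prev pos (φ ∨' ψ) (c , c′) er r d = signed-stable pos (φ ∨' ψ) (invert (truth n) {truthP pos (embed (codeF (φ ∨' ψ))) (at _)} r d >>= λ
    { (inj₁ x) → let p = first-sound n 5 pos pos φ (codeF ψ) (fact-sound n prev pos φ c) er x in return λ (k , _) → k p
    ; (inj₂ (inj₁ x)) → let p = second-sound n 5 pos pos ψ (codeF φ) (fact-sound n prev pos ψ c′) er x in return λ (_ , k) → k p
    ; (inj₂ (inj₂ ())) })
  fact-sound n prev neg⁻ (φ ∨' ψ) (c , c′) er r d = signed-stable neg⁻ (φ ∨' ψ) (invert (truth n) {truthP neg⁻ (embed (codeF (φ ∨' ψ))) (at _)} r d >>= λ
    { (inj₁ x) → let p , q = both-sound n 5 neg⁻ neg⁻ neg⁻ φ ψ (fact-sound n prev neg⁻ φ c) (fact-sound n prev neg⁻ ψ c′) er x in return λ k → k (p , q)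
    ; (inj₂ ()) })
  fact-sound n prev pos (φ ⇒' ψ) (c , c′) er r d = signed-stable pos (φ ⇒' ψ) (invert (truth n) {truthP pos (embed (codeF (φ ⇒' ψ))) (at _)} r d >>= λ
    { (inj₁ x) → let p = first-sound n 6 pos neg⁻ φ (codeF ψ) (fact-sound n prev neg⁻ φ c) er x in return λ a → ⊥-elim (p a)
    ; (inj₂ (inj₁ x)) → let p = second-sound n 6 pos pos ψ (codeF φ) (fact-sound n prev pos ψ c′) er x in return λ _ → p
    ; (inj₂ (inj₂ ())) })
  fact-sound n prev neg⁻ (φ ⇒' ψ) (c , c′) er r d = signed-stable neg⁻ (φ ⇒' ψ) (invert (truth n) {truthP neg⁻ (embed (codeF (φ ⇒' ψ))) (at _)} r d >>= λ
    { (inj₁ x) → let p , q = both-sound n 6 neg⁻ pos neg⁻ φ ψ (fact-sound n prev pos φ c) (fact-sound n prev neg⁻ ψ c′) er x in return λ k → q (k p)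
    ; (inj₂ ()) })
  fact-sound (suc n) prev neg⁻ (∀' φ) c er r d = signed-stable neg⁻ (∀' φ)
    (invert (truth (suc n)) {truthP neg⁻ (embed (codeF (∀' φ))) (at _)} r d >>= λ
    { (inj₁ (xs , (_ , (_ , m) , ms) , _ , b ∷ [])) →
        return λ k → sound-under (suc n) neg⁻ φ (fact-sound (suc n) prev neg⁻ φ c) er ms m b (k _)
    ; (inj₂ ()) })
  fact-sound (suc n) prev pos (∀' φ) c er r d = signed-stable pos (∀' φ)
    (invert (truth (suc n)) {truthP pos (embed (codeF (∀' φ))) (at _)} r d >>= λ
    { (inj₁ (xs , (_ , (_ , m) , ms) , u , [])) k →
        let d , r′ = Rep-exists (truthP neg⁻ (lf 7 · at (lookup xs v0)) (at (lookup xs v1))) in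
        -- Were the universal formula false, completeness one level down would derive its falsity,
        -- against the side condition u.
        proj₂ (prev neg⁻ (∀' φ) c) (EnvRep-≈ (≈-sym ms) er) k (into₁ (codeF φ) r′ m) λ t →
        proj₁ (sat-underivable (truth n) (truthP neg⁻ (lf 7 · at v0) (at v1)) xs) u (d , r′ , Tower⇒Der t)
    ; (inj₂ ()) })
  fact-sound (suc n) prev pos (∃' φ) c er r d = signed-stable pos (∃' φ)
    (invert (truth (suc n)) {truthP pos (embed (codeF (∃' φ))) (at _)} r d >>= λ
    { (inj₁ (xs , (_ , (_ , m) , ms) , _ , b ∷ [])) →
        return (_ , sound-under (suc n) pos φ (fact-sound (suc n) prev pos φ c) er ms m b)
    ; (inj₂ ()) })
  fact-sound (suc n) prev neg⁻ (∃' φ) c er r d = signed-stable neg⁻ (∃' φ)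
    (invert (truth (suc n)) {truthP neg⁻ (embed (codeF (∃' φ))) (at _)} r d >>= λ
    { (inj₁ (xs , (_ , (_ , m) , ms) , u , [])) → return λ k →
        let d , r′ = Rep-exists (truthP pos (lf 8 · at (lookup xs v0)) (at (lookup xs v1))) in
        proj₂ (prev pos (∃' φ) c) (EnvRep-≈ (≈-sym ms) er) k (into₁ (codeF φ) r′ m) λ t →
        proj₁ (sat-underivable (truth n) (truthP pos (lf 8 · at v0) (at v1)) xs) u (d , r′ , Tower⇒Der t)
    ; (inj₂ ()) })

module TruthLemma {L : Lang} {T : Formula L → Set} (S : Sequential T)
  (M : Model L) (M⊨T : ∀ φ → T φ → ∀ e → Model.sat M φ e) where

  open Truth S M M⊨T public
  open Sequential S using (interp; β)
  open Model M

  complete-premise : ∀ n sg φ → FactComplete n sg φ → ∀ {e s a} → EnvRep e s → IsTree (codeF φ) a → Signed sg (sat φ e)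
    → ¬ ¬ (Σ[ d ∈ D ] (Rep (truthP sg (at a) (at s)) d × Tower (truth n) d))
  complete-premise n sg φ h {s = s} {a} er m p =
    premise¬¬ (truthP sg (at a) (at s)) λ r → h er p (into (embed (codeF φ)) (at s) m r)

  complete-under : ∀ n sg φ → FactComplete n sg φ → ∀ {e s a} x → EnvRep e s → IsTree (codeF φ) a → Signed sg (sat φ (x ∷ᵉ e))
    → ¬ ¬ (Σ[ d ∈ D ] (Rep (truthP sg (at a) (at x · at s)) d × Tower (truth n) d))
  complete-under n sg φ h {s = s} {a} x er m p = premise¬¬ (truthP sg (at a) (at x · at s))
    λ { (_ , _ , p₁ , l₁ , c , s′ , p₂ , c≈ , rs) →
      h (push er rs) p (_ , _ , p₁ , l₁ , c , s′ , p₂ , Rep-≈ (embed (codeF φ)) (≈-sym c≈) m , ≈-refl) }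

  unary-tower : ∀ n sg s₁ φ → unary sg s₁ ∈ truth n → FactComplete n s₁ φ → ∀ {e s y} → EnvRep e s → Signed s₁ (sat φ e)
    → Rep (truthP sg (lf 3 · embed (codeF φ)) (at s)) y → ¬ ¬ Tower (truth n) y
  unary-tower n sg s₁ φ c∈ h {s = s} er p (_ , _ , p₁ , l₁ , _ , _ , p₂ , (_ , a , p₃ , l₃ , ra) , s≈) =
    complete-premise n s₁ φ h er ra p >>= λ b → return (tower c∈ ⟦ a , s , pt , pt , pt ⟧
      (_ , _ , p₁ , l₁ , _ , _ , p₂ , (_ , _ , p₃ , l₃ , ≈-refl) , s≈) id (b ∷ []))

  operands : ∀ k {j} t u {s y} → Rep (lf j · (lf k · embed t · embed u) · at s) y
    → Σ[ a ∈ D ] Σ[ b ∈ D ] (IsTree t a × IsTree u b × Rep (lf j · (lf k · at a · at b) · at s) y)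
  operands k t u (_ , _ , p₁ , l₁ , _ , _ , p₂ , (_ , _ , p₃ , l₃ , (a , b , p₄ , ra , rb)) , s≈) =
    a , b , ra , rb , _ , _ , p₁ , l₁ , _ , _ , p₂ , (_ , _ , p₃ , l₃ , (_ , _ , p₄ , ≈-refl , ≈-refl)) , s≈

  first-tower : ∀ n k sg s₁ φ t → first k sg s₁ ∈ truth n → FactComplete n s₁ φ → ∀ {e s y} → EnvRep e s
    → Rep (truthP sg (lf k · embed (codeF φ) · embed t) (at s)) y → Signed s₁ (sat φ e) → ¬ ¬ Tower (truth n) y
  first-tower n k sg s₁ φ t c∈ h {s = s} er r p with a , b , ra , _ , r′ ← operands k (codeF φ) t r =
    complete-premise n s₁ φ h er ra p >>= λ u → return (tower c∈ ⟦ a , b , s , pt , pt ⟧ r′ id (u ∷ []))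

  second-tower : ∀ n k sg s₂ ψ t → second k sg s₂ ∈ truth n → FactComplete n s₂ ψ → ∀ {e s y} → EnvRep e s
    → Rep (truthP sg (lf k · embed t · embed (codeF ψ)) (at s)) y → Signed s₂ (sat ψ e) → ¬ ¬ Tower (truth n) y
  second-tower n k sg s₂ ψ t c∈ h {s = s} er r p with a , b , _ , rb , r′ ← operands k t (codeF ψ) r =
    complete-premise n s₂ ψ h er rb p >>= λ u → return (tower c∈ ⟦ a , b , s , pt , pt ⟧ r′ id (u ∷ []))

  both-tower : ∀ n k sg s₁ s₂ φ ψ → both k sg s₁ s₂ ∈ truth n → FactComplete n s₁ φ → FactComplete n s₂ ψ
    → ∀ {e s y} → EnvRep e s → Rep (truthP sg (lf k · embed (codeF φ) · embed (codeF ψ)) (at s)) y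
    → Signed s₁ (sat φ e) → Signed s₂ (sat ψ e) → ¬ ¬ Tower (truth n) y
  both-tower n k sg s₁ s₂ φ ψ c∈ h h′ {s = s} er r p q with a , b , ra , rb , r′ ← operands k (codeF φ) (codeF ψ) r =
    complete-premise n s₁ φ h er ra p >>= λ u → complete-premise n s₂ ψ h′ er rb q >>= λ w →
    return (tower c∈ ⟦ a , b , s , pt , pt ⟧ r′ id (u ∷ w ∷ []))

  rel-tower : ∀ n sg q ts → (truthP sg (lf 1 · at v0 · at v1) (at v2) ⇐ valsP (at v1) (at v2) (at v3) ∷ [] ∣ relF sg 0 3) ∈ truth n
    → ∀ {e s y} → EnvRep e s → Signed sg (rl q (evals e ts)) → Rep (truthP sg (embed (codeF (rel q ts))) (at s)) y → Tower (truth n) y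
  rel-tower n sg q ts c∈ {e} {s} er p (_ , _ , p₁ , l₁ , _ , _ , p₂ , (_ , _ , p₃ , l₃ , (a , b , p₄ , la , rb)) , s≈) =
    tower c∈ xs
      (_ , _ , p₁ , l₁ , _ , _ , p₂ , (_ , _ , p₃ , l₃ , (_ , _ , p₄ , ≈-refl , ≈-refl)) , s≈)
      (proj₂ (sat-rel sg q 0 3 (sideEnv xs) la) (return (evals e ts , il , p)))
      (premise (valsP (at b) (at s) (at l)) (λ r → vals-tower n ts er il (into (embed (codeTs ts)) (at s · at l) rb r)) ∷ [])
    where
    l = proj₁ (Rep-exists (listS (Vec.map at (evals e ts))))
    il = proj₂ (Rep-exists (listS (Vec.map at (evals e ts))))
    xs = ⟦ a , b , s , l , pt ⟧

  fact-complete : ∀ n → Previous n → ∀ sg φ → Class sg n φ → FactComplete n sg φ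
  fact-complete n prev neg⁻ ⊥' c {s = s} er p r =
    return (tower (apply-clause n (# 6)) ⟦ s , pt , pt , pt , pt ⟧ r id [])
  fact-complete n prev pos (rel q ts) c er p r = return (rel-tower n pos q ts (apply-clause n (# 7)) er p r)
  fact-complete n prev neg⁻ (rel q ts) c er p r = return (rel-tower n neg⁻ q ts (apply-clause n (# 8)) er p r)
  fact-complete n prev pos (t ≐ u) c {e} {s} er p r with a , b , ra , rb , r′ ← operands 2 (codeT t) (codeT u) r =
    return (tower (apply-clause n (# 9)) ⟦ a , b , s , eval e t , eval e u ⟧ r′ p
      (val-exists n t er ra ∷ val-exists n u er rb ∷ []))
  fact-complete n prev neg⁻ (t ≐ u) c {e} {s} er p r with a , b , ra , rb , r′ ← operands 2 (codeT t) (codeT u) r =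
    return (tower (apply-clause n (# 10)) ⟦ a , b , s , eval e t , eval e u ⟧ r′ p
      (val-exists n t er ra ∷ val-exists n u er rb ∷ []))
  fact-complete n prev pos (¬' φ) c er p r =
    unary-tower n pos neg⁻ φ (apply-clause n (# 11)) (fact-complete n prev neg⁻ φ c) er p r
  fact-complete n prev neg⁻ (¬' φ) c er p r =
    unary-tower n neg⁻ pos φ (apply-clause n (# 12)) (fact-complete n prev pos φ c) er (stable φ p) r
  fact-complete n prev pos (φ ∧' ψ) (c , c′) er (p , q) r = both-tower n 4 pos pos pos φ ψ (apply-clause n (# 13))
    (fact-complete n prev pos φ c) (fact-complete n prev pos ψ c′) er r p q
  fact-complete n prev neg⁻ (φ ∧' ψ) (c , c′) {e} er p r = lem (sat φ e) >>= λ
    { (inj₁ a) → second-tower n 4 neg⁻ neg⁻ ψ (codeF φ) (apply-clause n (# 15)) (fact-complete n prev neg⁻ ψ c′) er r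
        (λ b → p (a , b))
    ; (inj₂ a) → first-tower n 4 neg⁻ neg⁻ φ (codeF ψ) (apply-clause n (# 14)) (fact-complete n prev neg⁻ φ c) er r a }
  fact-complete n prev pos (φ ∨' ψ) (c , c′) {e} er p r = lem (sat φ e) >>= λ
    { (inj₁ a) → first-tower n 5 pos pos φ (codeF ψ) (apply-clause n (# 16)) (fact-complete n prev pos φ c) er r a
    ; (inj₂ a) → second-tower n 5 pos pos ψ (codeF φ) (apply-clause n (# 17)) (fact-complete n prev pos ψ c′) er r
        (stable ψ λ b → p (a , b)) }
  fact-complete n prev neg⁻ (φ ∨' ψ) (c , c′) er p r = both-tower n 5 neg⁻ neg⁻ neg⁻ φ ψ (apply-clause n (# 18))
    (fact-complete n prev neg⁻ φ c) (fact-complete n prev neg⁻ ψ c′) er r (λ a → p λ (k , _) → k a) (λ b → p λ (_ , k) → k b)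
  fact-complete n prev pos (φ ⇒' ψ) (c , c′) {e} er p r = lem (sat φ e) >>= λ
    { (inj₁ a) → second-tower n 6 pos pos ψ (codeF φ) (apply-clause n (# 20)) (fact-complete n prev pos ψ c′) er r (p a)
    ; (inj₂ a) → first-tower n 6 pos neg⁻ φ (codeF ψ) (apply-clause n (# 19)) (fact-complete n prev neg⁻ φ c) er r a }
  fact-complete n prev neg⁻ (φ ⇒' ψ) (c , c′) er p r = both-tower n 6 neg⁻ pos neg⁻ φ ψ (apply-clause n (# 21))
    (fact-complete n prev pos φ c) (fact-complete n prev neg⁻ ψ c′) er r
    (stable φ λ k → p λ a → ⊥-elim (k a)) (λ b → p λ _ → b)
  fact-complete (suc n) prev neg⁻ (∀' φ) c {e} {s} er p (_ , _ , p₁ , l₁ , _ , _ , p₂ , (_ , a , p₃ , l₃ , ra) , s≈) =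
    -- A counterexample to the universal formula exists up to double negation only, hence the monad.
    (λ k → p λ x → stable φ λ q → k (x , q)) >>= λ { (x , q) →
    complete-under (suc n) neg⁻ φ (fact-complete (suc n) prev neg⁻ φ c) x er ra q >>= λ b →
    return (tower (apply-clause (suc n) (# 22)) ⟦ a , s , x , pt , pt ⟧
      (_ , _ , p₁ , l₁ , _ , _ , p₂ , (_ , _ , p₃ , l₃ , ≈-refl) , s≈) id (b ∷ [])) }
  fact-complete (suc n) prev pos (∀' φ) c {e} {s} er p (_ , _ , p₁ , l₁ , _ , _ , p₂ , (_ , a , p₃ , l₃ , ra) , s≈) =
    return (tower (apply-clause (suc n) (# 23)) xs
      (_ , _ , p₁ , l₁ , _ , _ , p₂ , (_ , _ , p₃ , l₃ , ≈-refl) , s≈)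
      (proj₂ (sat-underivable (truth n) (truthP neg⁻ (lf 7 · at v0) (at v1)) xs)
        λ (_ , r , d) → proj₁ (prev neg⁻ (∀' φ) c) er (into₁ (codeF φ) r ra) d p) [])
    where xs = ⟦ a , s , pt , pt , pt ⟧
  fact-complete (suc n) prev pos (∃' φ) c {e} {s} er (x , q) (_ , _ , p₁ , l₁ , _ , _ , p₂ , (_ , a , p₃ , l₃ , ra) , s≈) =
    complete-under (suc n) pos φ (fact-complete (suc n) prev pos φ c) x er ra q >>= λ b →
    return (tower (apply-clause (suc n) (# 24)) ⟦ a , s , x , pt , pt ⟧
      (_ , _ , p₁ , l₁ , _ , _ , p₂ , (_ , _ , p₃ , l₃ , ≈-refl) , s≈) id (b ∷ []))
  fact-complete (suc n) prev neg⁻ (∃' φ) c {e} {s} er p (_ , _ , p₁ , l₁ , _ , _ , p₂ , (_ , a , p₃ , l₃ , ra) , s≈) =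
    return (tower (apply-clause (suc n) (# 25)) xs
      (_ , _ , p₁ , l₁ , _ , _ , p₂ , (_ , _ , p₃ , l₃ , ≈-refl) , s≈)
      (proj₂ (sat-underivable (truth n) (truthP pos (lf 8 · at v0) (at v1)) xs)
        λ (_ , r , d) → p (proj₁ (prev pos (∃' φ) c) er (into₁ (codeF φ) r ra) d)) [])
    where xs = ⟦ a , s , pt , pt , pt ⟧

  previous : ∀ n → Previous n
  previous zero = tt
  previous (suc n) sg φ c = fact-sound n (previous n) sg φ c , fact-complete n (previous n) sg φ c

-- Horn clauses and standard ranks

-- The rules for `≐subst` and for substitution into vectors use six variables; together with two for
-- the ranks these make up the `K` variables of a clause.
Var : Set
Var = Fin 6

record Rule : Set where
  constructor _⟸_
  field
    conclusion : Shape Var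
    premises   : List (Shape Var)

infix 4.5 _⟸_

instT : Shape Var → Vec Tree 6 → Tree
instT (at i) v = lookup v i
instT (lf k) v = leaf k
instT (s · t) v = nd (instT s v) (instT t v)

instT-embed : ∀ t v → instT (embed t) v ≡ t
instT-embed (leaf k) v = refl
instT-embed (nd s t) v = cong₂ nd (instT-embed s v) (instT-embed t v)

-- The tag leaf 0 marks the trivial facts "t is a tree".
data Horn (P : List Rule) : Tree → Set where
  tree : ∀ t → Horn P (nd (leaf 0) t)
  rule : ∀ {r t} → r ∈ P → ∀ v → t ≡ instT (Rule.conclusion r) v
    → All (λ b → Horn P (instT b v)) (Rule.premises r) → Horn P t

-- Facts are paired with a rank, which drops by one at each step. Together with
-- the guards this forces everything below a standard rank to be standard.
module HornFormulas {L : Lang} (I : QInterp L) (β : Formula L) where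
  open Formulas I β

  raise : Shape Var → Pat
  raise = bind (λ i → at (fsuc (fsuc i)))

  succF : Formula L
  succF = natF 0 ∧' natF 1 ∧' arithF (qS (qv 1) q= qv 0) 0 1

  guards : List (Shape Var)
  guards = map (λ i → lf 0 · at i) (List.allFin 6)

  ranked : Rule → Clause L
  ranked (h ⟸ bs) = at v0 · raise h ⇐ map (λ b → at v1 · raise b) (bs ++ guards) ∣ succF

  -- Entry 0 of a leaf is the successor of its label: being nonzero excludes pairs, and being at
  -- most the rank forces the label to be standard when the rank is. The labels form an infinite
  -- family, which no finite list of rules could cover.
  leafRule : Clause L
  leafRule = at v0 · lf 0 · at v2 ⇐ [] ∣ natF 0 ∧' ∃' (atF 0 3 0 ∧' natF 0 ∧' ¬' (isNumF 0 0) ∧' leF 0 1)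

  nodeRule : Rule
  nodeRule = lf 0 · at v0 · at v1 ⟸ []

  system : List Rule → List (Clause L)
  system P = leafRule ∷ map ranked (nodeRule ∷ P)

module HornLemma {L : Lang} {T : Formula L → Set} (S : Sequential T)
  (M : Model L) (M⊨T : ∀ φ → T φ → ∀ e → Model.sat M φ e) where

  open TruthLemma S M M⊨T public
  open Sequential S using (interp; β)
  open HornFormulas interp β public
  open Model M

  sat-succ : ∀ e → sat succF e ⟺ (Σ[ q ∈ N (e 0) ] Σ[ q′ ∈ N (e 1) ] suc° (e 1 ,° q′) ~ (e 0 ,° q))
  sat-succ e =
    (λ (q , q′ , p) → let m = proj₁ (sat-nat 0 e) q ; m′ = proj₁ (sat-nat 1 e) q′ in
      m , m′ , proj₁ (sat-arith (qS (qv 1) q= qv 0) 0 1 e m m′) p)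
    , λ (m , m′ , p) → proj₂ (sat-nat 0 e) m , proj₂ (sat-nat 1 e) m′ , proj₂ (sat-arith (qS (qv 1) q= qv 0) 0 1 e m m′) p

  -- The variables v0 and v1 are reserved for the ranks.
  fill : Shape Var → Vec D K → Shape D
  fill s xs = bind (λ i → at (lookup xs (fsuc (fsuc i)))) s

  inst-raise : ∀ s xs → inst (raise s) xs ≡ fill s xs
  inst-raise (at i) xs = refl
  inst-raise (lf k) xs = refl
  inst-raise (s · t) xs = cong₂ _·_ (inst-raise s xs) (inst-raise t xs)

  Trees : Vec Tree 6 → Vec D K → Set
  Trees v xs = ∀ i → IsTree (lookup v i) (lookup xs (fsuc (fsuc i)))

  fill-IsTree : ∀ s {v xs x} → Trees v xs → Rep (fill s xs) x → IsTree (instT s v) x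
  fill-IsTree (at i) {v} h r = Rep-≈ (embed (lookup v i)) (≈-sym r) (h i)
  fill-IsTree (lf k) h r = r
  fill-IsTree (s · t) {v} {xs} h (y , z , p , q , r) = y , z , p , fill-IsTree s {v} {xs} h q , fill-IsTree t {v} {xs} h r

  ¬¬-All : ∀ {A : Set} {P : A → Set} {as} → All (λ a → ¬ ¬ P a) as → ¬ ¬ All P as
  ¬¬-All [] = return []
  ¬¬-All (p ∷ ps) = p >>= λ a → ¬¬-All ps >>= λ as → return (a ∷ as)

  Standard : List Rule → D → Set
  Standard P f = Σ[ t ∈ Tree ] (IsTree t f × Horn P t)

  -- Recursion on the standard rank. The successor condition passes to a smaller standard rank, and
  -- the guards show that all variables of the clause are standard trees, so the step in M is an
  -- instance of a genuine rule.
  Horn-sound : ∀ P r {q f e} → IsNum r q → Rep (at q · at f) e → Der (system P) e → ¬ ¬ Standard P f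
  private
    Premise : List Rule → Vec D K → Shape Var → Set
    Premise P xs b = Σ[ d ∈ D ] (Rep (inst (at v1 · raise b) xs) d × Der (system P) d)

    -- The hypothesis `ok` covers the rules of P as well as `nodeRule`, which need not belong to P
    -- and whose conclusions are Horn facts by `tree`.
    step-sound : ∀ P c → (∀ v → All (λ b → Horn P (instT b v)) (Rule.premises c) → Horn P (instT (Rule.conclusion c) v))
      → ∀ r {q f e} → IsNum r q → Rep (at q · at f) e → StepAt (Der (system P)) e (ranked c) → ¬ ¬ Standard P f

    premise-sound : ∀ P r xs b → IsNum r (lookup xs v1) → Premise P xs b
      → ¬ ¬ (Σ[ t ∈ Tree ] Σ[ f ∈ D ] (IsTree t f × Rep (fill b xs) f × Horn P t))
    premise-sound P r xs b m (d , (y , z , p , a , s) , der′) =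
      Horn-sound P r m (y , z , p , a , ≈-refl) der′ >>= λ (t , it , h) →
      return (t , z , it , ≡-subst (λ s → Rep s z) (inst-raise b xs) s , h)

    tree-of : ∀ {P xs i} → Σ[ t ∈ Tree ] Σ[ f ∈ D ] (IsTree t f × Rep (fill (lf 0 · at i) xs) f × Horn P t)
      → Σ[ t ∈ Tree ] IsTree t (lookup xs (fsuc (fsuc i)))
    tree-of (leaf k , f , it , (_ , _ , p , _) , h) = ⊥-elim (Leaf-Pair it p)
    tree-of (nd s t , f , (_ , _ , p , _ , it) , (_ , _ , p′ , _ , a) , h) =
      t , Rep-≈ (embed t) (≈-trans (proj₂ (Pair-unique p p′)) a) it

    step-sound P c ok zero m e (xs , h , su , bs) with q , q′ , s ← proj₁ (sat-succ (sideEnv xs)) su =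
      ⊥-elim (rank-zero m e h)
      where
      rank-zero : ∀ {q f e} → IsNum 0 q → Rep (at q · at f) e → Rep (inst (at v0 · raise (Rule.conclusion c)) xs) e → ⊥
      rank-zero (n ,ⁿ p) (_ , _ , p₁ , a , _) (_ , _ , p₂ , b , _) = suc≉zero (~-trans s (~-trans
        (~-of-≈ (≈-trans (side-≈ xs v0 ≈-refl) (≈-trans (≈-sym b) (≈-trans (proj₁ (Pair-unique p₂ p₁)) a)))) p))
    step-sound P c@(con ⟸ prems) ok (suc r) {q} {f} (n ,ⁿ p) (_ , _ , p₁ , a , f≈) (xs , (_ , z , p₂ , b , hd) , su , bs)
      with q₀ , q₁ , s ← proj₁ (sat-succ (sideEnv xs)) su =
      ¬¬-All (All.map (λ {b} → premise-sound P r xs b rank) (All.map⁻ bs)) >>= λ ps →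
      let trees : All (λ b → Σ[ t ∈ Tree ] Σ[ f ∈ D ] (IsTree t f × Rep (fill b xs) f × Horn P t)) guards
          trees = All.++⁻ʳ prems ps
          at-var : ∀ i → Σ[ t ∈ Tree ] IsTree t (lookup xs (fsuc (fsuc i)))
          at-var i = tree-of {xs = xs} {i} (All.lookup (All.map⁻ {f = λ i → lf 0 · at i} trees) (∈-allFin i))
          -- The guards supply a tree for every variable, including those that no premise mentions.
          v = Vec.tabulate (proj₁ ∘ at-var)
          at-v : Trees v xs
          at-v i = ≡-subst (λ t → IsTree t (lookup xs (fsuc (fsuc i)))) (sym (Vec.lookup∘tabulate (proj₁ ∘ at-var) i)) (proj₂ (at-var i))
      in return (instT con v ,
        fill-IsTree con {v} {xs} at-v (Rep-≈ (fill con xs) (≈-trans (proj₂ (Pair-unique p₂ p₁)) f≈)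
          (≡-subst (λ s → Rep s z) (inst-raise con xs) hd)) ,
        ok v (All.map (λ {b} (t , f , it , rf , h) →
          ≡-subst (Horn P) (IsTree-unique t (instT b v) it (fill-IsTree b {v} {xs} at-v rf)) h) (All.++⁻ˡ prems ps)))
      where
      rank : IsNum r (lookup xs v1)
      rank = IsNum-≈ (side-≈ xs v1 ≈-refl) (q₁ ,ⁿ suc°-inj (~-trans s (~-trans
        (~-of-≈ (≈-trans (side-≈ xs v0 ≈-refl) (≈-trans (≈-sym b) (≈-trans (proj₁ (Pair-unique p₂ p₁)) a)))) p)))

  Horn-sound P r {q} {f} {e} m re d = Der-step (system P) d >>= λ
    { (here (xs , (_ , _ , p₂ , b , (_ , z , p₃ , l₃ , c)) , (n₀ , u , atu , nu , u≢0 , u≤) , [])) →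
        let (_ , _ , p₁ , a , f≈) = re
            n₀′ = proj₁ (sat-nat 0 (sideEnv xs)) n₀
            nu′ = proj₁ (sat-nat 0 (u ∷ᵉ sideEnv xs)) nu
            (n ,ⁿ p) = m
            q~ : (sideEnv xs 0 ,° n₀′) ~ num r
            q~ = ~-trans (~-of-≈ (≈-trans (side-≈ xs v0 ≈-refl) (≈-trans (≈-sym b) (≈-trans (proj₁ (Pair-unique p₂ p₁)) a)))) p
            le = ≤°-resp ~-refl q~ (proj₁ (sat-le 0 1 (u ∷ᵉ sideEnv xs) nu′ n₀′) u≤)
            atu′ = proj₁ (sat-at 0 3 0 (u ∷ᵉ sideEnv xs)) atu
        in ≤°-num r (u ,° nu′) le >>= λ
          { (zero , _ , e₀) → ⊥-elim (u≢0 (proj₂ (sat-isNum 0 0 (u ∷ᵉ sideEnv xs)) (nu′ ,ⁿ e₀)))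
          ; (suc j , _ , ej) → return (nd (leaf 0) (leaf j) ,
              Rep-≈ (lf 0 · lf j) (≈-trans (proj₂ (Pair-unique p₂ p₁)) f≈)
                (_ , _ , p₃ , l₃ , u , At-≈ (≈-trans (side-≈ xs v2 ≈-refl) (≈-sym c)) ≈-refl atu′ , (nu′ ,ⁿ ej))
              , tree (leaf j)) }
    ; (there (here st)) → step-sound P nodeRule (λ v _ → tree _) r m re st
    ; (there (there st)) → rules P (λ i → i) (Any.map⁻ st) }
    where
    rules : ∀ Q → (∀ {c} → c ∈ Q → c ∈ P) → Any (StepAt (Der (system P)) e ∘ ranked) Q → ¬ ¬ Standard P f
    rules (c ∷ Q) sub (here st) = step-sound P c (λ v bs → rule (sub (here refl)) v refl bs) r m re st
    rules (c ∷ Q) sub (there a) = rules Q (sub ∘ there) a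

  -- Completeness of ranked derivability

  can : Tree → D
  can (leaf k) = proj₁ (leaf-exists k)
  can (nd s t) = proj₁ (pair-exists (can s) (can t))

  can-IsTree : ∀ t → IsTree t (can t)
  can-IsTree (leaf k) = proj₂ (leaf-exists k)
  can-IsTree (nd s t) = can s , can t , proj₂ (pair-exists (can s) (can t)) , can-IsTree s , can-IsTree t

  fill-can : ∀ s v q q′ → Rep (fill s (q ∷ q′ ∷ Vec.map can v)) (can (instT s v))
  fill-can (at i) v q q′ = ≡-subst (can (lookup v i) ≈_) (sym (Vec.lookup-map i can v)) ≈-refl
  fill-can (lf k) v q q′ = proj₂ (leaf-exists k)
  fill-can (s · t) v q q′ = _ , _ , proj₂ (pair-exists _ _) , fill-can s v q q′ , fill-can t v q q′

  -- Representatives of trees are not unique; canonical ones make equal trees equal elements.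
  record Tall (P : List Rule) (r : ℕ) (t : Tree) : Set where
    constructor tall
    field towers : ∀ r′ → r ≤ r′ → ∀ q e → IsNum r′ q → Rep (at q · at (can t)) e → Tower (system P) e
  open Tall

  Tall-mono : ∀ {P r m t} → r ≤ m → Tall P r t → Tall P m t
  Tall-mono p t = tall λ r′ q → towers t r′ (≤-trans p q)

  -- All premises of a clause share one rank. Their ranks are raised to the maximum, and this is why
  -- `Tall` speaks of all ranks from r on.
  tall-max : ∀ {P} {A : Set} {f : A → Tree} {as} → All (λ a → Σ[ r ∈ ℕ ] Tall P r (f a)) as
    → Σ[ r ∈ ℕ ] All (λ a → Tall P r (f a)) as
  tall-max [] = 0 , []
  tall-max ((r , t) ∷ ts) with m , us ← tall-max ts =
    r ⊔ m , Tall-mono (m≤m⊔n r m) t ∷ All.map (Tall-mono (m≤n⊔m r m)) us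

  step-tall : ∀ P c → ranked c ∈ system P → ∀ v r → All (λ b → Tall P r (instT b v)) (Rule.premises c ++ guards)
    → Tall P (suc r) (instT (Rule.conclusion c) v)
  step-tall P (con ⟸ prems) c∈ v r bs = tall λ
    { (suc r′) (s≤s r≤) q e (n ,ⁿ p) (y , z , p₁ , a , z≈) →
      let xs = q ∷ el (num r′) ∷ Vec.map can v in
      tower c∈ xs
        (y , z , p₁ , a , ≡-subst (λ s → Rep s z) (sym (inst-raise con xs)) (Rep-≈ (fill con xs) (≈-sym z≈) (fill-can con v q (el (num r′)))))
        (proj₂ (sat-succ (sideEnv xs)) (n , isN (num r′) , ~-sym p))
        (All.map⁺ (All.map (λ {b} t →
          let d , rd = Rep-exists (at (el (num r′)) · at (can (instT b v)))
              y′ , z′ , p′ , a′ , b′ = rd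
          in d , (y′ , z′ , p′ , a′ , ≡-subst (λ s → Rep s z′) (sym (inst-raise b xs))
              (Rep-≈ (fill b xs) (≈-sym b′) (fill-can b v q (el (num r′)))))
            , towers t r′ r≤ (el (num r′)) d (IsNum-num r′) rd) bs)) }

  guards-tall : ∀ P v → (∀ i → Σ[ r ∈ ℕ ] Tall P r (nd (leaf 0) (lookup v i)))
    → All (λ b → Σ[ r ∈ ℕ ] Tall P r (instT b v)) guards
  guards-tall P v h = All.map⁺ {f = λ i → lf 0 · at i} (All.tabulate λ {i} _ → h i)

  tree-tall : ∀ P t → Σ[ r ∈ ℕ ] Tall P r (nd (leaf 0) t)
  -- Entry 0 of this leaf is k + 1, which must not exceed the rank.
  tree-tall P (leaf k) = suc k , tall λ { r′ k<r′ q e (n ,ⁿ p) (y , z , p₁ , a , z≈) →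
    let xs = q ∷ pt ∷ can (leaf k) ∷ pt ∷ pt ∷ pt ∷ pt ∷ pt ∷ []
        u , atu , (nu ,ⁿ pu) = proj₂ (leaf-exists k)
        e′ = u ∷ᵉ sideEnv xs
        p₂ = proj₂ (pair-exists (can (leaf 0)) (can (leaf k)))
        l₂ = can-IsTree (leaf 0)
    in tower (here refl) xs (y , z , p₁ , a , _ , _ , Pair-≈ (≈-sym z≈) p₂ , l₂ , ≈-refl)
      (proj₂ (sat-nat 0 (sideEnv xs)) n , u , proj₂ (sat-at 0 3 0 e′) atu , proj₂ (sat-nat 0 e′) nu
        , (λ z₀ → case IsNum-unique {0} {suc k} (proj₁ (sat-isNum 0 0 e′) z₀) (nu ,ⁿ pu) of λ ())
        , proj₂ (sat-le 0 1 e′ nu n) (≤°-resp (~-sym pu) (~-sym p) (num-≤ k<r′))) [] }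
  tree-tall P (nd s t) =
    -- Variables that do not occur in the rule are guarded too; `leaf 0` fills their places.
    let v = s ∷ t ∷ leaf 0 ∷ leaf 0 ∷ leaf 0 ∷ leaf 0 ∷ []
        z = tree-tall P (leaf 0)
        r , bs = tall-max (guards-tall P v λ { v0 → tree-tall P s ; v1 → tree-tall P t ; v2 → z ; v3 → z ; v4 → z ; v5 → z })
    in suc r , step-tall P nodeRule (there (here refl)) v r bs

  Horn-complete : ∀ {P t} → Horn P t → Σ[ r ∈ ℕ ] Tall P r t
  private
    Horns-complete : ∀ {P v bs} → All (λ b → Horn P (instT b v)) bs → All (λ b → Σ[ r ∈ ℕ ] Tall P r (instT b v)) bs
    Horns-complete [] = []
    Horns-complete (h ∷ hs) = Horn-complete h ∷ Horns-complete hs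
  Horn-complete {P} (tree t) = tree-tall P t
  Horn-complete {P} (rule {c} c∈ v refl hs)
    with r , bs ← tall-max (All.++⁺ (Horns-complete hs) (guards-tall P v λ i → tree-tall P (lookup v i))) =
    suc r , step-tall P c (there (there (∈-map⁺ ranked c∈))) v r bs

-- Provability as a Horn program

codeSign : Sign → Tree
codeSign pos = leaf 0
codeSign neg⁻ = leaf 1

opp-opp : ∀ sg → opp (opp sg) ≡ sg
opp-opp pos = refl
opp-opp neg⁻ = refl

x₀ x₁ x₂ x₃ x₄ x₅ : Shape Var
x₀ = at v0
x₁ = at v1
x₂ = at v2
x₃ = at v3
x₄ = at v4
x₅ = at v5

-- Horn clauses for "α ⊢ D(x)" and "α ⊢ ¬ D(x)", α in the class Σ*ₙ. The parameters are formulas with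
-- the following free variables: leafK k says that 0 is a leaf labelled k, pairK that 2 is the pair
-- of 1 and 0, natK that 0 is a number, leK that 0 is a number below 1.
module Program {L : Lang} (leafK : ℕ → Formula L) (pairK natK leK : Formula L) (n : ℕ) where

  -- Serves as a name for t: the language need not have closed terms, so a sentence mentions t by
  -- defining its representatives.
  treeF : Tree → Formula L
  treeF (leaf k) = leafK k
  treeF (nd s t) = ∃' (treeF s ∧' ∃' (treeF t ∧' pairK))

  template : Formula L → Formula L → Formula L → Formula L
  template t φ ψ = ∀' (natK ⇒' (∃' (t ∧' φ) ⇒' ∃' (leK ∧' ∃' (t ∧' ψ))))

  -- For d = ⟨⌜φ⌝, ⌜ψ⌝⟩: every number satisfying φ with d as its parameter is bounded below by one satisfying ψ.
  diag : Tree → Formula L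
  diag (leaf k) = ⊥'
  diag d@(nd a b) = template (treeF d) (decF a) (decF b)

  -- The derivation rules use only the shift, instantiations and lifts of these, so the infinite
  -- substitutions involved have finite codes. Junk means the shift.
  decσ : Tree → ℕ → Term L
  decσ (nd (leaf 0) t) = decT t ∷σ var
  decσ (nd (leaf 1) s) = liftσ (decσ s)
  decσ _ = λ i → var (suc i)

  decΓ : Tree → List (Formula L)
  decΓ (leaf _) = []
  decΓ (nd a g) = decF a ∷ decΓ g

  -- The intended meaning of a fact, by its tag. Derivability may decode junk harmlessly, but class,
  -- term, vector and numeral facts assert that the tree is exactly a code, as the truth predicate
  -- is understood on codes only. Class facts list a sign along with its opposite, so that negation
  -- just swaps the two.
  Mean : Tree → Set
  Mean (nd (leaf 1) (nd s (nd i t))) = decσ s (decN i) ≡ decT t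
  Mean (nd (leaf 2) (nd s (nd a b))) = substT (decσ s) (decT a) ≡ decT b
  Mean (nd (leaf 3) (nd k (nd s (nd a b)))) = substTs (decσ s) (decTs (decN k) a) ≡ decTs (decN k) b
  Mean (nd (leaf 4) (nd s (nd a b))) = subst (decσ s) (decF a) ≡ decF b
  Mean (nd (leaf 5) (nd a g)) = decF a ∈ decΓ g
  Mean (nd (leaf 6) (nd g h)) = map shift (decΓ g) ≡ decΓ h
  Mean (nd (leaf 7) (nd g a)) = decΓ g ⊢ decF a
  Mean (nd (leaf 8) (nd p (nd q (nd m a)))) = ∀ sg → p ≡ codeSign sg → q ≡ codeSign (opp sg)
    → Σ[ φ ∈ Formula L ] (a ≡ codeF φ × Class sg (decN m) φ)
  Mean (nd (leaf 9) (nd t c)) = decF c ≡ treeF t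
  Mean (nd (leaf 10) (nd a x)) = Σ[ φ ∈ Formula L ] (a ≡ codeF φ × Class pos n φ × (φ ∷ [] ⊢ diag x))
  Mean (nd (leaf 11) (nd a x)) = Σ[ φ ∈ Formula L ] (a ≡ codeF φ × Class pos n φ × (φ ∷ [] ⊢ ¬' (diag x)))
  Mean (nd (leaf 12) i) = Σ[ m ∈ ℕ ] i ≡ codeN m
  Mean (nd (leaf 13) a) = Σ[ t ∈ Term L ] a ≡ codeT t
  Mean (nd (leaf 14) (nd k a)) = Σ[ ts ∈ Vec (Term L) (decN k) ] a ≡ codeTs ts
  Mean _ = ⊤

  substVarS substTermS substFormS : Shape Var → Shape Var → Shape Var → Shape Var
  substVarS s i t = lf 1 · s · i · t
  substTermS s a b = lf 2 · s · a · b
  substFormS s a b = lf 4 · s · a · b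

  substTermsS : Shape Var → Shape Var → Shape Var → Shape Var → Shape Var
  substTermsS k s a b = lf 3 · k · s · a · b

  memberS mapShiftS provesS quoteS vectorS : Shape Var → Shape Var → Shape Var
  memberS a g = lf 5 · a · g
  mapShiftS g h = lf 6 · g · h
  provesS g a = lf 7 · g · a
  quoteS t c = lf 9 · t · c
  vectorS k a = lf 14 · k · a

  numeralS termS : Shape Var → Shape Var
  numeralS i = lf 12 · i
  termS a = lf 13 · a

  class : Shape Var → Shape Var → Shape Var → Shape Var → Shape Var
  class p q m a = lf 8 · p · q · m · a

  ⊥S : Shape Var
  ⊥S = lf 0 · lf 0

  quoted : Formula L → Shape Var
  quoted φ = embed (codeF φ)

  templateS : Shape Var → Shape Var → Shape Var → Shape Var
  templateS t φ ψ = lf 7 · lf 6 · quoted natK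
    · (lf 6 · (lf 8 · lf 4 · t · φ) · (lf 8 · lf 4 · quoted leK · (lf 8 · lf 4 · t · ψ)))

  SoundRule : Rule → Set
  SoundRule r = ∀ v → All (λ b → Mean (instT b v)) (Rule.premises r) → Mean (instT (Rule.conclusion r) v)

  decF-quoted : ∀ φ v → decF (instT (quoted φ) v) ≡ φ
  decF-quoted φ v = trans (cong decF (instT-embed (codeF φ) v)) (decF-codeF φ)

  cong₃ : ∀ {A B C D : Set} (f : A → B → C → D) {a a′ b b′ c c′} → a ≡ a′ → b ≡ b′ → c ≡ c′ → f a b c ≡ f a′ b′ c′
  cong₃ f refl refl refl = refl

  decF-templateS : ∀ t x y v → decF (instT (templateS t x y) v)
    ≡ template (decF (instT t v)) (decF (instT x v)) (decF (instT y v))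
  decF-templateS t x y v = cong₂ (λ φ ψ → ∀' (φ ⇒' (∃' (decF (instT t v) ∧' decF (instT x v)) ⇒' ∃' (ψ ∧' ∃' (decF (instT t v) ∧' decF (instT y v))))))
    (decF-quoted natK v) (decF-quoted leK v)

  -- Each rule comes with its soundness proof, and `apply` refers to rules by their position here.
  -- Clauses only match patterns, so computations such as instantiating or shifting a formula appear
  -- as premises.
  rules : List (Σ Rule SoundRule)
  rules =
      (substVarS (lf 2) x₀ (lf 0 · lf 0 · x₀) ⟸ [] , λ v _ → refl)
    ∷ (substVarS (lf 0 · x₀) (lf 0) x₀ ⟸ [] , λ v _ → refl)
    ∷ (substVarS (lf 0 · x₀) (lf 0 · x₁) (lf 0 · x₁) ⟸ [] , λ v _ → refl)
    ∷ (substVarS (lf 1 · x₀) (lf 0) (lf 0 · lf 0) ⟸ [] , λ v _ → refl)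
    ∷ (substVarS (lf 1 · x₀) (lf 0 · x₁) x₃ ⟸ substVarS x₀ x₁ x₂ ∷ substTermS (lf 2) x₂ x₃ ∷ []
      , λ { v (p ∷ q ∷ []) → trans (cong shiftT p) q })
    ∷ (substTermS x₀ (lf 0 · x₁) x₂ ⟸ substVarS x₀ x₁ x₂ ∷ [] , λ { v (p ∷ []) → p })
    ∷ (substTermsS (lf 0) x₀ (lf 0) (lf 0) ⟸ [] , λ v _ → refl)
    ∷ (substTermsS (lf 0 · x₀) x₁ (x₂ · x₃) (x₄ · x₅) ⟸ substTermS x₁ x₂ x₄ ∷ substTermsS x₀ x₁ x₃ x₅ ∷ []
      , λ { v (p ∷ q ∷ []) → cong₂ _∷_ p q })
    ∷ (substFormS x₀ ⊥S ⊥S ⟸ [] , λ v _ → refl)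
    ∷ (substFormS x₀ (lf 2 · x₁ · x₂) (lf 2 · x₃ · x₄) ⟸ substTermS x₀ x₁ x₃ ∷ substTermS x₀ x₂ x₄ ∷ []
      , λ { v (p ∷ q ∷ []) → cong₂ _≐_ p q })
    ∷ (substFormS x₀ (lf 3 · x₁) (lf 3 · x₂) ⟸ substFormS x₀ x₁ x₂ ∷ [] , λ { v (p ∷ []) → cong ¬' p })
    ∷ (substFormS x₀ (lf 4 · x₁ · x₂) (lf 4 · x₃ · x₄) ⟸ substFormS x₀ x₁ x₃ ∷ substFormS x₀ x₂ x₄ ∷ []
      , λ { v (p ∷ q ∷ []) → cong₂ _∧'_ p q })
    ∷ (substFormS x₀ (lf 5 · x₁ · x₂) (lf 5 · x₃ · x₄) ⟸ substFormS x₀ x₁ x₃ ∷ substFormS x₀ x₂ x₄ ∷ []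
      , λ { v (p ∷ q ∷ []) → cong₂ _∨'_ p q })
    ∷ (substFormS x₀ (lf 6 · x₁ · x₂) (lf 6 · x₃ · x₄) ⟸ substFormS x₀ x₁ x₃ ∷ substFormS x₀ x₂ x₄ ∷ []
      , λ { v (p ∷ q ∷ []) → cong₂ _⇒'_ p q })
    ∷ (substFormS x₀ (lf 7 · x₁) (lf 7 · x₂) ⟸ substFormS (lf 1 · x₀) x₁ x₂ ∷ [] , λ { v (p ∷ []) → cong ∀' p })
    ∷ (substFormS x₀ (lf 8 · x₁) (lf 8 · x₂) ⟸ substFormS (lf 1 · x₀) x₁ x₂ ∷ [] , λ { v (p ∷ []) → cong ∃' p })
    ∷ (memberS x₀ (x₀ · x₁) ⟸ [] , λ v _ → here refl)
    ∷ (memberS x₀ (x₁ · x₂) ⟸ memberS x₀ x₂ ∷ [] , λ { v (p ∷ []) → there p })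
    ∷ (mapShiftS (lf 0) (lf 0) ⟸ [] , λ v _ → refl)
    ∷ (mapShiftS (x₀ · x₁) (x₂ · x₃) ⟸ substFormS (lf 2) x₀ x₂ ∷ mapShiftS x₁ x₃ ∷ []
      , λ { v (p ∷ q ∷ []) → cong₂ _∷_ p q })
    ∷ (provesS x₀ x₁ ⟸ memberS x₁ x₀ ∷ [] , λ { v (p ∷ []) → hyp p })
    ∷ (provesS x₀ x₁ ⟸ provesS ((lf 3 · x₁) · x₀) ⊥S ∷ [] , λ { v (p ∷ []) → raa p })
    ∷ (provesS x₀ (lf 4 · x₁ · x₂) ⟸ provesS x₀ x₁ ∷ provesS x₀ x₂ ∷ [] , λ { v (p ∷ q ∷ []) → ∧I p q })
    ∷ (provesS x₀ x₁ ⟸ provesS x₀ (lf 4 · x₁ · x₂) ∷ [] , λ { v (p ∷ []) → ∧E₁ p })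
    ∷ (provesS x₀ x₂ ⟸ provesS x₀ (lf 4 · x₁ · x₂) ∷ [] , λ { v (p ∷ []) → ∧E₂ p })
    ∷ (provesS x₀ (lf 5 · x₁ · x₂) ⟸ provesS x₀ x₁ ∷ [] , λ { v (p ∷ []) → ∨I₁ p })
    ∷ (provesS x₀ (lf 5 · x₁ · x₂) ⟸ provesS x₀ x₂ ∷ [] , λ { v (p ∷ []) → ∨I₂ p })
    ∷ (provesS x₀ x₃ ⟸ provesS x₀ (lf 5 · x₁ · x₂) ∷ provesS (x₁ · x₀) x₃ ∷ provesS (x₂ · x₀) x₃ ∷ []
      , λ { v (p ∷ q ∷ r ∷ []) → ∨E p q r })
    ∷ (provesS x₀ (lf 6 · x₁ · x₂) ⟸ provesS (x₁ · x₀) x₂ ∷ [] , λ { v (p ∷ []) → ⇒I p })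
    ∷ (provesS x₀ x₂ ⟸ provesS x₀ (lf 6 · x₁ · x₂) ∷ provesS x₀ x₁ ∷ [] , λ { v (p ∷ q ∷ []) → ⇒E p q })
    ∷ (provesS x₀ (lf 3 · x₁) ⟸ provesS (x₁ · x₀) ⊥S ∷ [] , λ { v (p ∷ []) → ¬I p })
    ∷ (provesS x₀ ⊥S ⟸ provesS x₀ (lf 3 · x₁) ∷ provesS x₀ x₁ ∷ [] , λ { v (p ∷ q ∷ []) → ¬E p q })
    ∷ (provesS x₀ (lf 7 · x₁) ⟸ mapShiftS x₀ x₂ ∷ provesS x₂ x₁ ∷ []
      , λ { v (p ∷ q ∷ []) → ∀I (≡-subst (_⊢ decF (lookup v v1)) (sym p) q) })
    ∷ (provesS x₀ x₃ ⟸ provesS x₀ (lf 7 · x₁) ∷ substFormS (lf 0 · x₂) x₁ x₃ ∷ []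
      , λ { v (p ∷ q ∷ []) → ≡-subst (decΓ (lookup v v0) ⊢_) q (∀E p (decT (lookup v v2))) })
    ∷ (provesS x₀ (lf 8 · x₁) ⟸ substFormS (lf 0 · x₂) x₁ x₃ ∷ provesS x₀ x₃ ∷ []
      , λ { v (p ∷ q ∷ []) → ∃I (decT (lookup v v2)) (≡-subst (decΓ (lookup v v0) ⊢_) (sym p) q) })
    ∷ (provesS x₀ x₂ ⟸ provesS x₀ (lf 8 · x₁) ∷ mapShiftS x₀ x₃ ∷ substFormS (lf 2) x₂ x₄ ∷ provesS (x₁ · x₃) x₄ ∷ []
      , λ { v (p ∷ q ∷ r ∷ s ∷ []) → ∃E p (≡-subst₂ (λ g c → decF (lookup v v1) ∷ g ⊢ c) (sym q) (sym r) s) })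
    ∷ (provesS x₀ (lf 2 · x₁ · x₁) ⟸ [] , λ v _ → ≐refl (decT (lookup v v1)))
    ∷ (provesS x₀ x₅ ⟸ provesS x₀ (lf 2 · x₁ · x₂) ∷ substFormS (lf 0 · x₁) x₃ x₄ ∷ provesS x₀ x₄
        ∷ substFormS (lf 0 · x₂) x₃ x₅ ∷ []
      , λ { v (p ∷ q ∷ r ∷ s ∷ []) → ≡-subst (decΓ (lookup v v0) ⊢_) s
          (≐subst {φ = decF (lookup v v3)} p (≡-subst (decΓ (lookup v v0) ⊢_) (sym q) r)) })
    ∷ (class x₀ x₁ x₂ ⊥S ⟸ [] , λ v _ sg _ _ → ⊥' , refl , tt)
    ∷ (class x₀ x₁ x₂ (lf 2 · x₃ · x₄) ⟸ termS x₃ ∷ termS x₄ ∷ []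
      , λ { v ((t , p) ∷ (u , q) ∷ []) sg _ _ → (t ≐ u) , cong₂ (λ a b → nd (leaf 2) (nd a b)) p q , tt })
    ∷ (class x₀ x₁ x₂ (lf 3 · x₃) ⟸ class x₁ x₀ x₂ x₃ ∷ []
      , λ { v (h ∷ []) sg p q → let φ , e , c = h (opp sg) q (trans p (cong codeSign (sym (opp-opp sg)))) in
          ¬' φ , cong (nd (leaf 3)) e , c })
    ∷ (class x₀ x₁ x₂ (lf 4 · x₃ · x₄) ⟸ class x₀ x₁ x₂ x₃ ∷ class x₀ x₁ x₂ x₄ ∷ []
      , λ { v (h ∷ k ∷ []) sg p q → let φ , e , c = h sg p q ; ψ , e′ , c′ = k sg p q in
          (φ ∧' ψ) , cong₂ (λ a b → nd (leaf 4) (nd a b)) e e′ , c , c′ })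
    ∷ (class x₀ x₁ x₂ (lf 5 · x₃ · x₄) ⟸ class x₀ x₁ x₂ x₃ ∷ class x₀ x₁ x₂ x₄ ∷ []
      , λ { v (h ∷ k ∷ []) sg p q → let φ , e , c = h sg p q ; ψ , e′ , c′ = k sg p q in
          (φ ∨' ψ) , cong₂ (λ a b → nd (leaf 5) (nd a b)) e e′ , c , c′ })
    ∷ (class x₀ x₁ x₂ (lf 6 · x₃ · x₄) ⟸ class x₁ x₀ x₂ x₃ ∷ class x₀ x₁ x₂ x₄ ∷ []
      , λ { v (h ∷ k ∷ []) sg p q →
          let φ , e , c = h (opp sg) q (trans p (cong codeSign (sym (opp-opp sg)))) ; ψ , e′ , c′ = k sg p q in
          (φ ⇒' ψ) , cong₂ (λ a b → nd (leaf 6) (nd a b)) e e′ , c , c′ })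
    ∷ (class (lf 0) (lf 1) (lf 0 · x₀) (lf 8 · x₁) ⟸ class (lf 0) (lf 1) (lf 0 · x₀) x₁ ∷ []
      , λ { v (h ∷ []) pos p q → let φ , e , c = h pos refl refl in ∃' φ , cong (nd (leaf 8)) e , c ; v _ neg⁻ () })
    ∷ (class (lf 1) (lf 0) (lf 0 · x₀) (lf 8 · x₁) ⟸ class (lf 0) (lf 1) x₀ (lf 8 · x₁) ∷ []
      , λ { v (h ∷ []) neg⁻ p q → drop-∃ (h pos refl refl) ; v _ pos () })
    ∷ (class (lf 1) (lf 0) (lf 0 · x₀) (lf 7 · x₁) ⟸ class (lf 1) (lf 0) (lf 0 · x₀) x₁ ∷ []
      , λ { v (h ∷ []) neg⁻ p q → let φ , e , c = h neg⁻ refl refl in ∀' φ , cong (nd (leaf 7)) e , c ; v _ pos () })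
    ∷ (class (lf 0) (lf 1) (lf 0 · x₀) (lf 7 · x₁) ⟸ class (lf 1) (lf 0) x₀ (lf 7 · x₁) ∷ []
      , λ { v (h ∷ []) pos p q → drop-∀ (h neg⁻ refl refl) ; v _ neg⁻ () })
    ∷ (numeralS (lf 0) ⟸ [] , λ v _ → 0 , refl)
    ∷ (numeralS (lf 0 · x₀) ⟸ numeralS x₀ ∷ [] , λ { v ((m , e) ∷ []) → suc m , cong (nd (leaf 0)) e })
    ∷ (termS (lf 0 · x₀) ⟸ numeralS x₀ ∷ [] , λ { v ((m , e) ∷ []) → var m , cong (nd (leaf 0)) e })
    ∷ (vectorS (lf 0) (lf 0) ⟸ [] , λ v _ → [] , refl)
    ∷ (vectorS (lf 0 · x₀) (x₁ · x₂) ⟸ termS x₁ ∷ vectorS x₀ x₂ ∷ []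
      , λ { v ((t , p) ∷ (ts , q) ∷ []) → t ∷ ts , cong₂ nd p q })
    ∷ (quoteS (x₀ · x₁) (lf 8 · lf 4 · x₂ · (lf 8 · lf 4 · x₃ · quoted pairK)) ⟸ quoteS x₀ x₂ ∷ quoteS x₁ x₃ ∷ []
      , λ { v (p ∷ q ∷ []) → cong₃ (λ a b c → ∃' (a ∧' ∃' (b ∧' c))) p q (decF-quoted pairK v) })
    ∷ (lf 10 · x₀ · x₁ · x₂ ⟸ class (lf 0) (lf 1) (embed (codeN n)) x₀ ∷ quoteS (x₁ · x₂) x₃
        ∷ provesS (x₀ · lf 0) (templateS x₃ x₁ x₂) ∷ []
      , λ { v (h ∷ p ∷ q ∷ []) → let φ , e , c = h pos refl refl in φ , e , class-n v φ c
          , ≡-subst₂ (λ a b → a ∷ [] ⊢ b) (trans (cong decF e) (decF-codeF φ))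
              (trans (decF-templateS x₃ x₁ x₂ v) (cong (λ t → template t (decF (lookup v v1)) (decF (lookup v v2))) p)) q })
    ∷ (lf 11 · x₀ · x₁ · x₂ ⟸ class (lf 0) (lf 1) (embed (codeN n)) x₀ ∷ quoteS (x₁ · x₂) x₃
        ∷ provesS (x₀ · lf 0) (lf 3 · templateS x₃ x₁ x₂) ∷ []
      , λ { v (h ∷ p ∷ q ∷ []) → let φ , e , c = h pos refl refl in φ , e , class-n v φ c
          , ≡-subst₂ (λ a b → a ∷ [] ⊢ b) (trans (cong decF e) (decF-codeF φ))
              (cong ¬' (trans (decF-templateS x₃ x₁ x₂ v) (cong (λ t → template t (decF (lookup v v1)) (decF (lookup v v2))) p))) q })
    ∷ []
    where
    ≡-subst₂ : ∀ {A B : Set} (R : A → B → Set) {a a′ b b′} → a ≡ a′ → b ≡ b′ → R a b → R a′ b′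
    ≡-subst₂ R refl refl r = r
    class-n : ∀ v φ → Class pos (decN (instT (embed (codeN n)) v)) φ → Class pos n φ
    class-n v φ = ≡-subst (λ m → Class pos m φ) (trans (cong decN (instT-embed (codeN n) v)) (decN-codeN n))
    drop-∃ : ∀ {m a} → Σ[ φ ∈ Formula L ] (nd (leaf 8) a ≡ codeF φ × Class pos m φ)
      → Σ[ φ ∈ Formula L ] (nd (leaf 8) a ≡ codeF φ × Class neg⁻ (suc m) φ)
    drop-∃ (∃' φ , e , c) = ∃' φ , e , c
    drop-∀ : ∀ {m a} → Σ[ φ ∈ Formula L ] (nd (leaf 7) a ≡ codeF φ × Class neg⁻ m φ)
      → Σ[ φ ∈ Formula L ] (nd (leaf 7) a ≡ codeF φ × Class pos (suc m) φ)
    drop-∀ (∀' φ , e , c) = ∀' φ , e , c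

  arityS : ∀ {k} → (Fin k → ℕ) → Fin k → Shape Var
  arityS arity f = embed (codeN (arity f))

  decN-arity : ∀ {k} (arity : Fin k → ℕ) f v → decN (instT (arityS arity f) v) ≡ arity f
  decN-arity arity f v = trans (cong decN (instT-embed (codeN (arity f)) v)) (decN-codeN (arity f))

  substFun substRel termFun classRel : Fin _ → Σ Rule SoundRule
  substFun f = (substTermS x₀ (lf 1 · lf (toℕ f) · x₁) (lf 1 · lf (toℕ f) · x₂) ⟸ substTermsS (arityS (funArity L) f) x₀ x₁ x₂ ∷ []) ,
    λ { v (p ∷ []) → trans (cong (substT _) (decT-fun f _)) (trans (cong (fun f)
      (≡-subst (λ k → substTs (decσ (lookup v v0)) (decTs k (lookup v v1)) ≡ decTs k (lookup v v2)) (decN-arity (funArity L) f v) p))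
        (sym (decT-fun f _))) }
  substRel r = (substFormS x₀ (lf 1 · lf (toℕ r) · x₁) (lf 1 · lf (toℕ r) · x₂) ⟸ substTermsS (arityS (relArity L) r) x₀ x₁ x₂ ∷ []) ,
    λ { v (p ∷ []) → trans (cong (subst _) (decF-rel r _)) (trans (cong (rel r)
      (≡-subst (λ k → substTs (decσ (lookup v v0)) (decTs k (lookup v v1)) ≡ decTs k (lookup v v2)) (decN-arity (relArity L) r v) p))
        (sym (decF-rel r _))) }
  termFun f = (termS (lf 1 · lf (toℕ f) · x₀) ⟸ vectorS (arityS (funArity L) f) x₀ ∷ []) ,
    λ { v (p ∷ []) → let ts , e = ≡-subst (λ k → Σ[ ts ∈ Vec (Term L) k ] lookup v v0 ≡ codeTs ts) (decN-arity (funArity L) f v) p in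
      fun f ts , cong (λ a → nd (leaf 1) (nd (leaf (toℕ f)) a)) e }
  classRel r = (class x₀ x₁ x₂ (lf 1 · lf (toℕ r) · x₃) ⟸ vectorS (arityS (relArity L) r) x₃ ∷ []) ,
    λ { v (p ∷ []) sg _ _ → let ts , e = ≡-subst (λ k → Σ[ ts ∈ Vec (Term L) k ] lookup v v3 ≡ codeTs ts) (decN-arity (relArity L) r v) p in
      rel r ts , cong (λ a → nd (leaf 1) (nd (leaf (toℕ r)) a)) e , tt }

  quoteLeaf : ℕ → Σ Rule SoundRule
  quoteLeaf k = (quoteS (lf k) (quoted (leafK k)) ⟸ []) , λ v _ → decF-quoted (leafK k) v

  -- Labels in codes of formulas are the tags 0, …, 8 and the indices of symbols.
  labels : ℕ
  labels = 9 + (nFun L + nRel L)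

  Horn⇒Mean : ∀ (rs : List (Σ Rule SoundRule)) {t} → Horn (map proj₁ rs) t → Mean t
  private
    Horns⇒Mean : ∀ rs {v bs} → All (λ b → Horn (map proj₁ rs) (instT b v)) bs → All (λ b → Mean (instT b v)) bs
  Horn⇒Mean rs (tree t) = tt
  Horn⇒Mean rs (rule r∈ v refl hs) with (_ , sound) , _ , refl ← ∈-map⁻ proj₁ {xs = rs} r∈ = sound v (Horns⇒Mean rs hs)
  Horns⇒Mean rs [] = []
  Horns⇒Mean rs (h ∷ hs) = Horn⇒Mean rs h ∷ Horns⇒Mean rs hs

  private
    families : List (List (Σ Rule SoundRule))
    families = rules ∷ map substFun (List.allFin (nFun L)) ∷ map substRel (List.allFin (nRel L))
      ∷ map termFun (List.allFin (nFun L)) ∷ map classRel (List.allFin (nRel L)) ∷ map quoteLeaf (List.upTo labels) ∷ []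

  abstract
    program : List Rule
    program = map proj₁ (List.concat families)

    program-sound : ∀ {t} → Horn program t → Mean t
    program-sound = Horn⇒Mean (List.concat families)

    private
      member-of : ∀ {r rs} → r ∈ rs → rs ∈ families → proj₁ r ∈ program
      member-of p q = ∈-map⁺ proj₁ (∈-concat⁺′ p q)

    rules∈ : ∀ i → proj₁ (List.lookup rules i) ∈ program
    rules∈ i = member-of (∈-lookup i) (here refl)

    substFun∈ : ∀ f → proj₁ (substFun f) ∈ program
    substFun∈ f = member-of (∈-map⁺ substFun (∈-allFin f)) (there (here refl))

    substRel∈ : ∀ r → proj₁ (substRel r) ∈ program
    substRel∈ r = member-of (∈-map⁺ substRel (∈-allFin r)) (there (there (here refl)))

    termFun∈ : ∀ f → proj₁ (termFun f) ∈ program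
    termFun∈ f = member-of (∈-map⁺ termFun (∈-allFin f)) (there (there (there (here refl))))

    classRel∈ : ∀ r → proj₁ (classRel r) ∈ program
    classRel∈ r = member-of (∈-map⁺ classRel (∈-allFin r)) (there (there (there (there (here refl)))))

    quoteLeaf∈ : ∀ {k} → k < labels → proj₁ (quoteLeaf k) ∈ program
    quoteLeaf∈ p = member-of (∈-map⁺ quoteLeaf (∈-upTo⁺ p)) (there (there (there (there (there (here refl))))))

  -- Completeness of the program

  ⌜_⌝ : Formula L → Tree
  ⌜_⌝ = codeF

  H : Tree → Set
  H = Horn program

  apply : ∀ (i : Fin (length rules)) v → All (λ b → H (instT b v)) (Rule.premises (proj₁ (List.lookup rules i)))
    → H (instT (Rule.conclusion (proj₁ (List.lookup rules i))) v)
  apply i v = rule {r = proj₁ (List.lookup rules i)} (rules∈ i) v refl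

  z : Tree
  z = leaf 0

  V : Tree → Tree → Tree → Tree → Tree → Tree → Vec Tree 6
  V a b c d e f = a ∷ b ∷ c ∷ d ∷ e ∷ f ∷ []

  data Substitution : Set where
    shiftₛ : Substitution
    instₛ  : Term L → Substitution
    liftₛ  : Substitution → Substitution

  codeS : Substitution → Tree
  codeS shiftₛ = leaf 2
  codeS (instₛ t) = nd (leaf 0) (codeT t)
  codeS (liftₛ s) = nd (leaf 1) (codeS s)

  act : Substitution → ℕ → Term L
  act shiftₛ i = var (suc i)
  act (instₛ t) = t ∷σ var
  act (liftₛ s) = liftσ (act s)

  SubstV⁺ SubstT⁺ : Substitution → Set
  SubstV⁺ s = ∀ i → H (nd (leaf 1) (nd (codeS s) (nd (codeN i) (codeT (act s i)))))
  SubstT⁺ s = ∀ t → H (nd (leaf 2) (nd (codeS s) (nd (codeT t) (codeT (substT (act s) t)))))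

  -- The variable case is a hypothesis because under `liftₛ` it has to shift a term, and so relies
  -- on the term case for `shiftₛ`.
  substT⁺ : ∀ s → SubstV⁺ s → SubstT⁺ s
  substTs⁺ : ∀ s → SubstV⁺ s → ∀ {k} (ts : Vec (Term L) k)
    → H (nd (leaf 3) (nd (codeN k) (nd (codeS s) (nd (codeTs ts) (codeTs (substTs (act s) ts))))))
  substT⁺ s h (var i) = apply (# 5) (V (codeS s) (codeN i) (codeT (act s i)) z z z) (h i ∷ [])
  substT⁺ s h (fun f ts) =
    let v = V (codeS s) (codeTs ts) (codeTs (substTs (act s) ts)) z z z in
    rule {r = proj₁ (substFun f)} (substFun∈ f) v refl
      (≡-subst (λ k → H (nd (leaf 3) (nd k (nd (codeS s) (nd (codeTs ts) (codeTs (substTs (act s) ts)))))))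
        (sym (instT-embed (codeN (funArity L f)) v)) (substTs⁺ s h ts) ∷ [])
  substTs⁺ s h [] = apply (# 6) (V (codeS s) z z z z z) []
  substTs⁺ s h {suc k} (t ∷ ts) =
    apply (# 7) (V (codeN k) (codeS s) (codeT t) (codeTs ts) (codeT (substT (act s) t)) (codeTs (substTs (act s) ts)))
      (substT⁺ s h t ∷ substTs⁺ s h ts ∷ [])

  substV-shift : SubstV⁺ shiftₛ
  substV-shift i = apply (# 0) (V (codeN i) z z z z z) []

  substV⁺ : ∀ s → SubstV⁺ s
  substV⁺ shiftₛ i = substV-shift i
  substV⁺ (instₛ t) zero = apply (# 1) (V (codeT t) z z z z z) []
  substV⁺ (instₛ t) (suc i) = apply (# 2) (V (codeT t) (codeN i) z z z z) []
  substV⁺ (liftₛ s) zero = apply (# 3) (V (codeS s) z z z z z) []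
  substV⁺ (liftₛ s) (suc i) =
    apply (# 4) (V (codeS s) (codeN i) (codeT (act s i)) (codeT (shiftT (act s i))) z z)
      (substV⁺ s i ∷ substT⁺ shiftₛ substV-shift (act s i) ∷ [])

  substF⁺ : ∀ s φ → H (nd (leaf 4) (nd (codeS s) (nd ⌜ φ ⌝ (codeF (subst (act s) φ)))))
  private
    binary : ∀ s φ ψ → Vec Tree 6
    binary s φ ψ = V (codeS s) ⌜ φ ⌝ ⌜ ψ ⌝ (codeF (subst (act s) φ)) (codeF (subst (act s) ψ)) z
  substF⁺ s ⊥' = apply (# 8) (V (codeS s) z z z z z) []
  substF⁺ s (rel r ts) =
    let v = V (codeS s) (codeTs ts) (codeTs (substTs (act s) ts)) z z z in
    rule {r = proj₁ (substRel r)} (substRel∈ r) v refl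
      (≡-subst (λ k → H (nd (leaf 3) (nd k (nd (codeS s) (nd (codeTs ts) (codeTs (substTs (act s) ts)))))))
        (sym (instT-embed (codeN (relArity L r)) v)) (substTs⁺ s (substV⁺ s) ts) ∷ [])
  substF⁺ s (t ≐ u) =
    apply (# 9) (V (codeS s) (codeT t) (codeT u) (codeT (substT (act s) t)) (codeT (substT (act s) u)) z)
      (substT⁺ s (substV⁺ s) t ∷ substT⁺ s (substV⁺ s) u ∷ [])
  substF⁺ s (¬' φ) = apply (# 10) (V (codeS s) ⌜ φ ⌝ (codeF (subst (act s) φ)) z z z) (substF⁺ s φ ∷ [])
  substF⁺ s (φ ∧' ψ) = apply (# 11) (binary s φ ψ) (substF⁺ s φ ∷ substF⁺ s ψ ∷ [])
  substF⁺ s (φ ∨' ψ) = apply (# 12) (binary s φ ψ) (substF⁺ s φ ∷ substF⁺ s ψ ∷ [])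
  substF⁺ s (φ ⇒' ψ) = apply (# 13) (binary s φ ψ) (substF⁺ s φ ∷ substF⁺ s ψ ∷ [])
  substF⁺ s (∀' φ) = apply (# 14) (V (codeS s) ⌜ φ ⌝ (codeF (subst (act (liftₛ s)) φ)) z z z) (substF⁺ (liftₛ s) φ ∷ [])
  substF⁺ s (∃' φ) = apply (# 15) (V (codeS s) ⌜ φ ⌝ (codeF (subst (act (liftₛ s)) φ)) z z z) (substF⁺ (liftₛ s) φ ∷ [])

  codeΓ : List (Formula L) → Tree
  codeΓ [] = leaf 0
  codeΓ (φ ∷ Γ) = nd ⌜ φ ⌝ (codeΓ Γ)

  member⁺ : ∀ {φ Γ} → φ ∈ Γ → H (nd (leaf 5) (nd ⌜ φ ⌝ (codeΓ Γ)))
  member⁺ {φ} {_ ∷ Γ} (here refl) = apply (# 16) (V ⌜ φ ⌝ (codeΓ Γ) z z z z) []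
  member⁺ {φ} {ψ ∷ Γ} (there p) = apply (# 17) (V ⌜ φ ⌝ ⌜ ψ ⌝ (codeΓ Γ) z z z) (member⁺ p ∷ [])

  mapShift⁺ : ∀ Γ → H (nd (leaf 6) (nd (codeΓ Γ) (codeΓ (map shift Γ))))
  mapShift⁺ [] = apply (# 18) (V z z z z z z) []
  mapShift⁺ (φ ∷ Γ) = apply (# 19) (V ⌜ φ ⌝ (codeΓ Γ) ⌜ shift φ ⌝ (codeΓ (map shift Γ)) z z)
    (substF⁺ shiftₛ φ ∷ mapShift⁺ Γ ∷ [])

  proves⁺ : ∀ {Γ φ} → Γ ⊢ φ → H (nd (leaf 7) (nd (codeΓ Γ) ⌜ φ ⌝))
  proves⁺ {Γ} {φ} (hyp p) = apply (# 20) (V (codeΓ Γ) ⌜ φ ⌝ z z z z) (member⁺ p ∷ [])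
  proves⁺ {Γ} {φ} (raa d) = apply (# 21) (V (codeΓ Γ) ⌜ φ ⌝ z z z z) (proves⁺ d ∷ [])
  proves⁺ {Γ} (∧I {φ = φ} {ψ} d e) =
    apply (# 22) (V (codeΓ Γ) ⌜ φ ⌝ ⌜ ψ ⌝ z z z) (proves⁺ d ∷ proves⁺ e ∷ [])
  proves⁺ {Γ} (∧E₁ {φ = φ} {ψ} d) = apply (# 23) (V (codeΓ Γ) ⌜ φ ⌝ ⌜ ψ ⌝ z z z) (proves⁺ d ∷ [])
  proves⁺ {Γ} (∧E₂ {φ = φ} {ψ} d) = apply (# 24) (V (codeΓ Γ) ⌜ φ ⌝ ⌜ ψ ⌝ z z z) (proves⁺ d ∷ [])
  proves⁺ {Γ} (∨I₁ {φ = φ} {ψ} d) = apply (# 25) (V (codeΓ Γ) ⌜ φ ⌝ ⌜ ψ ⌝ z z z) (proves⁺ d ∷ [])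
  proves⁺ {Γ} (∨I₂ {φ = φ} {ψ} d) = apply (# 26) (V (codeΓ Γ) ⌜ φ ⌝ ⌜ ψ ⌝ z z z) (proves⁺ d ∷ [])
  proves⁺ {Γ} (∨E {φ = φ} {ψ} {χ} d e f) =
    apply (# 27) (V (codeΓ Γ) ⌜ φ ⌝ ⌜ ψ ⌝ ⌜ χ ⌝ z z) (proves⁺ d ∷ proves⁺ e ∷ proves⁺ f ∷ [])
  proves⁺ {Γ} (⇒I {φ = φ} {ψ} d) = apply (# 28) (V (codeΓ Γ) ⌜ φ ⌝ ⌜ ψ ⌝ z z z) (proves⁺ d ∷ [])
  proves⁺ {Γ} (⇒E {φ = φ} {ψ} d e) =
    apply (# 29) (V (codeΓ Γ) ⌜ φ ⌝ ⌜ ψ ⌝ z z z) (proves⁺ d ∷ proves⁺ e ∷ [])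
  proves⁺ {Γ} (¬I {φ = φ} d) = apply (# 30) (V (codeΓ Γ) ⌜ φ ⌝ z z z z) (proves⁺ d ∷ [])
  proves⁺ {Γ} (¬E {φ = φ} d e) =
    apply (# 31) (V (codeΓ Γ) ⌜ φ ⌝ z z z z) (proves⁺ d ∷ proves⁺ e ∷ [])
  proves⁺ {Γ} (∀I {φ = φ} d) =
    apply (# 32) (V (codeΓ Γ) ⌜ φ ⌝ (codeΓ (map shift Γ)) z z z) (mapShift⁺ Γ ∷ proves⁺ d ∷ [])
  proves⁺ {Γ} (∀E {φ = φ} d t) =
    apply (# 33) (V (codeΓ Γ) ⌜ φ ⌝ (codeT t) ⌜ φ [ t ] ⌝ z z) (proves⁺ d ∷ substF⁺ (instₛ t) φ ∷ [])
  proves⁺ {Γ} (∃I {φ = φ} t d) =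
    apply (# 34) (V (codeΓ Γ) ⌜ φ ⌝ (codeT t) ⌜ φ [ t ] ⌝ z z) (substF⁺ (instₛ t) φ ∷ proves⁺ d ∷ [])
  proves⁺ {Γ} (∃E {φ = φ} {ψ} d e) =
    apply (# 35) (V (codeΓ Γ) ⌜ φ ⌝ ⌜ ψ ⌝ (codeΓ (map shift Γ)) ⌜ shift ψ ⌝ z)
      (proves⁺ d ∷ mapShift⁺ Γ ∷ substF⁺ shiftₛ ψ ∷ proves⁺ e ∷ [])
  proves⁺ {Γ} (≐refl t) = apply (# 36) (V (codeΓ Γ) (codeT t) z z z z) []
  proves⁺ {Γ} (≐subst {φ = φ} {s} {t} d e) =
    apply (# 37) (V (codeΓ Γ) (codeT s) (codeT t) ⌜ φ ⌝ ⌜ φ [ s ] ⌝ ⌜ φ [ t ] ⌝)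
      (proves⁺ d ∷ substF⁺ (instₛ s) φ ∷ proves⁺ e ∷ substF⁺ (instₛ t) φ ∷ [])

  numeral⁺ : ∀ i → H (nd (leaf 12) (codeN i))
  numeral⁺ zero = apply (# 48) (V z z z z z z) []
  numeral⁺ (suc i) = apply (# 49) (V (codeN i) z z z z z) (numeral⁺ i ∷ [])

  term⁺ : ∀ t → H (nd (leaf 13) (codeT t))
  vector⁺ : ∀ {k} (ts : Vec (Term L) k) → H (nd (leaf 14) (nd (codeN k) (codeTs ts)))
  term⁺ (var i) = apply (# 50) (V (codeN i) z z z z z) (numeral⁺ i ∷ [])
  term⁺ (fun f ts) =
    let v = V (codeTs ts) z z z z z in
    rule {r = proj₁ (termFun f)} (termFun∈ f) v refl
      (≡-subst (λ k → H (nd (leaf 14) (nd k (codeTs ts)))) (sym (instT-embed (codeN (funArity L f)) v)) (vector⁺ ts) ∷ [])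
  vector⁺ [] = apply (# 51) (V z z z z z z) []
  vector⁺ {suc k} (t ∷ ts) = apply (# 52) (V (codeN k) (codeT t) (codeTs ts) z z z) (term⁺ t ∷ vector⁺ ts ∷ [])

  class⁺ : ∀ sg m φ → Class sg m φ
    → H (nd (leaf 8) (nd (codeSign sg) (nd (codeSign (opp sg)) (nd (codeN m) ⌜ φ ⌝))))
  class⁺ sg m ⊥' c = apply (# 38) (V (codeSign sg) (codeSign (opp sg)) (codeN m) z z z) []
  class⁺ sg m (rel r ts) c =
    let v = V (codeSign sg) (codeSign (opp sg)) (codeN m) (codeTs ts) z z in
    rule {r = proj₁ (classRel r)} (classRel∈ r) v refl
      (≡-subst (λ k → H (nd (leaf 14) (nd k (codeTs ts)))) (sym (instT-embed (codeN (relArity L r)) v)) (vector⁺ ts) ∷ [])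
  class⁺ sg m (t ≐ u) c =
    apply (# 39) (V (codeSign sg) (codeSign (opp sg)) (codeN m) (codeT t) (codeT u) z) (term⁺ t ∷ term⁺ u ∷ [])
  class⁺ pos m (¬' φ) c =
    apply (# 40) (V (leaf 0) (leaf 1) (codeN m) ⌜ φ ⌝ z z) (class⁺ neg⁻ m φ c ∷ [])
  class⁺ neg⁻ m (¬' φ) c =
    apply (# 40) (V (leaf 1) (leaf 0) (codeN m) ⌜ φ ⌝ z z) (class⁺ pos m φ c ∷ [])
  class⁺ sg m (φ ∧' ψ) (c , d) =
    apply (# 41) (V (codeSign sg) (codeSign (opp sg)) (codeN m) ⌜ φ ⌝ ⌜ ψ ⌝ z)
      (class⁺ sg m φ c ∷ class⁺ sg m ψ d ∷ [])
  class⁺ sg m (φ ∨' ψ) (c , d) =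
    apply (# 42) (V (codeSign sg) (codeSign (opp sg)) (codeN m) ⌜ φ ⌝ ⌜ ψ ⌝ z)
      (class⁺ sg m φ c ∷ class⁺ sg m ψ d ∷ [])
  class⁺ pos m (φ ⇒' ψ) (c , d) =
    apply (# 43) (V (leaf 0) (leaf 1) (codeN m) ⌜ φ ⌝ ⌜ ψ ⌝ z) (class⁺ neg⁻ m φ c ∷ class⁺ pos m ψ d ∷ [])
  class⁺ neg⁻ m (φ ⇒' ψ) (c , d) =
    apply (# 43) (V (leaf 1) (leaf 0) (codeN m) ⌜ φ ⌝ ⌜ ψ ⌝ z) (class⁺ pos m φ c ∷ class⁺ neg⁻ m ψ d ∷ [])
  class⁺ pos (suc m) (∃' φ) c = apply (# 44) (V (codeN m) ⌜ φ ⌝ z z z z) (class⁺ pos (suc m) φ c ∷ [])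
  class⁺ neg⁻ (suc m) (∃' φ) c = apply (# 45) (V (codeN m) ⌜ φ ⌝ z z z z) (class⁺ pos m (∃' φ) c ∷ [])
  class⁺ neg⁻ (suc m) (∀' φ) c = apply (# 46) (V (codeN m) ⌜ φ ⌝ z z z z) (class⁺ neg⁻ (suc m) φ c ∷ [])
  class⁺ pos (suc m) (∀' φ) c = apply (# 47) (V (codeN m) ⌜ φ ⌝ z z z z) (class⁺ neg⁻ m (∀' φ) c ∷ [])

  Small : Tree → Set
  Small (leaf k) = k < labels
  Small (nd s t) = Small s × Small t

  small-tag : ∀ k → {True (k <ᵇ 9)} → k < labels
  small-tag k {p} = <-≤-trans (<ᵇ⇒< k 9 p) (m≤m+n 9 _)

  small-fun : ∀ f → toℕ {nFun L} f < labels
  small-fun f = <-≤-trans (toℕ<n f) (≤-trans (m≤m+n (nFun L) (nRel L)) (m≤n+m _ 9))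

  small-rel : ∀ r → toℕ {nRel L} r < labels
  small-rel r = <-≤-trans (toℕ<n r) (≤-trans (m≤n+m (nRel L) (nFun L)) (m≤n+m _ 9))

  small-N : ∀ i → Small (codeN i)
  small-N zero = small-tag 0
  small-N (suc i) = small-tag 0 , small-N i

  small-T : ∀ t → Small (codeT t)
  small-Ts : ∀ {k} (ts : Vec (Term L) k) → Small (codeTs ts)
  small-T (var i) = small-tag 0 , small-N i
  small-T (fun f ts) = small-tag 1 , small-fun f , small-Ts ts
  small-Ts [] = small-tag 0
  small-Ts (t ∷ ts) = small-T t , small-Ts ts

  small-F : ∀ φ → Small (codeF φ)
  small-F ⊥' = small-tag 0 , small-tag 0
  small-F (rel r ts) = small-tag 1 , small-rel r , small-Ts ts
  small-F (t ≐ u) = small-tag 2 , small-T t , small-T u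
  small-F (¬' φ) = small-tag 3 , small-F φ
  small-F (φ ∧' ψ) = small-tag 4 , small-F φ , small-F ψ
  small-F (φ ∨' ψ) = small-tag 5 , small-F φ , small-F ψ
  small-F (φ ⇒' ψ) = small-tag 6 , small-F φ , small-F ψ
  small-F (∀' φ) = small-tag 7 , small-F φ
  small-F (∃' φ) = small-tag 8 , small-F φ

  -- The program itself computes the code of the name of a tree; this is the syntactic computation
  -- behind self-reference. Only small labels have a quoting rule.
  quote⁺ : ∀ t → Small t → H (nd (leaf 9) (nd t (codeF (treeF t))))
  quote⁺ (leaf k) p =
    rule {r = proj₁ (quoteLeaf k)} (quoteLeaf∈ p) (V z z z z z z)
      (cong (λ c → nd (leaf 9) (nd (leaf k) c)) (sym (instT-embed (codeF (leafK k)) (V z z z z z z)))) []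
  quote⁺ (nd s t) (p , q) =
    let v = V s t (codeF (treeF s)) (codeF (treeF t)) z z in
    ≡-subst (λ c → H (nd (leaf 9) (nd (nd s t) (nd (leaf 8) (nd (leaf 4) (nd (codeF (treeF s)) (nd (leaf 8) (nd (leaf 4) (nd (codeF (treeF t)) c)))))))))
      (instT-embed (codeF pairK) v)
      (apply (# 53) v (quote⁺ s p ∷ quote⁺ t q ∷ []))

  templateS-code : ∀ t φ ψ v → lookup v v3 ≡ codeF t → lookup v v1 ≡ codeF φ → lookup v v2 ≡ codeF ψ
    → instT (templateS x₃ x₁ x₂) v ≡ codeF (template t φ ψ)
  templateS-code t φ ψ v p q r rewrite p | q | r =
    cong₂ (λ a b → nd (leaf 7) (nd (leaf 6) (nd a (nd (leaf 6) (nd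
        (nd (leaf 8) (nd (leaf 4) (nd (codeF t) (codeF φ))))
        (nd (leaf 8) (nd (leaf 4) (nd b (nd (leaf 8) (nd (leaf 4) (nd (codeF t) (codeF ψ))))))))))))
      (instT-embed (codeF natK) v) (instT-embed (codeF leK) v)

  module _ (α φ ψ : Formula L) (c : Class pos n α) where
    private
      d : Tree
      d = nd (codeF φ) (codeF ψ)

      v : Vec Tree 6
      v = V (codeF α) (codeF φ) (codeF ψ) (codeF (treeF d)) z z

      class-premise : H (instT (class (lf 0) (lf 1) (embed (codeN n)) x₀) v)
      class-premise = ≡-subst (λ k → H (nd (leaf 8) (nd (leaf 0) (nd (leaf 1) (nd k (codeF α))))))
        (sym (instT-embed (codeN n) v)) (class⁺ pos n α c)

      quote-premise : H (instT (quoteS (x₁ · x₂) x₃) v)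
      quote-premise = quote⁺ d (small-F φ , small-F ψ)

      template-code : instT (templateS x₃ x₁ x₂) v ≡ codeF (diag d)
      template-code = trans (templateS-code (treeF d) φ ψ v refl refl refl)
        (cong codeF (cong₂ (template (treeF d)) (sym (decF-codeF φ)) (sym (decF-codeF ψ))))

    proof⁺ : α ∷ [] ⊢ diag d → H (nd (leaf 10) (nd (codeF α) d))
    proof⁺ p = apply (# 54) v (class-premise ∷ quote-premise
      ∷ ≡-subst (λ a → H (nd (leaf 7) (nd (nd (codeF α) z) a))) (sym template-code) (proves⁺ p) ∷ [])

    refutation⁺ : α ∷ [] ⊢ ¬' (diag d) → H (nd (leaf 11) (nd (codeF α) d))
    refutation⁺ p = apply (# 55) v (class-premise ∷ quote-premise
      ∷ ≡-subst (λ a → H (nd (leaf 7) (nd (nd (codeF α) z) (nd (leaf 3) a)))) (sym template-code) (proves⁺ p) ∷ [])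

-- The Rosser sentence

module RosserFormulas {L : Lang} (I : QInterp L) (β : Formula L) (n : ℕ) where
  open Formulas I β
  open SystemFormulas I β
  open TruthFormulas I β
  open HornFormulas I β

  leafK : ℕ → Formula L
  leafK k = subst (clip 1) (leafF k 0)

  pairK natK leK : Formula L
  pairK = subst (clip 3) (pairF 1 0 2)
  natK = subst (clip 1) (natF 0)
  leK = subst (clip 2) (natF 0 ∧' leF 0 1)

  open Program leafK pairK natK leK n public

  opaque
    factF : ℕ → Formula L
    factF tag = ∃' (shapeF (at 3 · lf tag · at 1 · at 2) id 0 ∧' derF (system program) 0)

  opaque
    -- The assignment is a bare leaf, under which all variables take the same value.
    truthF : Formula L
    truthF = ∃' (∃' (leafF 0 1 ∧' shapeF (truthP pos (at 2) (at 1)) id 0 ∧' derF (truth n) 0))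

  clip-bound : ∀ k φ → FVBelow (suc k) (subst (clip (suc k)) φ)
  clip-bound k φ with m , b ← fv φ = bound-subst m (suc k) φ b λ i _ → clipped i
    where
    clipped : ∀ i → True (boundT {L} (suc k) (clip (suc k) i))
    clipped i with i <? suc k
    ... | yes p = <⇒<ᵇ p
    ... | no _ = tt

  opaque
    -- In rank 1 there is a derivation of ⟨tag, α, 0⟩ for some true α.
    searchF : ℕ → Formula L
    searchF tag = subst (clip 2) (∃' (factF tag ∧' truthF))

    searchF-bound : ∀ tag → FVBelow 2 (searchF tag)
    searchF-bound tag = clip-bound 1 (∃' (factF tag ∧' truthF))

  -- The fixed point: `searchF 10` and `searchF 11` look for proofs and refutations of `diag d` with
  -- d as a parameter, and here d becomes the pair of their own codes.
  dossier : Tree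
  dossier = nd (codeF (searchF 10)) (codeF (searchF 11))

  rosser : Formula L
  rosser = diag dossier

  rosser≡ : rosser ≡ template (treeF dossier) (searchF 10) (searchF 11)
  rosser≡ = cong₂ (template (treeF dossier)) (decF-codeF (searchF 10)) (decF-codeF (searchF 11))

  treeF-bound : ∀ t → FVBelow 1 (treeF t)
  treeF-bound (leaf k) = clip-bound 0 (leafF k 0)
  treeF-bound (nd s t) = ∧-join (bound-mono (treeF s) (s≤s z≤n) (treeF-bound s))
    (∧-join (bound-mono (treeF t) (s≤s z≤n) (treeF-bound t)) (clip-bound 2 (pairF 1 0 2)))

  template-bound : ∀ t φ ψ → FVBelow 1 t → FVBelow 2 φ → FVBelow 2 ψ → Sentence (template t φ ψ)
  template-bound t φ ψ a b c = ∧-join (clip-bound 0 (natF 0))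
    (∧-join (∧-join (bound-mono t (s≤s z≤n) a) b)
      (∧-join (clip-bound 1 (natF 0 ∧' leF 0 1)) (∧-join (bound-mono t (s≤s z≤n) a) (bound-mono ψ (s≤s (s≤s z≤n)) c))))

  rosser-sentence : Sentence rosser
  rosser-sentence = ≡-subst Sentence (sym rosser≡)
    (template-bound (treeF dossier) (searchF 10) (searchF 11) (treeF-bound dossier) (searchF-bound 10) (searchF-bound 11))

module RosserLemma {L : Lang} {T : Formula L → Set} (S : Sequential T)
  (M : Model L) (M⊨T : ∀ φ → T φ → ∀ e → Model.sat M φ e) (n : ℕ) where

  open HornLemma S M M⊨T
  open RosserFormulas (Sequential.interp S) (Sequential.β S) n
  open Model M

  sat-treeF : ∀ t e → sat (treeF t) e ⟺ IsTree t (e 0)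
  sat-treeF (leaf k) e = ⟺-trans (sat-subst (leafF k 0) e (clip 1)) (sat-leaf k 0 (eval e ∘ clip 1))
  sat-treeF (nd s t) e = ⟺-trans
    (⟺-Σ λ y → ⟺-× (sat-treeF s (y ∷ᵉ e)) (⟺-Σ λ z → ⟺-× (sat-treeF t (z ∷ᵉ y ∷ᵉ e))
      (⟺-trans (sat-subst (pairF 1 0 2) (z ∷ᵉ y ∷ᵉ e) (clip 3)) (sat-pair 1 0 2 (eval (z ∷ᵉ y ∷ᵉ e) ∘ clip 3)))))
    ((λ (y , q , z , r , p) → y , z , p , q , r) , λ (y , z , p , q , r) → y , q , z , r , p)

  record Search (tag : ℕ) (p d : D) : Set where
    constructor search
    field
      {α f s y} : D
      f-rep     : Rep (at p · lf tag · at α · at d) f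
      derivable : Der (system program) f
      s-leaf    : Leaf 0 s
      y-rep     : Rep (truthP pos (at α) (at s)) y
      verified  : Der (truth n) y

  Fact : ℕ → D → D → D → Set
  Fact tag α d p = Σ[ f ∈ D ] (Rep (at p · lf tag · at α · at d) f × Der (system program) f)

  Verified : D → Set
  Verified α = Σ[ s ∈ D ] Σ[ y ∈ D ] (Leaf 0 s × Rep (truthP pos (at α) (at s)) y × Der (truth n) y)

  opaque
    unfolding factF
    sat-fact : ∀ tag e → sat (factF tag) e ⟺ Fact tag (e 0) (e 1) (e 2)
    sat-fact tag e = ⟺-Σ λ f → ⟺-× (sat-shape (at 3 · lf tag · at 1 · at 2) id 0 (f ∷ᵉ e)) (sat-der (system program) 0 (f ∷ᵉ e))

  opaque
    unfolding truthF
    sat-truth : ∀ e → sat truthF e ⟺ Verified (e 0)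
    sat-truth e = ⟺-Σ λ s → ⟺-Σ λ y → ⟺-× (sat-leaf 0 1 (y ∷ᵉ s ∷ᵉ e))
     (⟺-× (sat-shape (truthP pos (at 2) (at 1)) id 0 (y ∷ᵉ s ∷ᵉ e)) (sat-der (truth n) 0 (y ∷ᵉ s ∷ᵉ e)))

  opaque
    unfolding searchF
    sat-search : ∀ tag e → sat (searchF tag) e ⟺ Search tag (e 1) (e 0)
    sat-search tag e = ⟺-trans (sat-subst (∃' (factF tag ∧' truthF)) e (clip 2)) (⟺-trans
      (⟺-Σ λ α → ⟺-× (sat-fact tag (α ∷ᵉ e′)) (sat-truth (α ∷ᵉ e′)))
      ((λ (α , (f , r , d) , (s , y , l , r′ , d′)) → search {α = α} {f} {s} {y} r d l r′ d′)
      , λ { (search {α = α} {f} {s} {y} r d l r′ d′) → α , (f , r , d) , (s , y , l , r′ , d′) }))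
      where
      e′ : ℕ → D
      e′ = eval e ∘ clip 2

  Found : ℕ → D → Set
  Found tag p = Σ[ d ∈ D ] (IsTree dossier d × Search tag p d)

  sat-found : ∀ tag p e → sat (∃' (treeF dossier ∧' searchF tag)) (p ∷ᵉ e) ⟺ Found tag p
  sat-found tag p e = ⟺-Σ λ d → ⟺-× (sat-treeF dossier (d ∷ᵉ p ∷ᵉ e)) (sat-search tag (d ∷ᵉ p ∷ᵉ e))

  sat-leK : ∀ q (p : Nat°) e → sat leK (q ∷ᵉ el p ∷ᵉ e) ⟺ (Σ[ m ∈ N q ] (q ,° m) ≤° p)
  sat-leK q p e = ⟺-trans (sat-subst (natF 0 ∧' leF 0 1) _ (clip 2))
    ((λ (m , l) → let m′ = proj₁ (sat-nat 0 e′) m in m′ , proj₁ (sat-le 0 1 e′ m′ (isN p)) l)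
    , λ (m , l) → proj₂ (sat-nat 0 e′) m , proj₂ (sat-le 0 1 e′ m (isN p)) l)
    where
    e′ : ℕ → D
    e′ = eval (q ∷ᵉ el p ∷ᵉ e) ∘ clip 2

  sat-natK : ∀ p e → sat natK (p ∷ᵉ e) ⟺ N p
  sat-natK p e = ⟺-trans (sat-subst (natF 0) _ (clip 1)) (sat-nat 0 (eval (p ∷ᵉ e) ∘ clip 1))

  Below : Nat° → Set
  Below p = Σ[ q ∈ D ] ((Σ[ m ∈ N q ] (q ,° m) ≤° p) × Found 11 q)

  belowF : Formula L
  belowF = ∃' (leK ∧' ∃' (treeF dossier ∧' searchF 11))

  sat-below : ∀ p e → sat belowF (el p ∷ᵉ e) ⟺ Below p
  sat-below p e = ⟺-Σ λ q → ⟺-× (sat-leK q p e) (sat-found 11 q (el p ∷ᵉ e))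

  sat-rosser : ∀ e → sat rosser e ⟺ (∀ p → Found 10 (el p) → Below p)
  sat-rosser e = ⟺-trans (⟺-≡ (cong (λ φ → sat φ e) rosser≡))
    ((λ h p f → proj₁ (sat-below p e) (h (el p) (proj₂ (sat-natK (el p) e) (isN p)) (proj₂ (sat-found 10 (el p) e) f)))
    , λ h p m f → proj₂ (sat-below (p ,° proj₁ (sat-natK p e) m) e) (h _ (proj₁ (sat-found 10 p e) f)))

  rosser-env : ∀ e e′ → sat rosser e → sat rosser e′
  rosser-env e e′ = proj₁ (sat-agree 0 rosser rosser-sentence λ _ ())

  IsTree-fact : ∀ tag d′ t {α d v} → IsTree t v → Rep (lf tag · at α · at d) v → IsTree d′ d
    → Σ[ a ∈ Tree ] (t ≡ nd (leaf tag) (nd a d′) × IsTree a α)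
  IsTree-fact tag d′ (leaf k) i (_ , _ , p , _) it = ⊥-elim (Leaf-Pair i p)
  IsTree-fact tag d′ (nd t (leaf k)) (_ , _ , p , _ , i) (_ , _ , p′ , _ , (_ , _ , q , _)) it =
    ⊥-elim (Leaf-Pair (Leaf-≈ (proj₂ (Pair-unique p p′)) i) q)
  IsTree-fact tag d′ (nd t (nd a d)) (_ , _ , p , it , (_ , _ , q , ia , id)) (_ , _ , p′ , l , (_ , _ , q′ , a≈ , d≈)) it′
    with e₁ , e₂ ← Pair-unique p p′
    with e₃ , e₄ ← Pair-unique (Pair-≈ e₂ q) q′ =
    a , cong₂ (λ t d → nd t (nd a d)) (IsTree-unique t (leaf tag) (Rep-≈ (embed t) e₁ it) l)
          (IsTree-unique d d′ (Rep-≈ (embed d) (≈-trans e₄ d≈) id) it′)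
      , Rep-≈ (embed a) (≈-trans e₃ a≈) ia

  -- At a standard rank the object found in M is a genuine Horn derivation. The premise it speaks of
  -- is a standard tree, represented by the very element that M verifies as true.
  search-standard : ∀ tag r {p d} → IsNum r p → IsTree dossier d → Search tag p d
    → ¬ ¬ (Σ[ a ∈ Tree ] Σ[ x ∈ D ] (Horn program (nd (leaf tag) (nd a dossier)) × IsTree a x × Verified x))
  search-standard tag r m it (search {α = α} (u , v , p , u≈ , rv) df l ry dy) =
    Horn-sound program r m (u , v , p , u≈ , ≈-refl) df >>= λ (t , itv , h) →
    let a , t≡ , ia = IsTree-fact tag dossier t itv rv it in
    return (a , α , ≡-subst (Horn program) t≡ h , ia , _ , _ , l , ry , dy)

  true-sat : ∀ φ → Class pos n φ → ∀ {x s y} → IsTree (codeF φ) x → Leaf 0 s → Rep (truthP pos (at x) (at s)) y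
    → Der (truth n) y → sat φ (λ _ → s)
  true-sat φ c ix l ry dy = fact-sound n (previous n) pos φ c (const l λ _ → ≈-refl) (into (embed (codeF φ)) (at _) ix ry) dy

  -- The premise found need not be a sentence. It holds in the constant environment of the empty
  -- assignment, so soundness yields `rosser` there, and `rosser`, being closed, holds in every
  -- environment.
  search-proof : ∀ r {p} → IsNum r p → Found 10 p → ∀ e → sat rosser e
  search-proof r m (d , it , se) e = stable rosser (search-standard 10 r m it se >>= λ (a , x , h , ix , s , y , l , ry , dy) →
    let φ , a≡ , c , d = program-sound h in
    return (rosser-env (λ _ → s) e (sound d (λ _ → s) (true-sat φ c (≡-subst (λ a → IsTree a x) a≡ ix) l ry dy ∷ []))))

  search-refutation : ∀ r {p} → IsNum r p → Found 11 p → ∀ e → ¬ sat rosser e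
  search-refutation r m (d , it , se) e k = search-standard 11 r m it se λ (a , x , h , ix , s , y , l , ry , dy) →
    let φ , a≡ , c , d = program-sound h in
    sound d (λ _ → s) (true-sat φ c (≡-subst (λ a → IsTree a x) a≡ ix) l ry dy ∷ []) (rosser-env e (λ _ → s) k)

  -- The Horn derivation, lifted into M, determines the rank. Truth of φ in M is derivable only up
  -- to double negation, which `Der-stable` removes because derivability is expressed by a formula.
  found : ∀ tag φ → Class pos n φ → (∀ e → sat φ e) → Horn program (nd (leaf tag) (nd (codeF φ) dossier))
    → Σ[ r ∈ ℕ ] Found tag (el (num r))
  found tag φ c valid h with r , t ← Horn-complete h = r , can dossier , can-IsTree dossier ,
    search f-rep′ (Tower⇒Der (Tall.towers t r ≤-refl (el (num r)) _ (IsNum-num r) f-rep)) l ry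
      (Der-stable (truth n) (fact-complete n (previous n) pos φ c (const l λ _ → ≈-refl) (valid _)
        (into (embed (codeF φ)) (at _) (can-IsTree (codeF φ)) ry) >>= λ t → return (Tower⇒Der t)))
    where
    l = proj₂ (leaf-exists 0)
    ry = proj₂ (Rep-exists (truthP pos (at (can (codeF φ))) (at (proj₁ (leaf-exists 0)))))
    fact = nd (leaf tag) (nd (codeF φ) dossier)
    f-rep : Rep (at (el (num r)) · at (can fact)) _
    f-rep = proj₂ (Rep-exists (at (el (num r)) · at (can fact)))
    fact-rep : Rep (lf tag · at (can (codeF φ)) · at (can dossier)) (can fact)
    fact-rep = _ , _ , proj₂ (pair-exists _ _) , proj₂ (leaf-exists tag) , _ , _ , proj₂ (pair-exists _ _) , ≈-refl , ≈-refl
    f-rep′ : Rep (at (el (num r)) · lf tag · at (can (codeF φ)) · at (can dossier)) _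
    f-rep′ = let u , v , p , a , b = f-rep in
      u , v , p , a , Rep-≈ (lf tag · at (can (codeF φ)) · at (can dossier)) (≈-sym b) fact-rep

  -- M satisfies `rosser` nevertheless. A proof found at p ≤ r has standard rank and would make
  -- `rosser` true outright; any other p lies above r, where the refutation is the bound required.
  irrefutable : ∀ φ → Class pos n φ → (∀ e → sat φ e) → ¬ (φ ∷ [] ⊢ ¬' rosser)
  irrefutable φ c valid d = ¬rosser (proj₂ (sat-rosser env) below)
    where
    env : ℕ → D
    env _ = pt
    ¬rosser : ¬ sat rosser env
    ¬rosser = sound d env (valid env ∷ [])
    rf : Σ[ r ∈ ℕ ] Found 11 (el (num r))
    rf = found 11 φ c valid (refutation⁺ φ (searchF 10) (searchF 11) c d)
    below : ∀ p → Found 10 (el p) → Below p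
    below p g = proj₁ (sat-below p env) (stable belowF (≤°-compare (proj₁ rf) p >>= λ
      { (inj₁ p≤r) → ≤°-num (proj₁ rf) p p≤r >>= λ (j , _ , q) → ⊥-elim (¬rosser (search-proof j (isN p ,ⁿ q) g env))
      ; (inj₂ r≤p) → return (proj₂ (sat-below p env) (_ , (isN (num (proj₁ rf)) , r≤p) , proj₂ rf)) }))

  unprovable : ∀ φ → Class pos n φ → (∀ e → sat φ e) → ¬ (φ ∷ [] ⊢ rosser)
  unprovable φ c valid d =
    ≤°-num (proj₁ rf) (proj₁ q ,° proj₁ (proj₁ (proj₂ q))) (proj₂ (proj₁ (proj₂ q))) λ (j , _ , p) →
      search-refutation j (_ ,ⁿ p) (proj₂ (proj₂ q)) env rosser-true
    where
    env : ℕ → D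
    env _ = pt
    rosser-true : sat rosser env
    rosser-true = sound d env (valid env ∷ [])
    rf : Σ[ r ∈ ℕ ] Found 10 (el (num r))
    rf = found 10 φ c valid (proof⁺ φ (searchF 10) (searchF 11) c d)
    q : Below (num (proj₁ rf))
    q = proj₁ (sat-rosser env) rosser-true (num (proj₁ rf)) (proj₂ rf)

-- Reduction to a single premise and the theorem

module _ {L : Lang} where
  conj : List (Formula L) → Formula L
  conj [] = ⊤'
  conj (φ ∷ Γ) = φ ∧' conj Γ

  conj-⊢ : ∀ Γ → All (conj Γ ∷ [] ⊢_) Γ
  conj-⊢ [] = []
  conj-⊢ (φ ∷ Γ) = ∧E₁ (hyp (here refl)) ∷ All.map (cut (∧E₂ (hyp (here refl)) ∷ [])) (conj-⊢ Γ)

  conj-Class : ∀ n Γ → All (Class pos n) Γ → Class pos n (conj Γ)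
  conj-Class n [] [] = tt , tt
  conj-Class n (φ ∷ Γ) (c ∷ cs) = c , conj-Class n Γ cs

  -- A derivation uses finitely many axioms, and their conjunction stays in the class. It is the
  -- single premise α about which the facts with tags 10 and 11 speak.
  single-axiom : ∀ n (A : Formula L → Set) → (∀ φ → A φ → Σ* n φ) → ∀ {φ} → Proves A φ
    → Σ[ α ∈ Formula L ] (Class pos n α × Proves A α × (α ∷ [] ⊢ φ))
  single-axiom n A h (Γ , a , d) = conj Γ , conj-Class n Γ (All.map (λ p → Σ*⇒Class (h _ p)) a)
    , (Γ , a , fold Γ (All.tabulate hyp)) , cut (conj-⊢ Γ) d
    where
    fold : ∀ {Γ} Δ → All (Γ ⊢_) Δ → Γ ⊢ conj Δ
    fold [] [] = ⇒I (hyp (here refl))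
    fold (φ ∷ Δ) (p ∷ ps) = ∧I p (fold Δ ps)

theoremA : (n : ℕ) (L : Lang) (T : Formula L → Set)
    → (∀ φ → T φ → Sentence φ)
    → Consistent T
    → Sequential T
    → Σ[ A ∈ (Formula L → Set) ]
    ((∀ φ → A φ → Sentence φ × Σ* n φ)
    × (∀ ψ → Sentence ψ → (T ψ → Proves A ψ) × (Proves A ψ → T ψ)))
    → Σ[ ψ ∈ Formula L ] (Sentence ψ × ¬ Proves T ψ × ¬ Proves T (¬' ψ))
theoremA n L T closed con S (A , A-Σ , A-T) =
  rosser , rosser-sentence
  , (λ p → let α , c , a , d = axiom p in unprovable α c (valid a) d)
  , (λ p → let α , c , a , d = axiom p in irrefutable α c (valid a) d)
  where
  open RosserFormulas (Sequential.interp S) (Sequential.β S) n using (rosser; rosser-sentence)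
  open Henkin T closed con using (model; model-⊨)
  open RosserLemma S model model-⊨ n using (unprovable; irrefutable)
  open Model model using (sat; sound)

  axiom : ∀ {φ} → Proves T φ → Σ[ α ∈ Formula L ] (Class pos n α × Proves A α × (α ∷ [] ⊢ φ))
  axiom p = single-axiom n A (λ φ a → proj₂ (A-Σ φ a))
    (Proves-cut (λ φ t → proj₁ (A-T φ (closed φ t)) t) p)

  valid : ∀ {α} → Proves A α → ∀ e → sat α e
  valid (Γ , a , d) e = sound d e (All.map (λ {γ} p →
    let s = proj₁ (A-Σ γ p) in model-⊨ γ (proj₂ (A-T γ s) (Proves-hyp p)) e) a)
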